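{- Let $n \in \mathbb{N}$. (1) If $G$ is a dihedral group of order $2n$ with $n \ge 3$, then $\mathsf s(G) = 3n$ if $n$ is odd and $\mathsf s(G) = 2n$ if $n$ is even. (2) If $G$ is a dicyclic group of order $4n$ with $n \ge 2$, then $\mathsf s(G) = 6n$ if $n$ is odd and $\mathsf s(G) = 4n$ if $n$ is even.
   Context: A sequence over a finite group $G$ is a finite unordered list of elements of $G$ with repetitions allowed (an element of the free abelian monoid on $G$); its length is the number of terms, and a subsequence is a sub-multiset. A sequence is product-one if its terms can be ordered so that their product equals the identity $1_G$. $\exp(G) = \operatorname{lcm}\{\operatorname{ord}(g) \mid g \in G\}$. $\mathsf s(G)$ is the smallest integer $\ell$ such that every sequence over $G$ of length at least $\ell$ has a product-one subsequence of length $\exp(G)$. The dihedral group of order $2n$ is $\langle \alpha,\tau \mid \alpha^n=\tau^2=1,\ \tau\alpha=\alpha^{ -1}\tau\rangle$; the dicyclic group of order $4n$ is $\langle \alpha,\tau \mid \alpha^{2n}=1,\ \tau^2=\alpha^n,\ \tau\alpha=\alpha^{ -1}\tau\rangle$. -}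

module Defs where

open import Data.Nat using (ℕ; zero; suc; _+_; _*_; _∸_; _≤_; NonZero)
open import Data.Nat.DivMod using (_%_; m%n<n)
open import Data.Nat.LCM using (lcm)
open import Data.Bool using (Bool; true; false; if_then_else_; not)
open import Data.Bool.Properties using () renaming (_≟_ to _≟ᵇ_)
open import Data.Fin using (Fin; toℕ; fromℕ<)
open import Data.Fin.Properties using () renaming (_≟_ to _≟ᶠ_)
open import Data.Product using (_×_; _,_; ∃; Σ-syntax)
open import Data.Product.Properties using (≡-dec)
open import Data.List using (List; []; _∷_; _++_; length; foldr; map; allFin; cartesianProduct)
open import Data.List.Membership.Propositional using (_∈_)
open import Data.List.Relation.Unary.Any using (here; there)
open import Data.Nat.Properties using (m*n≢0)
open import Data.List.Membership.Propositional.Properties using (∈-allFin; ∈-cartesianProduct⁺)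
open import Data.List.Relation.Binary.Permutation.Propositional using (_↭_)
open import Relation.Binary.PropositionalEquality using (_≡_)
open import Relation.Binary.Definitions using (DecidableEquality)
open import Relation.Nullary.Decidable using (⌊_⌋)

record FinGroup : Set₁ where
  field
    Carrier  : Set
    _∙_      : Carrier → Carrier → Carrier
    ε        : Carrier
    _≟_      : DecidableEquality Carrier
    elements : List Carrier
    complete : ∀ g → g ∈ elements

  pow : Carrier → ℕ → Carrier
  pow g zero    = ε
  pow g (suc k) = g ∙ pow g k

  -- least k ≥ 1 with g ^ k = 1 (searched among 1 .. |elements|, which
  -- suffices in a finite group)
  ordFrom : Carrier → ℕ → ℕ → ℕ
  ordFrom g k zero     = 0
  ordFrom g k (suc f)  = if ⌊ pow g k ≟ ε ⌋ then k else ordFrom g (suc k) f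

  ord : Carrier → ℕ
  ord g = ordFrom g 1 (length elements)

  exp : ℕ
  exp = foldr lcm 1 (map ord elements)

  prod : List Carrier → Carrier
  prod = foldr _∙_ ε

  -- sequences are lists considered up to permutation (multisets)
  -- T is a subsequence (sub-multiset) of S
  IsSubseq : List Carrier → List Carrier → Set
  IsSubseq T S = ∃ λ U → (T ++ U) ↭ S

  ProductOne : List Carrier → Set
  ProductOne T = ∃ λ T' → (T' ↭ T) × (prod T' ≡ ε)

  SProp : ℕ → Set
  SProp ℓ = ∀ (S : List Carrier) → ℓ ≤ length S →
            ∃ λ T → IsSubseq T S × (length T ≡ exp) × ProductOne T

  IsS : ℕ → Set
  IsS ℓ = SProp ℓ × (∀ m → SProp m → ℓ ≤ m)

module _ {n : ℕ} .{{_ : NonZero n}} where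
  _⊕_ : Fin n → Fin n → Fin n
  a ⊕ b = fromℕ< (m%n<n (toℕ a + toℕ b) n)

  ⊖_ : Fin n → Fin n
  ⊖ a = fromℕ< (m%n<n (n ∸ toℕ a) n)

  [_] : ℕ → Fin n
  [ m ] = fromℕ< (m%n<n m n)

elemsFinBool : (n : ℕ) → List (Fin n × Bool)
elemsFinBool n = cartesianProduct (allFin n) (false ∷ true ∷ [])

completeFinBool : (n : ℕ) → (g : Fin n × Bool) → g ∈ elemsFinBool n
completeFinBool n (i , false) = ∈-cartesianProduct⁺ (∈-allFin i) (here _≡_.refl)
completeFinBool n (i , true)  = ∈-cartesianProduct⁺ (∈-allFin i) (there (here _≡_.refl))

-- Dihedral group of order 2n: ⟨α, τ ∣ αⁿ = τ² = 1, τα = α⁻¹τ⟩.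
-- The pair (i , b) stands for αⁱ τᵇ (b = true meaning τ¹).

dihMul : {n : ℕ} .{{_ : NonZero n}} → Fin n × Bool → Fin n × Bool → Fin n × Bool
dihMul (i , false) (j , c) = (i ⊕ j , c)
dihMul (i , true)  (j , c) = (i ⊕ (⊖ j) , not c)

Dihedral : (n : ℕ) .{{_ : NonZero n}} → FinGroup
Dihedral n = record
  { Carrier  = Fin n × Bool
  ; _∙_      = dihMul
  ; ε        = ([ 0 ] , false)
  ; _≟_      = ≡-dec _≟ᶠ_ _≟ᵇ_
  ; elements = elemsFinBool n
  ; complete = completeFinBool n
  }

-- Dicyclic group of order 4n: ⟨α, τ ∣ α²ⁿ = 1, τ² = αⁿ, τα = α⁻¹τ⟩.
-- The pair (i , b), i ∈ ℤ/2nℤ, stands for αⁱ τᵇ.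

module _ (n : ℕ) .{{nz : NonZero n}} where
  private instance
    nz2 : NonZero (2 * n)
    nz2 = m*n≢0 2 n

  dicMul : Fin (2 * n) × Bool → Fin (2 * n) × Bool → Fin (2 * n) × Bool
  dicMul (i , false) (j , c)     = (i ⊕ j , c)
  dicMul (i , true)  (j , false) = (i ⊕ (⊖ j) , true)
  dicMul (i , true)  (j , true)  = ((i ⊕ (⊖ j)) ⊕ [ n ] , false)

  Dicyclic : FinGroup
  Dicyclic = record
    { Carrier  = Fin (2 * n) × Bool
    ; _∙_      = dicMul
    ; ε        = ([ 0 ] , false)
    ; _≟_      = ≡-dec _≟ᶠ_ _≟ᵇ_
    ; elements = elemsFinBool (2 * n)
    ; complete = completeFinBool (2 * n)
    }

{-# OPTIONS --safe #-}
{-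
Writing N for the order of α and τ² = αᶜ, a sequence with at least one reflection has product 1 as soon as
some signed sum of its rotation exponents, some balanced signed sum of its reflection exponents, and c for each
pair of reflections add up to 0 mod N: every sign pattern of the rotations is realised by placing them before or after a reflection.

Lower bounds: with e = exp(G), the sequence 1^(e-1) α^(N-1) τ has no product-one subsequence of length e,
and s(G) = e + N in all four cases.

Upper bounds for even n: after the Erdős–Ginzburg–Ziv theorem for cyclic quotients, only N = 4 and N = 2p with
p an odd prime remain. Pairs inside the four classes modulo ⟨α²⟩ suffice unless all classes are odd; then one
element of each class is taken, and the signs of p - 1 nonzero terms are adjusted.

Upper bounds for odd n: few reflections are handled by growing a symmetric set X ⊆ ℤ/M of signed subsums, two
elements at a time. Either X reaches the required value, and the selection is completed by cancelling pairs, or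
X is a union of cosets of a subgroup containing all remaining terms, to which the theorem for cyclic groups
applies. With many reflections, either equal ones cancel or the distinct ones realise all differences.
-}
module Submission where

open import Defs using (FinGroup; Dihedral; Dicyclic; elemsFinBool)
open import Data.Bool.Base using (Bool; true; false)
open import Data.Empty using (⊥; ⊥-elim)
open import Data.Fin.Base using (Fin; toℕ; fromℕ<)
open import Data.Fin.Properties as Finₚ using (pigeonhole)
open import Data.Integer.Base using (ℤ; +_; -[1+_]; 0ℤ; 1ℤ)
  renaming (∣_∣ to absᶻ; _+_ to infixl 6 _+ᶻ_; _-_ to infixl 6 _-ᶻ_; -_ to infix 8 -ᶻ_; _*_ to infixl 7 _*ᶻ_)
open import Data.Integer.Divisibility.Signed
open import Data.Integer.DivMod using (_%ℕ_; _/ℕ_; n%ℕd<d; a≡a%ℕn+[a/ℕn]*n)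
import Data.Integer.Properties as ℤₚ
import Data.Integer.Tactic.RingSolver as ℤR
open import Data.List.Base using (List; []; _∷_; _++_; length; map; concatMap; lookup; replicate; foldr; applyUpTo; allFin; cartesianProduct)
open import Data.List.Membership.Propositional using (find; lose) renaming (_∈_ to _∈ᴸ_)
open import Data.List.Membership.Propositional.Properties using (∈-lookup; ∈-map⁺)
open import Data.List.Properties using (length-++; length-map; length-replicate; length-applyUpTo; length-tabulate; map-++; ++-assoc; ++-identityʳ; ∷-injective)
open import Data.List.Relation.Binary.Permutation.Propositional as Perm using (_↭_; ↭-refl; ↭-sym; ↭-trans; ↭-reflexive; prep; swap)
import Data.List.Relation.Binary.Permutation.Propositional.Properties as Permₚ
open import Data.List.Relation.Unary.All as All using (All; []; _∷_)
import Data.List.Relation.Unary.All.Properties as Allₚ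
open import Data.List.Relation.Unary.AllPairs as AllPairs using (AllPairs; []; _∷_)
import Data.List.Relation.Unary.AllPairs.Properties as AllPairsₚ
open import Data.List.Relation.Unary.Any as Any using (Any; here; there)
import Data.List.Relation.Unary.Any.Properties as Anyₚ
open import Data.Nat.Base as ℕ using (ℕ; zero; suc; _+_; _*_; _∸_; _⊓_; _≤_; _<_; z≤n; s≤s; NonZero)
import Data.Nat.Divisibility as ℕᵈ
import Data.Nat.DivMod as ℕᵐ
open import Data.Nat.GCD using (module GCD; module Bézout)
open import Data.Nat.LCM using (lcm; m∣lcm[m,n]; n∣lcm[m,n]; lcm-least)
open import Data.Nat.ListAction using (product)
open import Data.Nat.Primality using (Prime; prime⇒irreducible; prime⇒nonZero; ¬prime[1])
open import Data.Nat.Primality.Factorisation using (PrimeFactorisation; factorise)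
import Data.Nat.Properties as ℕₚ
import Data.Nat.Tactic.RingSolver as ℕR
open import Data.Product.Base using (∃; ∃₂; Σ; _×_; _,_; proj₁; proj₂)
open import Data.Sum.Base using (_⊎_; inj₁; inj₂)
open import Function.Base using (_∘_; id; case_of_)
open import Relation.Binary.PropositionalEquality hiding ([_])
open import Relation.Nullary using (¬_; Dec; yes; no; contradiction)
open import Relation.Nullary.Decidable using (decidable-stable; ¬?; _⊎-dec_)

-- For even n the lengths fit exactly. If any 2s terms contain s terms whose product lies in the
-- subgroup generated by αˢ, then 2N terms contain 2(N/s) - 1 disjoint such blocks, which is the
-- number that the cyclic theorem modulo N/s requires. So only blocks among 2s terms have to be
-- found, for s = 4 or s = 2p. In the dicyclic case 4 always divides N, so p enters only with τ² =
-- 1. For odd n = M = 2k + 1 the exponent of the group is 2N. In the dihedral group two reflections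
-- leave 2M - 2 = 4k places for rotations with a prescribed signed sum. In the dicyclic group the
-- same number 4k counts pairs of terms: the condition modulo 2M splits into one modulo 2, settled
-- by forming pairs with even exponent, and one modulo M, where 2 is invertible. The obstacle is
-- that αᴹ is an odd power of α: two reflections form an even pair only if their exponents differ in
-- parity, so the surplus of reflections of one parity governs the case distinction.

-- Linear inequalities and divisibility of integers

-- A certificate for linear inequalities: `a ≤ b` is a sum of hypotheses formed with `_+≤_`, `s` is
-- the slack, and what remains is a ring identity.
≤-by : ∀ {l r a b} s → a ≤ b → l + b + s ≡ r + a → l ≤ r
≤-by {l} {r} {a} {b} s a≤b eq = ℕₚ.+-cancelʳ-≤ a l r (begin
  l + a      ≤⟨ ℕₚ.+-monoʳ-≤ l a≤b ⟩
  l + b      ≤⟨ ℕₚ.m≤m+n (l + b) s ⟩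
  l + b + s  ≡⟨ eq ⟩
  r + a      ∎)
  where open ℕₚ.≤-Reasoning

infixl 6 _+≤_
_+≤_ : ∀ {a b c d} → a ≤ b → c ≤ d → a + c ≤ b + d
_+≤_ = ℕₚ.+-mono-≤

∣-resp : ∀ {k a b} → a ≡ b → k ∣ a → k ∣ b
∣-resp refl d = d

neg-diff : ∀ a b → -ᶻ (a -ᶻ b) ≡ b -ᶻ a
neg-diff = ℤR.solve-∀

∣-sum : ∀ {k a b} → k ∣ a → k ∣ b → k ∣ a +ᶻ b
∣-sum {k} {a} {b} = ∣m∣n⇒∣m+n

∣-neg : ∀ {k a} → k ∣ a → k ∣ -ᶻ a
∣-neg {k} {a} = ∣m⇒∣-m

∣-mul : ∀ {k a} b → k ∣ a → k ∣ b *ᶻ a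
∣-mul {k} {a} b = ∣n⇒∣m*n b

∣-diff : ∀ {k a b} → k ∣ a → k ∣ b → k ∣ a -ᶻ b
∣-diff p q = ∣-sum p (∣-neg q)

∣-zero : ∀ {k} → k ∣ 0ℤ
∣-zero = divides 0ℤ refl

∣-self : ∀ {k} b → k ∣ b *ᶻ k
∣-self b = divides b refl

pos-* : ∀ a b → + (a * b) ≡ + a *ᶻ + b
pos-* a b = ℤₚ.pos-* a b

∣ℕ : ∀ {a b q} → b ≡ q * a → + a ∣ + b
∣ℕ {a} {b} {q} eq = divides (+ q) (trans (cong +_ eq) (pos-* q a))


-- Lists up to permutation, sums over lists, pairings

module ++-Solver (A : Set) where
  open import Algebra.Solver.CommutativeMonoid (Permₚ.++-commutativeMonoid {A = A}) public using (solve; _⊜_; _⊕_)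

module _ {A : Set} where

  ++-comm : (xs ys : List A) → xs ++ ys ↭ ys ++ xs
  ++-comm = Permₚ.++-comm

  ↭-assoc : (xs ys zs : List A) → (xs ++ ys) ++ zs ↭ xs ++ (ys ++ zs)
  ↭-assoc xs ys zs = ↭-reflexive (++-assoc xs ys zs)

  sumBy : (A → ℤ) → List A → ℤ
  sumBy v []       = 0ℤ
  sumBy v (x ∷ xs) = v x +ᶻ sumBy v xs

  sumBy-++ : ∀ v xs ys → sumBy v (xs ++ ys) ≡ sumBy v xs +ᶻ sumBy v ys
  sumBy-++ v []       ys = sym (ℤₚ.+-identityˡ _)
  sumBy-++ v (x ∷ xs) ys = trans (cong (v x +ᶻ_) (sumBy-++ v xs ys)) (sym (ℤₚ.+-assoc (v x) _ _))

  sumBy-↭ : ∀ v {xs ys} → xs ↭ ys → sumBy v xs ≡ sumBy v ys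
  sumBy-↭ v Perm.refl = refl
  sumBy-↭ v (prep x p) = cong (v x +ᶻ_) (sumBy-↭ v p)
  sumBy-↭ v (swap x y p) = trans (cong (λ s → v x +ᶻ (v y +ᶻ s)) (sumBy-↭ v p)) (lem (v x) (v y) _)
    where
    lem : ∀ a b c → a +ᶻ (b +ᶻ c) ≡ b +ᶻ (a +ᶻ c)
    lem = ℤR.solve-∀
  sumBy-↭ v (Perm.trans p q) = trans (sumBy-↭ v p) (sumBy-↭ v q)

  sumBy-∣ : ∀ {k} v {xs} → All (λ x → k ∣ v x) xs → k ∣ sumBy v xs
  sumBy-∣ v []       = ∣-zero
  sumBy-∣ v (p ∷ ps) = ∣-sum p (sumBy-∣ v ps)

  sumBy-* : ∀ k v w {xs} → All (λ x → v x ≡ w x *ᶻ k) xs → sumBy v xs ≡ sumBy w xs *ᶻ k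
  sumBy-* k v w []       = refl
  sumBy-* k v w {x ∷ xs} (p ∷ ps) = trans (cong₂ _+ᶻ_ p (sumBy-* k v w ps)) (sym (ℤₚ.*-distribʳ-+ k (w x) _))

  sumBy-cong : ∀ {k} (v w : A → ℤ) {xs} → All (λ x → k ∣ v x -ᶻ w x) xs → k ∣ sumBy v xs -ᶻ sumBy w xs
  sumBy-cong v w []       = ∣-zero
  sumBy-cong v w {x ∷ xs} (p ∷ ps) = ∣-resp (lem (v x) (w x) _ _) (∣-sum p (sumBy-cong v w ps))
    where
    lem : ∀ a b c d → (a -ᶻ b) +ᶻ (c -ᶻ d) ≡ (a +ᶻ c) -ᶻ (b +ᶻ d)
    lem = ℤR.solve-∀

  splitLength : ∀ n (xs : List A) → n ≤ length xs → ∃₂ λ ys zs → ys ++ zs ≡ xs × length ys ≡ n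
  splitLength zero    xs       p       = [] , xs , refl , refl
  splitLength (suc n) (x ∷ xs) (s≤s p) with ys , zs , refl , refl ← splitLength n xs p = x ∷ ys , zs , refl , refl

  extract : ∀ {P : A → Set} {xs} → Any P xs → ∃₂ λ x ys → P x × x ∷ ys ↭ xs
  extract (here p)  = _ , _ , p , ↭-refl
  extract (there i) with x , ys , p , q ← extract i = x , _ , p , ↭-trans (swap _ _ ↭-refl) (prep _ q)

  AllPairs-lookup : ∀ {R : A → A → Set} {xs} → AllPairs R xs →
                    ∀ (i j : Fin (length xs)) → toℕ i < toℕ j → R (lookup xs i) (lookup xs j)
  AllPairs-lookup (p ∷ ps) Fin.zero    (Fin.suc j) _         = All.lookup p (∈-lookup j)
  AllPairs-lookup (p ∷ ps) (Fin.suc i) (Fin.suc j) (s≤s i<j) = AllPairs-lookup ps i j i<j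

  length-bound : ∀ (f : A → ℕ) n → (∀ x → f x < n) → ∀ {xs} → AllPairs (λ x y → f x ≢ f y) xs → length xs ≤ n
  length-bound f n f<n {xs} ps = ℕₚ.≮⇒≥ λ n<l →
    let i , j , i<j , eq = pigeonhole n<l (λ i → fromℕ< (f<n (lookup xs i)))
    in AllPairs-lookup ps i j i<j
         (trans (sym (Finₚ.toℕ-fromℕ< (f<n _))) (trans (cong toℕ eq) (Finₚ.toℕ-fromℕ< (f<n _))))

  AllPairs-resp-↭ : ∀ {R : A → A → Set} → (∀ {x y} → R x y → R y x) →
                    ∀ {xs ys} → xs ↭ ys → AllPairs R xs → AllPairs R ys
  AllPairs-resp-↭ s Perm.refl        ps                 = ps
  AllPairs-resp-↭ s (prep x p)       (r ∷ ps)           = Permₚ.All-resp-↭ p r ∷ AllPairs-resp-↭ s p ps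
  AllPairs-resp-↭ s (swap x y p)     ((r ∷ rs) ∷ q ∷ ps) =
    (s r ∷ Permₚ.All-resp-↭ p q) ∷ Permₚ.All-resp-↭ p rs ∷ AllPairs-resp-↭ s p ps
  AllPairs-resp-↭ s (Perm.trans p q) ps                 = AllPairs-resp-↭ s q (AllPairs-resp-↭ s p ps)

  flat : List (A × A) → List A
  flat []             = []
  flat ((x , y) ∷ ps) = x ∷ y ∷ flat ps

  flat-length : ∀ ps → length (flat ps) ≡ 2 * length ps
  flat-length []       = refl
  flat-length (_ ∷ ps) = trans (cong (suc ∘ suc) (flat-length ps)) (lem (length ps))
    where
    lem : ∀ n → 2 + 2 * n ≡ 2 * suc n
    lem = ℕR.solve-∀

  flat-++ : ∀ ps qs → flat (ps ++ qs) ≡ flat ps ++ flat qs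
  flat-++ []             qs = refl
  flat-++ ((x , y) ∷ ps) qs = cong (λ l → x ∷ y ∷ l) (flat-++ ps qs)

  flat-↭ : ∀ {ps qs} → ps ↭ qs → flat ps ↭ flat qs
  flat-↭ Perm.refl                       = ↭-refl
  flat-↭ (prep (x , y) p)                = prep x (prep y (flat-↭ p))
  flat-↭ (swap (x , y) (z , w) p)        = ↭-trans (Permₚ.shifts (x ∷ y ∷ []) (z ∷ w ∷ [])) (prep z (prep w (prep x (prep y (flat-↭ p)))))
  flat-↭ (Perm.trans p q)                = ↭-trans (flat-↭ p) (flat-↭ q)

  flat-rest : ∀ {cs R xs} as bs → as ++ bs ≡ cs → flat cs ++ R ↭ xs → flat as ++ (flat bs ++ R) ↭ xs
  flat-rest {R = R} as bs refl p = ↭-trans (↭-reflexive (trans (sym (++-assoc (flat as) (flat bs) R)) (cong (_++ R) (sym (flat-++ as bs))))) p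

  -- The unpaired terms have distinct values of `f`, so `length-bound` limits their number and
  -- thereby bounds the number of pairs from below.
  record Pairing (f : A → ℕ) (xs : List A) : Set where
    constructor pairing
    field
      pairs     : List (A × A)
      rest      : List A
      perm      : flat pairs ++ rest ↭ xs
      equal     : All (λ p → f (proj₁ p) ≡ f (proj₂ p)) pairs
      distinct  : AllPairs (λ x y → f x ≢ f y) rest

  pair-up : ∀ f xs → Pairing f xs
  pair-up f []       = pairing [] [] ↭-refl [] []
  pair-up f (x ∷ xs) with pair-up f xs
  ... | pairing ps ls perm eqs dis with Any.any? (λ y → f x ℕₚ.≟ f y) ls
  ...   | yes i with y , ls′ , e , q ← extract i = pairing ((x , y) ∷ ps) ls′
            (prep x (↭-trans (↭-sym (Permₚ.shift y (flat ps) ls′)) (↭-trans (Permₚ.++⁺ˡ (flat ps) q) perm))) (e ∷ eqs)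
            (AllPairs.tail (AllPairs-resp-↭ ≢-sym (↭-sym q) dis))
  ...   | no ¬i = pairing ps (x ∷ ls) (↭-trans (Permₚ.shift x (flat ps) ls) (prep x perm)) eqs (Allₚ.¬Any⇒All¬ ls ¬i ∷ dis)

-- Residues and subgroups of ℤ/M

module Residue (M : ℕ) {{M≢0 : NonZero M}} where

  res : ℤ → ℕ
  res a = a %ℕ M

  res< : ∀ a → res a < M
  res< a = n%ℕd<d a M

  res-≡ : ∀ a → + M ∣ a -ᶻ + res a
  res-≡ a = divides (a /ℕ M) (trans (cong (_-ᶻ + res a) (a≡a%ℕn+[a/ℕn]*n a M)) (lem (+ res a) _))
    where
    lem : ∀ r q → (r +ᶻ q) -ᶻ r ≡ q
    lem = ℤR.solve-∀

  res-∣ : ∀ {a b} → res a ≡ res b → + M ∣ a -ᶻ b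
  res-∣ {a} {b} eq = ∣-resp (lem a b (+ res b)) (∣-diff (subst (λ r → + M ∣ a -ᶻ + r) eq (res-≡ a)) (res-≡ b))
    where
    lem : ∀ a b r → (a -ᶻ r) -ᶻ (b -ᶻ r) ≡ a -ᶻ b
    lem = ℤR.solve-∀

  ∣-small : ∀ {m n} → m < M → n < M → m ≤ n → + M ∣ + n -ᶻ + m → m ≡ n
  ∣-small {m} {n} m< n< m≤n d with n ∸ m in eq
  ... | zero  = ℕₚ.≤-antisym m≤n (ℕₚ.m∸n≡0⇒m≤n eq)
  ... | suc k = contradiction (ℕᵈ.∣⇒≤ (subst (M ℕᵈ.∣_) abs (∣⇒∣ᵤ d)))
                  (ℕₚ.<⇒≱ (ℕₚ.≤-<-trans (ℕₚ.≤-reflexive (sym eq)) (ℕₚ.≤-<-trans (ℕₚ.m∸n≤m n m) n<)))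
    where
    abs : absᶻ (+ n -ᶻ + m) ≡ suc k
    abs = trans (cong absᶻ (trans (ℤₚ.[+m]-[+n]≡m⊖n n m) (ℤₚ.⊖-≥ m≤n))) eq

  ∣-res : ∀ {a b} → + M ∣ a -ᶻ b → res a ≡ res b
  ∣-res {a} {b} d with ℕₚ.≤-total (res a) (res b)
  ... | inj₁ le = ∣-small (res< a) (res< b) le (∣-resp (lem a b _ _) (∣-diff (∣-diff (res-≡ a) (res-≡ b)) d))
    where
    lem : ∀ a b r s → ((a -ᶻ r) -ᶻ (b -ᶻ s)) -ᶻ (a -ᶻ b) ≡ s -ᶻ r
    lem = ℤR.solve-∀
  ... | inj₂ le = sym (∣-small (res< b) (res< a) le (∣-resp (lem a b _ _) (∣-diff d (∣-diff (res-≡ a) (res-≡ b)))))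
    where
    lem : ∀ a b r s → (a -ᶻ b) -ᶻ ((a -ᶻ r) -ᶻ (b -ᶻ s)) ≡ r -ᶻ s
    lem = ℤR.solve-∀

  Incongruent : List ℤ → Set
  Incongruent = AllPairs (λ a b → ¬ + M ∣ a -ᶻ b)

  incongruent-length : ∀ {X} → Incongruent X → length X ≤ M
  incongruent-length ps = length-bound res M res< (AllPairs.map (λ {a} {b} ¬d eq → ¬d (res-∣ {a} {b} eq)) ps)

  infix 4 _∈ᴹ_
  _∈ᴹ_ : ℤ → List ℤ → Set
  z ∈ᴹ X = Any (λ x → + M ∣ z -ᶻ x) X

  _∈ᴹ?_ : ∀ z X → Dec (z ∈ᴹ X)
  z ∈ᴹ? X = Any.any? (λ x → + M ∣? (z -ᶻ x)) X

  ∈ᴹ-resp : ∀ {X a b} → + M ∣ a -ᶻ b → a ∈ᴹ X → b ∈ᴹ X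
  ∈ᴹ-resp {a = a} {b} d = Any.map (λ {x} e → ∣-resp (lem a b x) (∣-diff e d))
    where
    lem : ∀ a b x → (a -ᶻ x) -ᶻ (a -ᶻ b) ≡ b -ᶻ x
    lem = ℤR.solve-∀

  insert-incongruent : ∀ {z X} → ¬ z ∈ᴹ X → Incongruent X → Incongruent (z ∷ X)
  insert-incongruent z∉ ps = Allₚ.¬Any⇒All¬ _ z∉ ∷ ps

  Closed : (ℤ → Set) → ℤ → Set
  Closed P e = ∀ x → P x → P (x +ᶻ e)

  -- The dichotomy behind the covering arguments below: failure to grow means invariance under
  -- translation by `e`, and the translations preserving a set form a subgroup.
  grow? : ∀ X e → (∃ λ x → x ∈ᴸ X × ¬ (x +ᶻ e) ∈ᴹ X) ⊎ Closed (_∈ᴹ X) e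
  grow? X e with Any.any? (λ x → ¬? ((x +ᶻ e) ∈ᴹ? X)) X
  ... | yes i = inj₁ (find i)
  ... | no ¬i = inj₂ λ x x∈ → closed x x∈
    where
    lem : ∀ x y e → (y +ᶻ e) -ᶻ (x +ᶻ e) ≡ -ᶻ (x -ᶻ y)
    lem = ℤR.solve-∀
    closed : ∀ x → x ∈ᴹ X → (x +ᶻ e) ∈ᴹ X
    closed x x∈ = let y , y∈ , d = find x∈ in
      ∈ᴹ-resp {X} {y +ᶻ e} {x +ᶻ e} (∣-resp (sym (lem x y e)) (∣-neg d))
        (decidable-stable ((y +ᶻ e) ∈ᴹ? X) (λ y∉ → ¬i (lose y∈ y∉)))

  module Closure (P : ℤ → Set) (P-resp : ∀ {a b} → + M ∣ a -ᶻ b → P a → P b) where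

    P-≡ : ∀ {a b} → a ≡ b → P a → P b
    P-≡ refl p = p

    closed-* : ∀ {e} → Closed P e → ∀ n → Closed P (+ n *ᶻ e)
    closed-* {e} c zero    x p = P-≡ (lem x e) p
      where
      lem : ∀ x e → x ≡ x +ᶻ 0ℤ *ᶻ e
      lem = ℤR.solve-∀
    closed-* {e} c (suc n) x p = P-≡ (lem x (+ n) e) (closed-* c n _ (c x p))
      where
      lem : ∀ x n e → (x +ᶻ e) +ᶻ n *ᶻ e ≡ x +ᶻ (1ℤ +ᶻ n) *ᶻ e
      lem = ℤR.solve-∀

    -- Modulo `M`, subtracting `e` is adding it `M - 1` times.
    closed-neg : ∀ {e} → Closed P e → Closed P (-ᶻ e)
    closed-neg {e} c x p = P-resp {x +ᶻ + ℕ.pred M *ᶻ e} {x -ᶻ e} (divides e (trans (lem x e (+ ℕ.pred M)) (cong (e *ᶻ_) (cong +_ (ℕₚ.suc-pred M)))))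
                             (closed-* c (ℕ.pred M) x p)
      where
      lem : ∀ x e m → (x +ᶻ m *ᶻ e) -ᶻ (x -ᶻ e) ≡ e *ᶻ (1ℤ +ᶻ m)
      lem = ℤR.solve-∀

    closed-ℤ* : ∀ {e} → Closed P e → ∀ n → Closed P (n *ᶻ e)
    closed-ℤ* c (+ n)     x p = closed-* c n x p
    closed-ℤ* {e} c -[1+ n ] x p = P-≡ (cong (x +ᶻ_) (trans (ℤₚ.neg-distribˡ-* (+ suc n) e) refl)) (closed-neg (closed-* c (suc n)) x p)

    closed-+ : ∀ {e f} → Closed P e → Closed P f → Closed P (e +ᶻ f)
    closed-+ {e} {f} c d x p = P-≡ (ℤₚ.+-assoc x e f) (d _ (c x p))

    closed-∣∣ : ∀ e → Closed P e → Closed P (+ (absᶻ e))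
    closed-∣∣ (+ n)     c = c
    closed-∣∣ -[1+ n ] c = closed-neg c

    -- Subgroups of ℤ/M are cyclic: `generator` takes for `g` the gcd of `M` and all of `es`,
    -- starting from `M` itself and adjoining one translation at a time by Bézout's identity.
    record Generator (es : List ℤ) : Set where
      field
        g       : ℕ
        g∣M     : + g ∣ + M
        g∣es    : All (+ g ∣_) es
        closed  : Closed P (+ g)

    generator : ∀ es → All (Closed P) es → Generator es
    generator [] [] = record { g = M ; g∣M = ∣-refl ; g∣es = [] ; closed = λ x p → P-resp {x} {x +ᶻ + M} (divides (-ᶻ 1ℤ) (lem x (+ M))) p }
      where
      lem : ∀ x m → x -ᶻ (x +ᶻ m) ≡ (-ᶻ 1ℤ) *ᶻ m
      lem = ℤR.solve-∀
    generator (e ∷ es) (c ∷ cs) with generator es cs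
    ... | record { g = g ; g∣M = g∣M ; g∣es = g∣es ; closed = cg } with Bézout.lemma g (absᶻ e)
    ... | Bézout.result d isgcd b = record
      { g = d ; g∣M = ∣-trans d∣g g∣M ; g∣es = ∣ᵤ⇒∣ (proj₂ (GCD.commonDivisor isgcd)) ∷ All.map (∣-trans d∣g) g∣es ; closed = cd b }
      where
      d∣g : + d ∣ + g
      d∣g = ∣ᵤ⇒∣ (proj₁ (GCD.commonDivisor isgcd))
      lem : ∀ x p q → (x +ᶻ p) +ᶻ q -ᶻ q ≡ x +ᶻ p
      lem = ℤR.solve-∀
      combine : ∀ {a b y z} → Closed P a → Closed P b → + d +ᶻ y *ᶻ b ≡ z *ᶻ a → Closed P (+ d)
      combine {a} {b} {y} {z} ca cb eq x p = P-≡ (trans (cong (λ w → x +ᶻ (w +ᶻ -ᶻ (y *ᶻ b))) (sym eq)) (lem′ x (+ d) (y *ᶻ b)))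
          (closed-+ (closed-ℤ* ca z) (closed-neg (closed-ℤ* cb y)) x p)
        where
        lem′ : ∀ x d q → x +ᶻ ((d +ᶻ q) +ᶻ -ᶻ q) ≡ x +ᶻ d
        lem′ = ℤR.solve-∀
      cast : ∀ {y n x m} → d + y * n ≡ x * m → + d +ᶻ + y *ᶻ + n ≡ + x *ᶻ + m
      cast {y} {n} {x} {m} eq = trans (cong (+ d +ᶻ_) (sym (pos-* y n))) (trans (cong +_ eq) (pos-* x m))
      cd : Bézout.Identity d g (absᶻ e) → Closed P (+ d)
      cd (Bézout.+- x y eq) = combine {y = + y} {z = + x} cg (closed-∣∣ e c) (cast {y} {(absᶻ e)} {x} {g} eq)
      cd (Bézout.-+ x y eq) = combine {y = + x} {z = + y} (closed-∣∣ e c) cg (cast {x} {g} {y} {(absᶻ e)} eq)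

-- The Erdős–Ginzburg–Ziv theorem for cyclic groups

module Cover {I : Set} (v : I → ℤ) where

  module _ {p : ℕ} (prime : Prime p) where
    private instance
      p≢0 : NonZero p
      p≢0 = prime⇒nonZero prime
    open Residue p

    -- A nonzero `e` generates ℤ/p: the divisor `g` of `p` must be 1, since `g = p` would divide
    -- `e`.
    prime-closed : ∀ X e → ¬ + p ∣ e → Closed (_∈ᴹ X) e → 0ℤ ∈ᴹ X → ∀ z → z ∈ᴹ X
    prime-closed X e ne closed z∈ z = go (generator (e ∷ []) (closed ∷ []))
      where
      open Closure (_∈ᴹ X) (λ {a} {b} → ∈ᴹ-resp {X} {a} {b})
      lem : ∀ d → 0ℤ +ᶻ d *ᶻ 1ℤ ≡ d
      lem = ℤR.solve-∀
      go : Generator (e ∷ []) → z ∈ᴹ X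
      go record { g = g ; g∣M = g∣p ; g∣es = g∣e ∷ [] ; closed = closed-g } with prime⇒irreducible prime (∣⇒∣ᵤ g∣p)
      ... | inj₁ refl = P-≡ (lem z) (closed-ℤ* closed-g z 0ℤ z∈)
      ... | inj₂ refl = contradiction g∣e ne

    Reach : List I → ℤ → Set
    Reach used z = ∃₂ λ A B → A ++ B ↭ used × sumBy v A ≡ z

    cover-go : ∀ δ todo used X → All (λ i → ¬ + p ∣ v i) todo → All (Reach used) X → Incongruent X → 0ℤ ∈ᴹ X →
               p ≤ length X + length todo → ∃₂ λ A B → A ++ B ↭ todo ++ used × + p ∣ sumBy v A -ᶻ δ
    cover-go δ [] used X _ reach inc z∈ le with δ ∈ᴹ? X
    ... | yes δ∈ with x , x∈ , d ← find δ∈ with A , B , q , refl ← All.lookup reach x∈ =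
      A , B , q , ∣-resp (neg-diff δ _) (∣-neg d)
    ... | no δ∉ = contradiction (incongruent-length (insert-incongruent {δ} δ∉ inc))
                    (ℕₚ.<⇒≱ (s≤s (ℕₚ.≤-trans le (ℕₚ.≤-reflexive (ℕₚ.+-identityʳ _)))))
    cover-go δ (e ∷ todo) used X (ne ∷ nes) reach inc z∈ le with grow? X (v e)
    ... | inj₁ (x , x∈ , x+e∉) with A , B , q , refl ← All.lookup reach x∈ =
      let A′ , B′ , q′ , d = cover-go δ todo (e ∷ used) ((sumBy v A +ᶻ v e) ∷ X) nes
                               ((e ∷ A , B , prep e q , ℤₚ.+-comm (v e) _) ∷ All.map extend reach)
                               (insert-incongruent x+e∉ inc) (there z∈)
                               (ℕₚ.≤-trans le (ℕₚ.≤-reflexive (ℕₚ.+-suc (length X) (length todo))))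
      in A′ , B′ , ↭-trans q′ (Permₚ.shift e todo used) , d
      where
      extend : ∀ {z} → Reach used z → Reach (e ∷ used) z
      extend (A , B , q , eq) = A , e ∷ B , ↭-trans (Permₚ.shift e A B) (prep e q) , eq
    ... | inj₂ closed with x , x∈ , d ← find (prime-closed X (v e) ne closed z∈ δ) with A , B , q , refl ← All.lookup reach x∈ =
      A , e ∷ todo ++ B , ↭-trans (Permₚ.shifts A (e ∷ todo)) (Permₚ.++⁺ˡ (e ∷ todo) q) , ∣-resp (neg-diff δ _) (∣-neg d)

    cover : ∀ δ items → All (λ i → ¬ + p ∣ v i) items → p ≤ suc (length items) →
            ∃₂ λ A B → A ++ B ↭ items × + p ∣ sumBy v A -ᶻ δ
    cover δ items nes le with A , B , q , d ← cover-go δ items [] (0ℤ ∷ []) nes (([] , [] , ↭-refl , refl) ∷ []) ([] ∷ []) (here ∣-zero) le =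
      A , B , ↭-trans q (↭-reflexive (++-identityʳ items)) , d

map-split : ∀ {A B : Set} (f : A → B) us vs {ws} → us ++ vs ↭ ws → map f us ++ map f vs ↭ map f ws
map-split f us vs p = ↭-trans (↭-reflexive (sym (map-++ f us vs))) (Permₚ.map⁺ f p)

module _ {A B : Set} (els : B → List A) where

  expand : List B → List A
  expand = concatMap els

  expand-++ : ∀ bs cs → expand (bs ++ cs) ≡ expand bs ++ expand cs
  expand-++ []       cs = refl
  expand-++ (b ∷ bs) cs = trans (cong (els b ++_) (expand-++ bs cs)) (sym (++-assoc (els b) _ _))

  expand-↭ : ∀ {bs cs} → bs ↭ cs → expand bs ↭ expand cs
  expand-↭ Perm.refl         = ↭-refl
  expand-↭ (prep b p)        = Permₚ.++⁺ˡ (els b) (expand-↭ p)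
  expand-↭ (swap b c p)      = ↭-trans (Permₚ.shifts (els b) (els c)) (Permₚ.++⁺ˡ (els c) (Permₚ.++⁺ˡ (els b) (expand-↭ p)))
  expand-↭ (Perm.trans p q)  = ↭-trans (expand-↭ p) (expand-↭ q)

  expand-split : ∀ {cs} as bs → as ++ bs ↭ cs → expand as ++ expand bs ↭ expand cs
  expand-split as bs p = ↭-trans (↭-reflexive (sym (expand-++ as bs))) (expand-↭ p)

  expand-rest : ∀ {cs R S} as bs → as ++ bs ↭ cs → expand cs ++ R ↭ S → expand as ++ (expand bs ++ R) ↭ S
  expand-rest {R = R} as bs p q = ↭-trans (↭-sym (↭-assoc (expand as) (expand bs) R)) (↭-trans (Permₚ.++⁺ʳ R (expand-split as bs p)) q)

  expand-sum : ∀ v bs → sumBy v (expand bs) ≡ sumBy (sumBy v ∘ els) bs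
  expand-sum v []       = refl
  expand-sum v (b ∷ bs) = trans (sumBy-++ v (els b) _) (cong (sumBy v (els b) +ᶻ_) (expand-sum v bs))

  expand-length : ∀ {s bs} → All (λ b → length (els b) ≡ s) bs → length (expand bs) ≡ length bs * s
  expand-length []       = refl
  expand-length {bs = b ∷ bs} (p ∷ ps) = trans (length-++ (els b)) (cong₂ _+_ p (expand-length ps))

  private
    blocks-eq₁ : ∀ ℓ js s n → ℓ + (n + s) + js ≡ n + (ℓ + (s + js))
    blocks-eq₁ = ℕR.solve-∀
    blocks-eq₂ : ∀ ℓ js s n → ℓ + js + (n + s) + 0 ≡ n + (ℓ + (s + js))
    blocks-eq₂ = ℕR.solve-∀

  -- Greedy extraction: before the last block is taken, `ℓ` terms must still be present. This is the
  -- bound `ℓ + (j - 1) * s ≤ length xs`, with one `s` moved to the right to avoid subtraction.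
  blocks : ∀ s ℓ → (∀ b → length (els b) ≡ s) → (∀ xs → ℓ ≤ length xs → ∃₂ λ b rest → els b ++ rest ↭ xs) →
           ∀ j xs → ℓ + j * s ≤ length xs + s → ∃₂ λ bs rest → expand bs ++ rest ↭ xs × length bs ≡ j
  blocks s ℓ size take zero    xs le = [] , xs , ↭-refl , refl
  blocks s ℓ size take (suc j) xs le
    with b , rest , p ← take xs (≤-by (j * s) le (blocks-eq₁ ℓ (j * s) s (length xs)))
    with bs , rest′ , p′ , eq ← blocks s ℓ size take j rest
           (≤-by 0 le (trans (blocks-eq₂ ℓ (j * s) s (length xs)) (cong (_+ (ℓ + (s + j * s))) (trans (sym (Permₚ.↭-length p)) (trans (length-++ (els b)) (trans (cong (_+ length rest) (size b)) (ℕₚ.+-comm s _)))))))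
    = b ∷ bs , rest′ , ↭-trans (↭-assoc (els b) _ _) (↭-trans (Permₚ.++⁺ˡ (els b) p′) p) , cong suc eq

record Chosen {I : Set} (v : I → ℤ) (n l : ℕ) (xs : List I) : Set where
  constructor chosen
  field
    sel   : List I
    rest  : List I
    perm  : sel ++ rest ↭ xs
    size  : length sel ≡ l
    div   : + n ∣ sumBy v sel

-- The hypothesis is the bound 2n - 1 on the length. The type of items varies because in `egz-*` the
-- blocks found for one factor become the items for the other.
Egz : ℕ → Set₁
Egz n = ∀ {I : Set} (v : I → ℤ) xs → n + n ≤ suc (length xs) → Chosen v n n xs

record Blk {I : Set} (v : I → ℤ) (n : ℕ) : Set where
  constructor blk
  field
    els  : List I
    size : length els ≡ n
    div  : + n ∣ sumBy v els

egz-blocks : ∀ {n} → Egz n → ∀ {I : Set} (v : I → ℤ) k xs → n + k * n ≤ suc (length xs) →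
             ∃₂ λ (bs : List (Blk v n)) rest → expand Blk.els bs ++ rest ↭ xs × length bs ≡ k
egz-blocks {zero}  egz v k xs le = replicate k (blk [] refl ∣-zero) , xs , Permₚ.++⁺ʳ xs (↭-reflexive (lem k)) , length-replicate k
  where
  lem : ∀ k → expand Blk.els (replicate k (blk [] refl ∣-zero)) ≡ []
  lem zero = refl
  lem (suc k) = lem k
egz-blocks {suc n} egz {I} v k xs le = blocks Blk.els (suc n) (n + suc n) Blk.size take k xs
    (≤-by 0 le (lem n k (length xs)))
  where
  lem : ∀ n k l → n + suc n + k * suc n + suc l + 0 ≡ l + suc n + (suc n + k * suc n)
  lem = ℕR.solve-∀
  take : ∀ xs → n + suc n ≤ length xs → ∃₂ λ (b : Blk v (suc n)) rest → Blk.els b ++ rest ↭ xs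
  take xs le with chosen sel rest p s d ← egz v xs (s≤s le) = blk sel s d , rest , p

egz-multi : ∀ {n} → Egz n → ∀ {I : Set} (v : I → ℤ) k xs → n + k * n ≤ suc (length xs) → Chosen v n (k * n) xs
egz-multi egz v k xs le with bs , rest , p , refl ← egz-blocks egz v k xs le =
  chosen (expand Blk.els bs) rest p (expand-length Blk.els (All.universal Blk.size bs))
    (∣-resp (sym (expand-sum Blk.els v bs)) (sumBy-∣ _ (All.universal Blk.div bs)))

private
  egz-*-eq : ∀ m n l → m + (n + suc n) * m + suc l + 0 ≡ suc l + (m * suc n + m * suc n)
  egz-*-eq = ℕR.solve-∀

-- Among 2mn - 1 terms there are 2n - 1 disjoint blocks of `m` terms with sum divisible by `m`; the
-- theorem for `n` is applied to these sums divided by `m`.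
egz-* : ∀ {m n} → Egz m → Egz n → Egz (m * n)
egz-* {m} {zero}  egzm egzn v xs le = chosen [] xs ↭-refl (sym (ℕₚ.*-zeroʳ m)) ∣-zero
egz-* {m} {suc n} egzm egzn v xs le
  with bs , rest , p , eq ← egz-blocks egzm v (n + suc n) xs (≤-by 0 le (egz-*-eq m n (length xs)))
  with chosen sel rest′ p′ s d ← egzn (λ b → quotient (Blk.div b)) bs (ℕₚ.≤-reflexive (cong suc (sym eq)))
  = chosen (expand Blk.els sel) (expand Blk.els rest′ ++ rest)
      (expand-rest Blk.els sel rest′ p′ p)
      (trans (expand-length Blk.els (All.universal Blk.size sel)) (trans (cong (_* m) s) (ℕₚ.*-comm (suc n) m)))
      (∣-resp (sym (trans (expand-sum Blk.els v sel) (sumBy-* (+ m) _ (λ b → quotient (Blk.div b)) (All.universal (λ b → _∣_.equality (Blk.div b)) sel))))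
        (divides (quotient d) (trans (cong (_*ᶻ + m) (_∣_.equality d)) (lem′ (quotient d) (+ suc n) (+ m) (pos-* m (suc n))))))
  where
  lem′ : ∀ q n m {mn} → mn ≡ m *ᶻ n → q *ᶻ n *ᶻ m ≡ q *ᶻ mn
  lem′ q n m refl = lem″ q n m
    where
    lem″ : ∀ q n m → q *ᶻ n *ᶻ m ≡ q *ᶻ (m *ᶻ n)
    lem″ = ℤR.solve-∀

egz-1 : Egz 1
egz-1 v (x ∷ xs) le = chosen (x ∷ []) xs ↭-refl refl (divides (v x +ᶻ 0ℤ) (sym (ℤₚ.*-identityʳ (v x +ᶻ 0ℤ))))
egz-1 v []       (s≤s ())

module _ {I : Set} (f : I → ℕ) where

  -- The field `alt` says that the pairing into distinct values cannot be enlarged: a pair avoiding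
  -- `κ` could be split and matched with two of the terms in `same`.
  record Greedy (xs : List I) : Set where
    constructor greedy
    field
      pairs     : List (I × I)
      κ         : ℕ
      same      : List I
      perm      : flat pairs ++ same ↭ xs
      distinct  : All (λ p → f (proj₁ p) ≢ f (proj₂ p)) pairs
      allκ      : All (λ x → f x ≡ κ) same
      alt       : length same ≤ 1 ⊎ All (λ p → f (proj₁ p) ≡ κ ⊎ f (proj₂ p) ≡ κ) pairs

  has? : ∀ κ (p : I × I) → Dec (f (proj₁ p) ≡ κ ⊎ f (proj₂ p) ≡ κ)
  has? κ (x , y) = (f x ℕₚ.≟ κ) ⊎-dec (f y ℕₚ.≟ κ)

  greedily : ∀ xs → Greedy xs
  greedily [] = greedy [] 0 [] ↭-refl [] [] (inj₁ z≤n)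
  greedily (x ∷ xs) with greedily xs
  ... | greedy ps κ [] p dis al alt = greedy ps (f x) (x ∷ []) (↭-trans (Permₚ.shift x (flat ps) []) (prep x p)) dis (refl ∷ []) (inj₁ ℕₚ.≤-refl)
  ... | greedy ps κ (y ∷ ys) p dis (e ∷ al) alt with f x ℕₚ.≟ κ
  ...   | no ne = greedy ((x , y) ∷ ps) κ ys (prep x (↭-trans (↭-sym (Permₚ.shift y (flat ps) ys)) p)) ((λ q → ne (trans q e)) ∷ dis) al (alt′ alt)
    where
    alt′ : _ → length ys ≤ 1 ⊎ _
    alt′ (inj₁ (s≤s le)) = inj₁ (ℕₚ.m≤n⇒m≤1+n le)
    alt′ (inj₂ h)        = inj₂ (inj₂ e ∷ h)
  ...   | yes e′ with All.all? (has? κ) ps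
  ...     | yes h = greedy ps κ (x ∷ y ∷ ys) (↭-trans (Permₚ.shift x (flat ps) (y ∷ ys)) (prep x p)) dis (e′ ∷ e ∷ al) (inj₂ h)
  ...     | no ¬h = improve ys p alt (extract (Allₚ.¬All⇒Any¬ (has? κ) ps ¬h))
    where
    improve : ∀ ys → flat ps ++ y ∷ ys ↭ xs → suc (length ys) ≤ 1 ⊎ All (λ p → f (proj₁ p) ≡ κ ⊎ f (proj₂ p) ≡ κ) ps →
              (∃₂ λ r qs → ¬ (f (proj₁ r) ≡ κ ⊎ f (proj₂ r) ≡ κ) × r ∷ qs ↭ ps) → Greedy (x ∷ xs)
    improve _        _ (inj₂ h)        _ = contradiction h ¬h
    improve (_ ∷ _)  _ (inj₁ (s≤s ())) _
    -- Neither `a` nor `b` has value `κ`, while `x` and `y` do; re-pairing crosswise leaves nothing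
    -- over.
    improve []       p (inj₁ _)        ((a , b) , qs , ¬ab , q) with _ ∷ dis′ ← Permₚ.All-resp-↭ (↭-sym q) dis =
      greedy ((a , x) ∷ (b , y) ∷ qs) κ []
        (↭-trans (swap a x (prep b (↭-sym (Permₚ.shift y (flat qs) [])))) (prep x (↭-trans (Permₚ.++⁺ʳ (y ∷ []) (flat-↭ q)) p)))
        ((λ h → ¬ab (inj₁ (trans h e′))) ∷ (λ h → ¬ab (inj₂ (trans h e))) ∷ dis′) [] (inj₁ z≤n)

module _ {A : Set} where

  firsts seconds : List (A × A) → List A
  firsts  = map proj₁
  seconds = map proj₂

  flat-unzip : ∀ ps → flat ps ↭ firsts ps ++ seconds ps
  flat-unzip []             = ↭-refl
  flat-unzip ((x , y) ∷ ps) = prep x (↭-trans (prep y (flat-unzip ps)) (↭-sym (Permₚ.shift y (firsts ps) (seconds ps))))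

  pick-each : ∀ {P : A → Set} ps → All (λ p → P (proj₁ p) ⊎ P (proj₂ p)) ps →
              ∃₂ λ as bs → as ++ bs ↭ flat ps × length as ≡ length ps × All P as
  pick-each []             []       = [] , [] , ↭-refl , refl , []
  pick-each ((x , y) ∷ ps) (h ∷ hs) with as , bs , p , l , al ← pick-each ps hs | h
  ... | inj₁ px = x ∷ as , y ∷ bs , prep x (↭-trans (Permₚ.shift y as bs) (prep y p)) , cong suc l , px ∷ al
  ... | inj₂ py = y ∷ as , x ∷ bs , ↭-trans (prep y (↭-trans (Permₚ.shift x as bs) (prep x p))) (swap y x ↭-refl) , cong suc l , py ∷ al

-- Given p - 1 pairs of distinct residues, one term of each pair and one further term make p terms,
-- and switching a choice changes the sum by a nonzero difference, so `cover` reaches every residue.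
-- With fewer pairs, maximality of the pairing makes one residue occur at least p times.
egz-prime : ∀ {p} → Prime p → Egz p
egz-prime {p} pr {I} v xs le = cases (greedily f xs)
  where
  instance
    p≢0 : NonZero p
    p≢0 = prime⇒nonZero pr
  open Residue p
  f : I → ℕ
  f = res ∘ v

  diff : I × I → ℤ
  diff (x , y) = v x -ᶻ v y

  sum-const : ∀ c {ys} → All (λ y → f y ≡ c) ys → + p ∣ sumBy v ys -ᶻ + length ys *ᶻ + c
  sum-const c [] = ∣-zero
  sum-const c {y ∷ ys} (refl ∷ al) = ∣-resp (lem (v y) (+ c) (sumBy v ys) (+ length ys)) (∣-sum (res-≡ (v y)) (sum-const c al))
    where
    lem : ∀ y c s l → (y -ᶻ c) +ᶻ (s -ᶻ l *ᶻ c) ≡ (y +ᶻ s) -ᶻ (1ℤ +ᶻ l) *ᶻ c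
    lem = ℤR.solve-∀

  diff-sum : ∀ ps → sumBy v (firsts ps) ≡ sumBy diff ps +ᶻ sumBy v (seconds ps)
  diff-sum []             = refl
  diff-sum ((x , y) ∷ ps) = trans (cong (v x +ᶻ_) (diff-sum ps)) (lem (v x) (v y) _ _)
    where
    lem : ∀ x y a b → x +ᶻ (a +ᶻ b) ≡ ((x -ᶻ y) +ᶻ a) +ᶻ (y +ᶻ b)
    lem = ℤR.solve-∀

  perm-eq : ∀ {as bs cs ds es fs : List I} {z} → (as ++ bs) ++ (cs ++ ds) ↭ es → es ++ (z ∷ fs) ↭ xs →
            (z ∷ as ++ ds) ++ (bs ++ cs ++ fs) ↭ xs
  perm-eq {as} {bs} {cs} {ds} {es} {fs} {z} q q′ = ↭-trans (↭-trans (prep z (step as bs cs ds fs)) (↭-sym (Permₚ.shift z ((as ++ bs) ++ (cs ++ ds)) fs))) (↭-trans (Permₚ.++⁺ʳ (z ∷ fs) q) q′)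
    where
    open ++-Solver I
    step : ∀ as bs cs ds fs → (as ++ ds) ++ (bs ++ cs ++ fs) ↭ ((as ++ bs) ++ (cs ++ ds)) ++ fs
    step = solve 5 (λ as bs cs ds fs → (as ⊕ ds) ⊕ (bs ⊕ (cs ⊕ fs)) ⊜ ((as ⊕ bs) ⊕ (cs ⊕ ds)) ⊕ fs) ↭-refl

  many : ∀ ps rest → suc (length ps) ≡ p → All (λ q → f (proj₁ q) ≢ f (proj₂ q)) ps → ∀ z → flat ps ++ (z ∷ rest) ↭ xs → Chosen v p p xs
  many ps rest l dis z perm
    -- The starting choice is all second terms and `z`; the pairs in `A` are switched to their first
    -- terms, and the switches have to cancel the starting sum.
    with A , B , q , d ← Cover.cover diff pr (-ᶻ (sumBy v (seconds ps) +ᶻ v z)) ps (All.map (λ {r} ne d → ne (∣-res {v (proj₁ r)} {v (proj₂ r)} d)) dis) (ℕₚ.≤-reflexive (sym l))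
    = chosen (z ∷ firsts A ++ seconds B) (seconds A ++ firsts B ++ rest)
        (perm-eq {firsts A} {seconds A} {firsts B} {seconds B} {flat ps}
          (↭-trans (Permₚ.++⁺ (↭-sym (flat-unzip A)) (↭-sym (flat-unzip B))) (↭-trans (↭-reflexive (sym (flat-++ A B))) (flat-↭ q))) perm)
        (trans (cong suc (trans (length-++ (firsts A)) (trans (cong₂ _+_ (length-map proj₁ A) (length-map proj₂ B))
          (trans (sym (length-++ A)) (Permₚ.↭-length q))))) l)
        (∣-resp (trans (lem (sumBy diff A) (sumBy v (seconds ps)) (v z) (sumBy v (seconds A)) (sumBy v (seconds B)) sec)
            (cong (v z +ᶻ_) (trans (cong (_+ᶻ sumBy v (seconds B)) (sym (diff-sum A))) (sym (sumBy-++ v (firsts A) _))))) d)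
    where
    lem : ∀ a s z sa sb → s ≡ sa +ᶻ sb → a -ᶻ (-ᶻ (s +ᶻ z)) ≡ z +ᶻ ((a +ᶻ sa) +ᶻ sb)
    lem a s z sa sb refl = lem′ a z sa sb
      where
      lem′ : ∀ a z sa sb → a -ᶻ (-ᶻ ((sa +ᶻ sb) +ᶻ z)) ≡ z +ᶻ ((a +ᶻ sa) +ᶻ sb)
      lem′ = ℤR.solve-∀
    sec : sumBy v (seconds ps) ≡ sumBy v (seconds A) +ᶻ sumBy v (seconds B)
    sec = trans (sumBy-↭ v (Permₚ.map⁺ proj₂ (↭-sym q))) (trans (cong (sumBy v) (map-++ proj₂ A B)) (sumBy-++ v (seconds A) _))

  few : ∀ c ys rest → All (λ y → f y ≡ c) ys → p ≤ length ys → ys ++ rest ↭ xs → Chosen v p p xs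
  few c ys rest al le perm with zs , ws , refl , l ← splitLength p ys le =
    chosen zs (ws ++ rest) (↭-trans (↭-sym (↭-assoc zs ws rest)) perm) l
      (∣-resp (lem (sumBy v zs) (+ length zs *ᶻ + c)) (∣-sum (sum-const c (Allₚ.++⁻ˡ zs al)) (∣-resp (trans (ℤₚ.*-comm (+ c) (+ p)) (cong (λ n → + n *ᶻ + c) (sym l))) (∣-self (+ c)))))
    where
    lem : ∀ a b → (a -ᶻ b) +ᶻ b ≡ a
    lem = ℤR.solve-∀

  nonempty : ∀ (ys : List I) → 1 ≤ length ys → ∃₂ λ z zs → ys ≡ z ∷ zs
  nonempty (z ∷ zs) _ = z , zs , refl

  total : ∀ ps same → flat ps ++ same ↭ xs → p + p ≤ suc (2 * length ps + length same)
  total ps same perm = subst (λ n → p + p ≤ suc n)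
    (trans (sym (Permₚ.↭-length perm)) (trans (length-++ (flat ps)) (cong (_+ length same) (flat-length ps)))) le

  cases : Greedy f xs → Chosen v p p xs
  cases (greedy ps κ same perm dis al alt) with p ℕₚ.≤? suc (length ps)
  ... | yes p≤ with pre , post , refl , l ← splitLength (ℕ.pred p) ps (ℕₚ.pred-mono-≤ p≤) =
    let z , zs , eq = nonempty (flat post ++ same) (≤-by 0 (total pre (flat post ++ same) perm′) (lem p (length pre) (length (flat post ++ same)) l′))
    in many pre zs l′ (Allₚ.++⁻ˡ pre dis) z (subst (λ t → flat pre ++ t ↭ xs) eq perm′)
    where
    l′ : suc (length pre) ≡ p
    l′ = trans (cong suc l) (ℕₚ.suc-pred p)
    perm′ : flat pre ++ (flat post ++ same) ↭ xs
    perm′ = flat-rest pre post refl perm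
    lem : ∀ p a t → suc a ≡ p → 1 + suc (2 * a + t) + 0 ≡ t + (p + p)
    lem p a t refl = lem′ a t
      where
      lem′ : ∀ a t → 1 + suc (2 * a + t) + 0 ≡ t + (suc a + suc a)
      lem′ = ℕR.solve-∀
  ... | no p≰ = go alt
    where
    s<p : suc (suc (length ps)) ≤ p
    s<p = ℕₚ.≰⇒> p≰
    go : _ → Chosen v p p xs
    -- At most p - 2 pairs and one further term are only 2p - 3 terms.
    go (inj₁ short) = contradiction (≤-by {1} {0} 1 (total ps same perm +≤ short +≤ s<p +≤ s<p) (lem p (length ps) (length same))) λ ()
      where
      lem : ∀ p s t → 1 + (suc (2 * s + t) + 1 + p + p) + 1 ≡ 0 + (p + p + t + suc (suc s) + suc (suc s))
      lem = ℕR.solve-∀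
    -- Each of the at most p - 2 pairs holds one term of residue `κ`, so the residue occurs at least
    -- (2p - 1) - (p - 2) = p + 1 times; hence the slack 1.
    go (inj₂ h) with as , bs , q , l , al′ ← pick-each ps h =
      few κ (as ++ same) bs (Allₚ.++⁺ al′ al)
        (≤-by 1 (total ps same perm +≤ s<p) (trans (lem p (length ps) (length same)) (cong (_+ (p + p + suc (suc (length ps)))) (trans (cong (_+ length same) (sym l)) (sym (length-++ as))))))
        (↭-trans (↭-assoc as same bs) (↭-trans (Permₚ.++⁺ˡ as (++-comm same bs)) (↭-trans (↭-sym (↭-assoc as bs same)) (↭-trans (Permₚ.++⁺ʳ same q) perm))))
      where
      lem : ∀ p s t → p + (suc (2 * s + t) + p) + 1 ≡ (s + t) + (p + p + suc (suc s))
      lem = ℕR.solve-∀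

egz : ∀ n → .{{_ : NonZero n}} → Egz n
egz n = subst Egz (sym (PrimeFactorisation.isFactorisation (factorise n))) (go (PrimeFactorisation.factorsPrime (factorise n)))
  where
  go : ∀ {ps} → All Prime ps → Egz (product ps)
  go []         = egz-1
  go (pr ∷ prs) = egz-* (egz-prime pr) (go prs)

-- Signed sums modulo an odd number

module _ {I : Set} (v : I → ℤ) where

  record Signed (n l : ℕ) (δ : ℤ) (xs : List I) : Set where
    constructor signed
    field
      plus  : List I
      minus : List I
      rest  : List I
      perm  : (plus ++ minus) ++ rest ↭ xs
      size  : length (plus ++ minus) ≡ l
      div   : + n ∣ (sumBy v plus -ᶻ sumBy v minus) -ᶻ δ

  private
    perm-lemma : ∀ p m p′ m′ r → ((p ++ p′) ++ (m ++ m′)) ++ r ↭ (p ++ m) ++ ((p′ ++ m′) ++ r)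
    perm-lemma = solve 5 (λ p m p′ m′ r → ((p ⊕ p′) ⊕ (m ⊕ m′)) ⊕ r ⊜ (p ⊕ m) ⊕ ((p′ ⊕ m′) ⊕ r)) ↭-refl
      where open ++-Solver I
    size-lemma : ∀ (p m p′ m′ : List I) → (p ++ p′) ++ (m ++ m′) ↭ (p ++ m) ++ (p′ ++ m′)
    size-lemma = solve 4 (λ p m p′ m′ → (p ⊕ p′) ⊕ (m ⊕ m′) ⊜ (p ⊕ m) ⊕ (p′ ⊕ m′)) ↭-refl
      where open ++-Solver I

  signed-++ : ∀ {n l l′ δ δ′ xs} (s : Signed n l δ xs) → Signed n l′ δ′ (Signed.rest s) → Signed n (l + l′) (δ +ᶻ δ′) xs
  signed-++ {δ = δ} {δ′ = δ′} (signed p m r perm size div) (signed p′ m′ r′ perm′ size′ div′) =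
    signed (p ++ p′) (m ++ m′) r′ (↭-trans (perm-lemma p m p′ m′ r′) (↭-trans (Permₚ.++⁺ˡ (p ++ m) perm′) perm))
      (trans (Permₚ.↭-length (size-lemma p m p′ m′)) (trans (length-++ (p ++ m)) (cong₂ _+_ size size′)))
      (∣-resp (trans (lem (sumBy v p) (sumBy v m) δ (sumBy v p′) (sumBy v m′) δ′)
                 (cong₂ (λ a b → (a -ᶻ b) -ᶻ (δ +ᶻ δ′)) (sym (sumBy-++ v p p′)) (sym (sumBy-++ v m m′))))
              (∣-sum div div′))
    where
    lem : ∀ a b d a′ b′ d′ → ((a -ᶻ b) -ᶻ d) +ᶻ ((a′ -ᶻ b′) -ᶻ d′) ≡ ((a +ᶻ a′) -ᶻ (b +ᶻ b′)) -ᶻ (d +ᶻ d′)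
    lem = ℤR.solve-∀

  signed-resp : ∀ {n l l′ δ δ′ xs} → l ≡ l′ → δ ≡ δ′ → Signed n l δ xs → Signed n l′ δ′ xs
  signed-resp refl refl s = s

  signed-weaken : ∀ {n l δ xs ys} zs → xs ++ zs ↭ ys → Signed n l δ xs → Signed n l δ ys
  signed-weaken zs p (signed a b c perm s d) =
    signed a b (c ++ zs) (↭-trans (↭-sym (↭-assoc (a ++ b) c zs)) (↭-trans (Permₚ.++⁺ʳ zs perm) p)) s d

  chosen⇒signed : ∀ {n l xs} → Chosen v n l xs → Signed n l 0ℤ xs
  chosen⇒signed (chosen sel rest perm size div) = signed sel [] rest
    (↭-trans (↭-reflexive (cong (_++ rest) (++-identityʳ sel))) perm) (trans (cong length (++-identityʳ sel)) size)
    (∣-resp (lem (sumBy v sel)) div)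
    where
    lem : ∀ a → a ≡ (a -ᶻ 0ℤ) -ᶻ 0ℤ
    lem = ℤR.solve-∀

even-or-odd : ∀ n → ∃ λ i → n ≡ 2 * i ⊎ n ≡ suc (2 * i)
even-or-odd zero    = 0 , inj₁ refl
even-or-odd (suc n) with even-or-odd n
... | i , inj₁ refl = i , inj₂ refl
... | i , inj₂ refl = suc i , inj₁ (sym (ℕₚ.*-suc 2 i))

module Odd (k : ℕ) where

  M : ℕ
  M = suc (2 * k)

  open Residue M public

  pos-M : + M ≡ 1ℤ +ᶻ + 2 *ᶻ + k
  pos-M = cong (1ℤ +ᶻ_) (pos-* 2 k)

  -- Since `M = 2k + 1`, one has z = zM - k(z + z): 2 is invertible modulo every divisor of `M`.
  half : ∀ {g z} → + g ∣ + M → + g ∣ z +ᶻ z → + g ∣ z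
  half {g} {z} g∣M d = ∣-resp (trans (cong (λ m → z *ᶻ m +ᶻ -ᶻ (+ k *ᶻ (z +ᶻ z))) pos-M) (lem z (+ k))) (∣-diff (∣-mul z g∣M) (∣-mul (+ k) d))
    where
    lem : ∀ z k → z *ᶻ (1ℤ +ᶻ + 2 *ᶻ k) +ᶻ -ᶻ (k *ᶻ (z +ᶻ z)) ≡ z
    lem = ℤR.solve-∀

  -- In z = Mz - 2kz, evenness of `z` makes the first term a multiple of 2M, and divisibility by `M`
  -- the second.
  double-∣ : ∀ {z} → + 2 ∣ z → + M ∣ z → + (2 * M) ∣ z
  double-∣ {z} (divides q eq) (divides r eq′) = divides (q -ᶻ + k *ᶻ r) (begin
    z                                                   ≡⟨ lem z (+ k) ⟩
    (1ℤ +ᶻ + 2 *ᶻ + k) *ᶻ z -ᶻ + 2 *ᶻ + k *ᶻ z            ≡⟨ cong₂ (λ m s → m *ᶻ z -ᶻ + 2 *ᶻ + k *ᶻ s) (sym pos-M) eq′ ⟩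
    + M *ᶻ z -ᶻ + 2 *ᶻ + k *ᶻ (r *ᶻ + M)                 ≡⟨ cong (λ s → + M *ᶻ s -ᶻ + 2 *ᶻ + k *ᶻ (r *ᶻ + M)) eq ⟩
    + M *ᶻ (q *ᶻ + 2) -ᶻ + 2 *ᶻ + k *ᶻ (r *ᶻ + M)        ≡⟨ lem′ (+ M) q r (+ k) ⟩
    (q -ᶻ + k *ᶻ r) *ᶻ (+ 2 *ᶻ + M)                      ≡⟨ cong ((q -ᶻ + k *ᶻ r) *ᶻ_) (sym (pos-* 2 M)) ⟩
    (q -ᶻ + k *ᶻ r) *ᶻ + (2 * M)                              ∎)
    where
    open ≡-Reasoning
    lem : ∀ z k → z ≡ (1ℤ +ᶻ + 2 *ᶻ k) *ᶻ z -ᶻ + 2 *ᶻ k *ᶻ z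
    lem = ℤR.solve-∀
    lem′ : ∀ m q r k → m *ᶻ (q *ᶻ + 2) -ᶻ + 2 *ᶻ k *ᶻ (r *ᶻ m) ≡ (q -ᶻ k *ᶻ r) *ᶻ (+ 2 *ᶻ m)
    lem′ = ℤR.solve-∀

  -- The residue up to sign, a number from 0 to `k`; thus only k + 1 classes.
  fold : ℤ → ℕ
  fold a = res a ⊓ (M ∸ res a)

  fold< : ∀ a → fold a < suc k
  fold< a with res a ℕₚ.≤? k
  ... | yes r≤k = s≤s (ℕₚ.≤-trans (ℕₚ.m⊓n≤m _ _) r≤k)
  ... | no r≰k = s≤s (ℕₚ.≤-trans (ℕₚ.m⊓n≤n _ _) (ℕₚ.≤-trans (ℕₚ.∸-monoʳ-≤ M (ℕₚ.≰⇒> r≰k)) (ℕₚ.≤-reflexive (trans (cong (_∸ k) (cong (λ n → k + n) (ℕₚ.+-identityʳ k))) (ℕₚ.m+n∸m≡n k k)))))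

  opposite : ∀ a b → res a + res b ≡ M → + M ∣ a +ᶻ b
  opposite a b eq = ∣-resp (lem a b (+ res a) (+ res b)) (∣-sum (∣-sum (res-≡ a) (res-≡ b)) (∣-resp (cong +_ (sym eq)) ∣-refl))
    where
    lem : ∀ a b r s → ((a -ᶻ r) +ᶻ (b -ᶻ s)) +ᶻ (r +ᶻ s) ≡ a +ᶻ b
    lem = ℤR.solve-∀

  fold-≡ : ∀ a b → fold a ≡ fold b → + M ∣ a -ᶻ b ⊎ + M ∣ a +ᶻ b
  fold-≡ a b eq with ℕₚ.⊓-sel (res a) (M ∸ res a) | ℕₚ.⊓-sel (res b) (M ∸ res b)
  ... | inj₁ p | inj₁ q = inj₁ (res-∣ {a} {b} (trans (sym p) (trans eq q)))
  ... | inj₂ p | inj₂ q = inj₁ (res-∣ {a} {b} (ℕₚ.∸-cancelˡ-≡ (ℕₚ.<⇒≤ (res< a)) (ℕₚ.<⇒≤ (res< b)) (trans (sym p) (trans eq q))))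
  ... | inj₁ p | inj₂ q = inj₂ (opposite a b (trans (cong (_+ res b) (trans (sym p) (trans eq q))) (ℕₚ.m∸n+n≡m (ℕₚ.<⇒≤ (res< b)))))
  ... | inj₂ p | inj₁ q = inj₂ (opposite a b (trans (cong (λ t → res a + t) (trans (sym q) (trans (sym eq) p))) (ℕₚ.m+[n∸m]≡n (ℕₚ.<⇒≤ (res< a)))))

  module _ {I : Set} (v : I → ℤ) where

    equal-pair : ∀ x y xs → + M ∣ v x -ᶻ v y → Signed v M 2 0ℤ (x ∷ y ∷ xs)
    equal-pair x y xs d = signed (x ∷ []) (y ∷ []) xs ↭-refl refl (∣-resp (lem (v x) (v y)) d)
      where
      lem : ∀ a b → a -ᶻ b ≡ ((a +ᶻ 0ℤ) -ᶻ (b +ᶻ 0ℤ)) -ᶻ 0ℤ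
      lem = ℤR.solve-∀

    opposite-pair : ∀ x y xs → + M ∣ v x +ᶻ v y → Signed v M 2 0ℤ (x ∷ y ∷ xs)
    opposite-pair x y xs d = signed (x ∷ y ∷ []) [] xs ↭-refl refl (∣-resp (lem (v x) (v y)) d)
      where
      lem : ∀ a b → a +ᶻ b ≡ ((a +ᶻ (b +ᶻ 0ℤ)) -ᶻ 0ℤ) -ᶻ 0ℤ
      lem = ℤR.solve-∀

    cancel : ∀ ps → All (λ p → fold (v (proj₁ p)) ≡ fold (v (proj₂ p))) ps → Signed v M (2 * length ps) 0ℤ (flat ps)
    cancel []             []       = signed [] [] [] ↭-refl refl ∣-zero
    cancel ((x , y) ∷ ps) (e ∷ es) with fold-≡ (v x) (v y) e
    ... | inj₁ d = signed-resp v (sym (ℕₚ.*-suc 2 (length ps))) refl (signed-++ v (equal-pair x y (flat ps) d) (cancel ps es))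
    ... | inj₂ d = signed-resp v (sym (ℕₚ.*-suc 2 (length ps))) refl (signed-++ v (opposite-pair x y (flat ps) d) (cancel ps es))

    -- Terms that agree up to sign cancel in pairs. At most k + 1 terms stay unpaired, one more than
    -- the hypothesis provides for; but the paired terms are then at least 2j - 1, and being even in
    -- number, at least 2j.
    zero-fill : ∀ j xs → 2 * j + k ≤ length xs → Signed v M (2 * j) 0ℤ xs
    zero-fill j xs le = go (pair-up (fold ∘ v) xs)
      where
      lem : ∀ j k p l → suc (2 * j) + (2 * p + l + (suc k)) + 0 ≡ 2 * suc p + (2 * j + k + l)
      lem = ℕR.solve-∀
      go : Pairing (fold ∘ v) xs → Signed v M (2 * j) 0ℤ xs
      go (pairing ps ls perm eqs dis) =
        let qs , rs , eq , l = splitLength j ps (ℕ.s≤s⁻¹ (ℕₚ.*-cancelˡ-< 2 j (suc (length ps)) j<))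
        in signed-resp v (cong (2 *_) l) refl (signed-weaken v (flat rs ++ ls) (flat-rest qs rs eq perm)
             (cancel qs (Allₚ.++⁻ˡ qs (subst (All _) (sym eq) eqs))))
        where
        len : length xs ≡ 2 * length ps + length ls
        len = trans (sym (Permₚ.↭-length perm)) (trans (length-++ (flat ps)) (cong (_+ length ls) (flat-length ps)))
        j< : 2 * j < 2 * suc (length ps)
        j< = ≤-by 0 (subst (2 * j + k ≤_) len le +≤ length-bound (fold ∘ v) (suc k) (fold< ∘ v) dis) (lem j k (length ps) (length ls))

    -- The set `X` gains exactly two residues per used term, so `size` and `|X| ≤ M` bound the
    -- number of used terms by `k`; this keeps a hit short enough to be completed.
    record State (δ : ℤ) (used : List I) : Set where
      field
        X          : List ℤ
        reach      : All (λ z → ∃₂ λ A B → ∃ λ C → (A ++ B) ++ C ↭ used × sumBy v A -ᶻ sumBy v B ≡ z) X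
        inc        : Incongruent X
        zero∈      : 0ℤ ∈ᴹ X
        symm       : ∀ z → z ∈ᴹ X → (-ᶻ z) ∈ᴹ X
        size       : length X ≡ suc (2 * length used)

    Hit : ℤ → List I → Set
    Hit δ xs = ∃ λ l → l ≤ k × Signed v M l δ xs

    Stuck : ℤ → List I → Set
    Stuck δ xs = ∃₂ λ used rem → used ++ rem ↭ xs × Σ (State δ used) λ s → All (λ e → Closed (_∈ᴹ State.X s) (v e)) rem × ¬ δ ∈ᴹ State.X s

    scan : ∀ X rem → (∃₂ λ e rem′ → e ∷ rem′ ↭ rem × ∃ λ x → x ∈ᴸ X × ¬ (x +ᶻ v e) ∈ᴹ X) ⊎ All (λ e → Closed (_∈ᴹ X) (v e)) rem
    scan X []        = inj₂ []
    scan X (e ∷ rem) with grow? X (v e) | scan X rem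
    ... | inj₁ (x , new) | _                         = inj₁ (e , rem , ↭-refl , x , new)
    ... | inj₂ c         | inj₂ cs                   = inj₂ (c ∷ cs)
    ... | inj₂ c         | inj₁ (e′ , rem′ , p , h)  = inj₁ (e′ , e ∷ rem′ , ↭-trans (swap e′ e ↭-refl) (prep e p) , h)

    -- Oddness of `M` separates `z` from `-z`: if they agreed, `z` would be 0, which lies in `X`. By
    -- symmetry of `X`, `-z` is new as well.
    extend : ∀ {δ used e x} (s : State δ used) → x ∈ᴸ State.X s → ¬ (x +ᶻ v e) ∈ᴹ State.X s → State δ (e ∷ used)
    extend {δ} {used} {e} {x} s x∈ z∉ = record
      { X     = z ∷ (-ᶻ z) ∷ X
      ; reach = reach-z ∷ reach-neg reach-z ∷ All.map (λ (A , B , C , p , eq) → A , B , e ∷ C , ↭-trans (Permₚ.shift e (A ++ B) C) (prep e p) , eq) reach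
      ; inc   = ((λ d → z∉ (∈ᴹ-resp {X} {0ℤ} {z} (∣-resp (lem₂ z) (∣-neg (half ∣-refl (∣-resp (lem₃ z) d)))) zero∈)) ∷ Allₚ.¬Any⇒All¬ _ z∉)
                ∷ insert-incongruent { -ᶻ z} (λ z′∈ → z∉ (∈ᴹ-resp {X} { -ᶻ (-ᶻ z)} {z} (∣-resp (lem₁ z) ∣-zero) (symm (-ᶻ z) z′∈))) inc
      ; zero∈ = there (there zero∈)
      ; symm  = symm′
      ; size  = trans (cong (suc ∘ suc) size) (cong suc (sym (ℕₚ.*-suc 2 (length used))))
      }
      where
      open State s
      z = x +ᶻ v e
      Reached : ℤ → Set
      Reached z = ∃₂ λ A B → ∃ λ C → (A ++ B) ++ C ↭ e ∷ used × sumBy v A -ᶻ sumBy v B ≡ z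
      lem : ∀ a b c → (c +ᶻ a) -ᶻ b ≡ (a -ᶻ b) +ᶻ c
      lem = ℤR.solve-∀
      reach-z : Reached z
      reach-z with A , B , C , p , refl ← All.lookup reach x∈ = e ∷ A , B , C , prep e p , lem (sumBy v A) (sumBy v B) (v e)
      reach-neg : ∀ {z} → Reached z → Reached (-ᶻ z)
      reach-neg (A , B , C , p , refl) = B , A , C , ↭-trans (Permₚ.++⁺ʳ C (++-comm B A)) p , lem′ (sumBy v A) (sumBy v B)
        where
        lem′ : ∀ a b → b -ᶻ a ≡ -ᶻ (a -ᶻ b)
        lem′ = ℤR.solve-∀
      lem₁ : ∀ z → 0ℤ ≡ -ᶻ (-ᶻ z) -ᶻ z
      lem₁ = ℤR.solve-∀
      lem₂ : ∀ z → -ᶻ z ≡ 0ℤ -ᶻ z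
      lem₂ = ℤR.solve-∀
      lem₃ : ∀ z → z -ᶻ (-ᶻ z) ≡ z +ᶻ z
      lem₃ = ℤR.solve-∀
      lem₄ : ∀ w z → -ᶻ (w -ᶻ z) ≡ -ᶻ w -ᶻ (-ᶻ z)
      lem₄ = ℤR.solve-∀
      lem₅ : ∀ w z → -ᶻ (w -ᶻ (-ᶻ z)) ≡ -ᶻ w -ᶻ z
      lem₅ = ℤR.solve-∀
      symm′ : ∀ w → w ∈ᴹ (z ∷ (-ᶻ z) ∷ X) → (-ᶻ w) ∈ᴹ (z ∷ (-ᶻ z) ∷ X)
      symm′ w (here d)           = there (here (∣-resp (lem₄ w z) (∣-neg d)))
      symm′ w (there (here d))   = here (∣-resp (lem₅ w z) (∣-neg d))
      symm′ w (there (there w∈)) = there (there (symm w w∈))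

    hit : ∀ {δ used rem xs} → used ++ rem ↭ xs → (s : State δ used) → δ ∈ᴹ State.X s → Hit δ xs
    hit {δ} {used} {rem} perm s δ∈ with x , x∈ , d ← find δ∈ with A , B , C , p , refl ← All.lookup (State.reach s) x∈ =
      length (A ++ B) , ℕₚ.≤-trans l≤ (ℕₚ.*-cancelˡ-≤ 2 (ℕ.s≤s⁻¹ (subst (_≤ M) (State.size s) (incongruent-length (State.inc s))))) ,
      signed-weaken v rem perm (signed A B C p refl (∣-resp (neg-diff δ (sumBy v A -ᶻ sumBy v B)) (∣-neg d)))
      where
      l≤ : length (A ++ B) ≤ length used
      l≤ = subst (length (A ++ B) ≤_) (trans (sym (length-++ (A ++ B))) (Permₚ.↭-length p)) (ℕₚ.m≤m+n _ _)

    search : ∀ δ fuel used rem {xs} → length rem ≤ fuel → used ++ rem ↭ xs → State δ used → Hit δ xs ⊎ Stuck δ xs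
    search δ fuel used rem le perm s with δ ∈ᴹ? State.X s | scan (State.X s) rem
    ... | yes δ∈ | _         = inj₁ (hit perm s δ∈)
    ... | no δ∉  | inj₂ cs   = inj₂ (used , rem , perm , s , cs , δ∉)
    search δ zero used rem le perm s | no δ∉ | inj₁ (e , rem′ , p , _) with () ← subst (_≤ 0) (sym (Permₚ.↭-length p)) le
    search δ (suc fuel) used rem le perm s | no δ∉ | inj₁ (e , rem′ , p , x , x∈ , z∉) =
      search δ fuel (e ∷ used) rem′ (ℕ.s≤s⁻¹ (subst (_≤ suc fuel) (sym (Permₚ.↭-length p)) le))
        (↭-trans (↭-sym (Permₚ.shift e used rem′)) (↭-trans (Permₚ.++⁺ˡ used p) perm)) (extend s x∈ z∉)

    start : ∀ δ → State δ []
    start δ = record { X = 0ℤ ∷ [] ; reach = ([] , [] , [] , ↭-refl , refl) ∷ [] ; inc = [] ∷ [] ; zero∈ = here ∣-zero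
                     ; symm = λ { z (here d) → here (∣-resp (lem z) (∣-neg d)) } ; size = refl }
      where
      lem : ∀ z → -ᶻ (z -ᶻ 0ℤ) ≡ -ᶻ z -ᶻ 0ℤ
      lem = ℤR.solve-∀

    module Periodic {δ xs used rem} (le : suc (5 * k) ≤ length xs) (perm : used ++ rem ↭ xs) (s : State δ used) (δ∉ : ¬ δ ∈ᴹ State.X s)
                    (g d : ℕ) (M≡dg : M ≡ d * g) (g∣M : + g ∣ + M) (g∣es : All (λ e → + g ∣ v e) rem) (closed-g : Closed (_∈ᴹ State.X s) (+ g)) where
      open State s
      open Closure (_∈ᴹ X) (λ {a} {b} → ∈ᴹ-resp {X} {a} {b})

      instance
        g≢0 : NonZero g
        g≢0 = ℕ.≢-nonZero λ { refl → case trans M≡dg (ℕₚ.*-zeroʳ d) of λ () }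
        d≢0 : NonZero d
        d≢0 = ℕ.≢-nonZero λ { refl → case M≡dg of λ () }

      coset : ℤ → List ℤ
      coset c = applyUpTo (λ i → c +ᶻ + (i * g)) d

      coset-inc : ∀ c → Incongruent (coset c)
      coset-inc c = AllPairsₚ.applyUpTo⁺₁ _ d λ {i} {j} i<j j<d dv →
        ℕₚ.<⇒≢ i<j (ℕₚ.*-cancelʳ-≡ i j g (∣-small (below (ℕₚ.<-trans i<j j<d)) (below j<d) (ℕₚ.*-monoˡ-≤ g (ℕₚ.<⇒≤ i<j))
          (∣-resp (lem c (+ (i * g)) (+ (j * g))) (∣-neg dv))))
        where
        below : ∀ {i} → i < d → i * g < M
        below {i} i<d = subst (i * g <_) (sym M≡dg) (ℕₚ.*-monoˡ-< g i<d)
        lem : ∀ c a b → -ᶻ ((c +ᶻ a) -ᶻ (c +ᶻ b)) ≡ b -ᶻ a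
        lem = ℤR.solve-∀

      -- δ + gℤ and -δ + gℤ are two further cosets of gℤ, disjoint from X and (as g is odd) from each other.
      coset∉X : ∀ c → ¬ c ∈ᴹ X → All (λ a → All (λ b → ¬ + M ∣ a -ᶻ b) X) (coset c)
      coset∉X c c∉ = Allₚ.applyUpTo⁺₂ _ d λ i → Allₚ.¬Any⇒All¬ X λ c∈ →
        c∉ (P-≡ {c +ᶻ + (i * g) +ᶻ (-ᶻ + i) *ᶻ + g} {c} (trans (cong (λ t → (c +ᶻ t) +ᶻ (-ᶻ + i) *ᶻ + g) (pos-* i g)) (lem c (+ i) (+ g))) (closed-ℤ* closed-g (-ᶻ + i) (c +ᶻ + (i * g)) c∈))
        where
        lem : ∀ c i g → (c +ᶻ i *ᶻ g) +ᶻ (-ᶻ i) *ᶻ g ≡ c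
        lem = ℤR.solve-∀

      -δ∉ : ¬ (-ᶻ δ) ∈ᴹ X
      -δ∉ h = δ∉ (P-≡ { -ᶻ (-ᶻ δ)} {δ} (ℤₚ.neg-involutive δ) (symm (-ᶻ δ) h))

      g∤δ : ¬ + g ∣ δ
      g∤δ (divides q eq) = δ∉ (P-≡ (trans (ℤₚ.+-identityˡ _) (sym eq)) (closed-ℤ* closed-g q 0ℤ zero∈))

      cosets-apart : All (λ a → All (λ b → ¬ + M ∣ a -ᶻ b) (coset (-ᶻ δ))) (coset δ)
      cosets-apart = Allₚ.applyUpTo⁺₂ _ d λ i → Allₚ.applyUpTo⁺₂ _ d λ j dv →
        g∤δ (half {z = δ} g∣M (∣-resp (lem δ (+ (i * g)) (+ (j * g))) (∣-sum (∣-trans g∣M dv) (∣-diff (mult j) (mult i)))))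
        where
        mult : ∀ i → + g ∣ + (i * g)
        mult i = ∣ℕ {q = i} refl
        lem : ∀ e a b → ((e +ᶻ a) -ᶻ (-ᶻ e +ᶻ b)) +ᶻ (b -ᶻ a) ≡ e +ᶻ e
        lem = ℤR.solve-∀

      all-inc : Incongruent (coset δ ++ (coset (-ᶻ δ) ++ X))
      all-inc = AllPairsₚ.++⁺ (coset-inc δ)
        (AllPairsₚ.++⁺ (coset-inc (-ᶻ δ)) inc (coset∉X (-ᶻ δ) -δ∉))
        (All.zipWith (λ (p , q) → Allₚ.++⁺ p q) (cosets-apart , coset∉X δ δ∉))

      -- The two cosets and `X` are disjoint sets of residues, so at most k - d terms have been
      -- used. The d terms saved pay for the theorem modulo `d` in `enough`.
      bound : d + (d + suc (2 * length used)) ≤ suc (2 * k)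
      bound = subst (_≤ M) (trans (length-++ (coset δ)) (cong₂ _+_ (length-applyUpTo _ d) (trans (length-++ (coset (-ᶻ δ))) (cong₂ _+_ (length-applyUpTo _ d) size))))
                (incongruent-length all-inc)

      total : length xs ≡ length used + length rem
      total = trans (sym (Permₚ.↭-length perm)) (length-++ used)

      open Residue g using () renaming (∣-res to ∣-res-g)

      w : I → ℤ
      w e = v e /ℕ g

      v≡wg : ∀ {e} → + g ∣ v e → v e ≡ w e *ᶻ + g
      v≡wg {e} dv = trans (a≡a%ℕn+[a/ℕn]*n (v e) g) (trans (cong (λ r → + r +ᶻ w e *ᶻ + g) (trans (∣-res-g {v e} {0ℤ} (∣-resp (lem (v e)) dv)) (ℕᵐ.m<n⇒m%n≡m (ℕ.>-nonZero⁻¹ g)))) (ℤₚ.+-identityˡ _))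
        where
        lem : ∀ a → a ≡ a -ᶻ 0ℤ
        lem = ℤR.solve-∀

      -- There remain at least (5k + 1) - (k - d) = 2M + d - 1 terms, exactly the number from which
      -- 2g blocks of `d` terms can be taken. The inequality is doubled because `bound` controls
      -- twice the number of used terms.
      enough : d + (2 * g) * d ≤ suc (length rem)
      enough = ℕₚ.*-cancelˡ-≤ 2 (≤-by 0 (subst (suc (5 * k) ≤_) total le +≤ subst (suc (5 * k) ≤_) total le +≤ bound)
        (lem d g k (length used) (length rem) (trans (ℕₚ.*-comm g d) (sym M≡dg))))
        where
        lem : ∀ d g k u r → g * d ≡ suc (2 * k) → 2 * (d + (2 * g) * d) + ((u + r) + (u + r) + suc (2 * k)) + 0 ≡ 2 * suc r + (suc (5 * k) + suc (5 * k) + (d + (d + suc (2 * u))))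
        lem d g k u r eq = trans (lem₁ d g k u r) (trans (cong (λ m → 2 * d + 4 * m + (2 * u + 2 * r + suc (2 * k))) eq) (lem₂ d k u r))
          where
          lem₁ : ∀ d g k u r → 2 * (d + (2 * g) * d) + ((u + r) + (u + r) + suc (2 * k)) + 0 ≡ 2 * d + 4 * (g * d) + (2 * u + 2 * r + suc (2 * k))
          lem₁ = ℕR.solve-∀
          lem₂ : ∀ d k u r → 2 * d + 4 * suc (2 * k) + (2 * u + 2 * r + suc (2 * k)) ≡ 2 * suc r + (suc (5 * k) + suc (5 * k) + (d + (d + suc (2 * u))))
          lem₂ = ℕR.solve-∀

      rescale : ∀ {sel} → All (λ e → + g ∣ v e) sel → + d ∣ sumBy w sel → + M ∣ sumBy v sel
      rescale {sel} gs (divides q eq) = divides q (begin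
        sumBy v sel          ≡⟨ sumBy-* (+ g) v w (All.map v≡wg gs) ⟩
        sumBy w sel *ᶻ + g   ≡⟨ cong (_*ᶻ + g) eq ⟩
        q *ᶻ + d *ᶻ + g      ≡⟨ ℤₚ.*-assoc q (+ d) (+ g) ⟩
        q *ᶻ (+ d *ᶻ + g)    ≡⟨ cong (q *ᶻ_) (sym (pos-* d g)) ⟩
        q *ᶻ + (d * g)       ≡⟨ cong (λ m → q *ᶻ + m) (sym M≡dg) ⟩
        q *ᶻ + M             ∎)
        where open ≡-Reasoning

      twice : (2 * g) * d ≡ 2 * M
      twice = trans (ℕₚ.*-assoc 2 g d) (cong (2 *_) (trans (ℕₚ.*-comm g d) (sym M≡dg)))

      convert : Chosen w d ((2 * g) * d) rem → Chosen v M (2 * M) xs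
      convert (chosen sel rest p size dv) =
        chosen sel (rest ++ used) (↭-trans (↭-sym (↭-assoc sel rest used)) (↭-trans (Permₚ.++⁺ʳ used p) (↭-trans (++-comm rem used) perm)))
          (trans size twice) (rescale (Allₚ.++⁻ˡ sel (Permₚ.All-resp-↭ (↭-sym p) g∣es)) dv)

      finish : Chosen v M (2 * M) xs
      finish = convert (egz-multi (egz d) w (2 * g) rem enough)

    stuck : ∀ {δ xs} → suc (5 * k) ≤ length xs → Stuck δ xs → Chosen v M (2 * M) xs
    stuck {δ} {xs} le (used , rem , perm , s , closeds , δ∉) = go (generator (map v rem) (Allₚ.map⁺ closeds))
      where
      open Closure (_∈ᴹ State.X s) (λ {a} {b} → ∈ᴹ-resp {State.X s} {a} {b})
      go : Generator (map v rem) → Chosen v M (2 * M) xs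
      go gen = Periodic.finish le perm s δ∉ (Generator.g gen) (ℕᵈ._∣_.quotient g∣ᵤM) (ℕᵈ._∣_.equality g∣ᵤM) (Generator.g∣M gen)
                 (Allₚ.map⁻ (Generator.g∣es gen)) (Generator.closed gen)
        where
        g∣ᵤM = ∣⇒∣ᵤ (Generator.g∣M gen)

    -- The length 4k = 2M - 2 leaves room for two reflections in a selection of 2M. The bound 5k + 1
    -- is what `stuck` needs, and also what a hit of odd length `l ≤ k` needs, after which 2M - 1
    -- terms must remain.
    weighted : ∀ δ xs → suc (5 * k) ≤ length xs → Chosen v M (2 * M) xs ⊎ Signed v M (4 * k) δ xs
    weighted δ xs le with search δ (length xs) [] xs ℕₚ.≤-refl ↭-refl (start δ)
    ... | inj₂ st = inj₁ (stuck le st)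
    ... | inj₁ (l , l≤k , s) = inj₂ (go s (rest-length s) (even-or-odd l))
      where
      rest-length : ∀ {l δ ys} (s : Signed v M l δ ys) → length ys ≡ l + length (Signed.rest s)
      rest-length (signed p m r perm size _) = trans (sym (Permₚ.↭-length perm)) (trans (length-++ (p ++ m)) (cong (_+ length r) size))

      go : (s : Signed v M l δ xs) → length xs ≡ l + length (Signed.rest s) → (∃ λ i → l ≡ 2 * i ⊎ l ≡ suc (2 * i)) → Signed v M (4 * k) δ xs
      go s len (i , inj₁ refl) =
        signed-resp v (trans (sym (ℕₚ.*-distribˡ-+ 2 i j)) (trans (cong (2 *_) i+j) (sym (ℕₚ.*-assoc 2 2 k)))) (ℤₚ.+-identityʳ δ)
          (signed-++ v s (zero-fill j (Signed.rest s) (≤-by 1 (subst (suc (5 * k) ≤_) len le) (lem i j k (length (Signed.rest s)) i+j))))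
        where
        j = 2 * k ∸ i
        i+j : i + j ≡ 2 * k
        i+j = ℕₚ.m+[n∸m]≡n (≤-by {i} {2 * k} (i + k) l≤k (lem i k))
          where
          lem : ∀ i k → i + k + (i + k) ≡ 2 * k + 2 * i
          lem = ℕR.solve-∀
        lem : ∀ i j k r → i + j ≡ 2 * k → 2 * j + k + (2 * i + r) + 1 ≡ r + suc (5 * k)
        lem i j k r eq = trans (lem₁ i j k r) (trans (cong (λ t → 2 * t + k + r + 1) eq) (lem₂ k r))
          where
          lem₁ : ∀ i j k r → 2 * j + k + (2 * i + r) + 1 ≡ 2 * (i + j) + k + r + 1
          lem₁ = ℕR.solve-∀
          lem₂ : ∀ k r → 2 * (2 * k) + k + r + 1 ≡ r + suc (5 * k)
          lem₂ = ℕR.solve-∀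
      go s len (i , inj₂ refl) =
        signed-resp v (lem₃ i j k i+j) (trans (cong (δ +ᶻ_) (ℤₚ.+-identityʳ 0ℤ)) (ℤₚ.+-identityʳ δ))
          (signed-++ v s (signed-++ v block (zero-fill j (Signed.rest block)
            (≤-by 1 (subst (suc (5 * k) ≤_) (trans len (cong (λ t → suc (2 * i) + t) (rest-length block))) le) (lem₂ i j k _ i+j)))))
        where
        j = k ∸ suc i
        i+j : suc i + j ≡ k
        i+j = ℕₚ.m+[n∸m]≡n (ℕₚ.≤-trans (s≤s (ℕₚ.m≤m+n i (i + 0))) l≤k)
        -- Cancelling pairs cannot change the parity of the length; a zero-sum block with the odd
        -- number `M` of terms does.
        block : Signed v M M 0ℤ (Signed.rest s)
        block = chosen⇒signed v (egz M v (Signed.rest s) (≤-by 0 (subst (suc (5 * k) ≤_) len le +≤ l≤k) (lem i k _)))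
          where
          lem : ∀ i k r → (suc (2 * k) + suc (2 * k)) + ((suc (2 * i) + r) + k) + 0 ≡ suc r + (suc (5 * k) + suc (2 * i))
          lem = ℕR.solve-∀
        lem₂ : ∀ i j k r → suc i + j ≡ k → 2 * j + k + (suc (2 * i) + (suc (2 * k) + r)) + 1 ≡ r + suc (5 * k)
        lem₂ i j k r refl = lem i j r
          where
          lem : ∀ i j r → 2 * j + (suc i + j) + (suc (2 * i) + (suc (2 * (suc i + j)) + r)) + 1 ≡ r + suc (5 * (suc i + j))
          lem = ℕR.solve-∀
        lem₃ : ∀ i j k → suc i + j ≡ k → suc (2 * i) + (suc (2 * k) + 2 * j) ≡ 4 * k
        lem₃ i j k refl = lem i j
          where
          lem : ∀ i j → suc (2 * i) + (suc (2 * (suc i + j)) + 2 * j) ≡ 4 * (suc i + j)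
          lem = ℕR.solve-∀

-- Parity classes

Parity : ℤ → ℤ → Set
Parity a x = + 2 ∣ x -ᶻ a

parity : ∀ x → Parity 0ℤ x ⊎ Parity 1ℤ x
parity x with x %ℕ 2 | n%ℕd<d x 2 | Residue.res-≡ 2 x
... | 0           | _              | d = inj₁ d
... | 1           | _              | d = inj₂ d
... | suc (suc _) | s≤s (s≤s ())   | _

split-parity : ∀ xs → ∃₂ λ ys zs → ys ++ zs ↭ xs × All (Parity 0ℤ) ys × All (Parity 1ℤ) zs
split-parity [] = [] , [] , ↭-refl , [] , []
split-parity (x ∷ xs) with split-parity xs | parity x
... | ys , zs , p , es , os | inj₁ d = x ∷ ys , zs , prep x p , d ∷ es , os
... | ys , zs , p , es , os | inj₂ d = ys , x ∷ zs , ↭-trans (Permₚ.shift x ys zs) (prep x p) , es , d ∷ os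

-- Products in dihedral and dicyclic groups

-- (x , false) and (b , true) stand for αˣ and αᵇτ, where τ² = αᶜ.
module Model (N : ℕ) (c : ℤ) (N∣2c : + N ∣ c +ᶻ c) where

  E : Set
  E = ℤ × Bool

  rot ref : ℤ → E
  rot x = x , false
  ref b = b , true

  infixl 7 _·_
  _·_ : E → E → E
  (a , false) · (b , s)     = a +ᶻ b , s
  (a , true)  · (b , false) = a -ᶻ b , true
  (a , true)  · (b , true)  = a -ᶻ b +ᶻ c , false

  zprod : List E → E
  zprod = foldr _·_ (0ℤ , false)

  infix 4 _≋_
  record _≋_ (e f : E) : Set where
    constructor _,_
    field
      val-≋  : + N ∣ proj₁ e -ᶻ proj₁ f
      sign-≡ : proj₂ e ≡ proj₂ f

  ≋-refl : ∀ {e} → e ≋ e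
  ≋-refl {a , _} = ∣-resp (lem a) ∣-zero , refl
    where
    lem : ∀ a → 0ℤ ≡ a -ᶻ a
    lem = ℤR.solve-∀

  ≋-trans : ∀ {e f g} → e ≋ f → f ≋ g → e ≋ g
  ≋-trans {a , _} {b , _} {c , _} (p , refl) (q , refl) = ∣-resp (lem a b c) (∣-sum p q) , refl
    where
    lem : ∀ a b c → (a -ᶻ b) +ᶻ (b -ᶻ c) ≡ a -ᶻ c
    lem = ℤR.solve-∀

  ≋-sym : ∀ {e f} → e ≋ f → f ≋ e
  ≋-sym {a , _} {b , _} (d , refl) = ∣-resp (neg-diff a b) (∣-neg d) , refl

  ≡⇒≋ : ∀ {a b s} → a ≡ b → (a , s) ≋ (b , s)
  ≡⇒≋ refl = ≋-refl

  ·-congʳ : ∀ e {f g} → f ≋ g → e · f ≋ e · g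
  ·-congʳ (a , false) {b , s}     {b′ , .s}    (d , refl) = ∣-resp (lem a b b′) d , refl
    where
    lem : ∀ a b c → b -ᶻ c ≡ (a +ᶻ b) -ᶻ (a +ᶻ c)
    lem = ℤR.solve-∀
  ·-congʳ (a , true)  {b , false} {b′ , .false} (d , refl) = ∣-resp (lem a b b′) (∣-neg d) , refl
    where
    lem : ∀ a b c → -ᶻ (b -ᶻ c) ≡ (a -ᶻ b) -ᶻ (a -ᶻ c)
    lem = ℤR.solve-∀
  ·-congʳ (a , true)  {b , true}  {b′ , .true} (d , refl) = ∣-resp (lem a b b′ c) (∣-neg d) , refl
    where
    lem : ∀ a b b′ c → -ᶻ (b -ᶻ b′) ≡ (a -ᶻ b +ᶻ c) -ᶻ (a -ᶻ b′ +ᶻ c)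
    lem = ℤR.solve-∀

  ·-congˡ : ∀ {e f} g → e ≋ f → e · g ≋ f · g
  ·-congˡ {a , false} {a′ , .false} (b , s)     (d , refl) = ∣-resp (lem a a′ b) d , refl
    where
    lem : ∀ a b c → a -ᶻ b ≡ (a +ᶻ c) -ᶻ (b +ᶻ c)
    lem = ℤR.solve-∀
  ·-congˡ {a , true}  {a′ , .true}  (b , false) (d , refl) = ∣-resp (lem a a′ b) d , refl
    where
    lem : ∀ a b c → a -ᶻ b ≡ (a -ᶻ c) -ᶻ (b -ᶻ c)
    lem = ℤR.solve-∀
  ·-congˡ {a , true}  {a′ , .true}  (b , true)  (d , refl) = ∣-resp (lem a a′ b c) d , refl
    where
    lem : ∀ a a′ b c → a -ᶻ a′ ≡ (a -ᶻ b +ᶻ c) -ᶻ (a′ -ᶻ b +ᶻ c)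
    lem = ℤR.solve-∀

  ·-assoc : ∀ e f g → (e · f) · g ≋ e · (f · g)
  ·-assoc (a , false) (b , false) (x , s)     = ≡⇒≋ (ℤₚ.+-assoc a b x)
  ·-assoc (a , false) (b , true)  (x , false) = ≡⇒≋ (ℤₚ.+-assoc a b (-ᶻ x))
  ·-assoc (a , false) (b , true)  (x , true)  = ≡⇒≋ (lem a b x c)
    where
    lem : ∀ a b x c → a +ᶻ b -ᶻ x +ᶻ c ≡ a +ᶻ (b -ᶻ x +ᶻ c)
    lem = ℤR.solve-∀
  ·-assoc (a , true)  (b , false) (x , false) = ≡⇒≋ (lem a b x)
    where
    lem : ∀ a b x → a -ᶻ b -ᶻ x ≡ a -ᶻ (b +ᶻ x)
    lem = ℤR.solve-∀
  ·-assoc (a , true)  (b , false) (x , true)  = ≡⇒≋ (lem a b x c)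
    where
    lem : ∀ a b x c → a -ᶻ b -ᶻ x +ᶻ c ≡ a -ᶻ (b +ᶻ x) +ᶻ c
    lem = ℤR.solve-∀
  ·-assoc (a , true)  (b , true)  (x , false) = ≡⇒≋ (lem a b x c)
    where
    lem : ∀ a b x c → a -ᶻ b +ᶻ c +ᶻ x ≡ a -ᶻ (b -ᶻ x) +ᶻ c
    lem = ℤR.solve-∀
  -- On the right the exponent `c` passes a reflection and is inverted; both sides agree because τ²
  -- is its own inverse.
  ·-assoc (a , true)  (b , true)  (x , true)  = ∣-resp (lem a b x c) N∣2c , refl
    where
    lem : ∀ a b x c → c +ᶻ c ≡ (a -ᶻ b +ᶻ c +ᶻ x) -ᶻ (a -ᶻ (b -ᶻ x +ᶻ c))
    lem = ℤR.solve-∀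

  zprod-++ : ∀ S T → zprod (S ++ T) ≋ zprod S · zprod T
  zprod-++ []      T = ≡⇒≋ (sym (ℤₚ.+-identityˡ _))
  zprod-++ (e ∷ S) T = ≋-trans (·-congʳ e (zprod-++ S T)) (≋-sym (·-assoc e (zprod S) (zprod T)))

  -- Real T z: the terms of T can be ordered so that their product is α^z.
  Real : List E → ℤ → Set
  Real T z = ∃ λ T′ → T′ ↭ T × zprod T′ ≋ (z , false)

  HasRef : List E → Set
  HasRef = Any (λ e → proj₂ e ≡ true)

  real-↭ : ∀ {S T z} → S ↭ T → Real S z → Real T z
  real-↭ p (T′ , q , eq) = T′ , ↭-trans q p , eq

  real-resp : ∀ {T y z} → + N ∣ y -ᶻ z → Real T y → Real T z
  real-resp d (T′ , q , eq) = T′ , q , ≋-trans eq (d , refl)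

  real-≡ : ∀ {T y z} → y ≡ z → Real T y → Real T z
  real-≡ refl r = r

  real-[] : Real [] 0ℤ
  real-[] = [] , ↭-refl , ≋-refl

  real-rot : ∀ x → Real (rot x ∷ []) x
  real-rot x = rot x ∷ [] , ↭-refl , ≡⇒≋ (ℤₚ.+-identityʳ x)

  real-ref : ∀ b b′ → Real (ref b ∷ ref b′ ∷ []) (b -ᶻ b′ +ᶻ c)
  real-ref b b′ = ref b ∷ ref b′ ∷ [] , ↭-refl , ≡⇒≋ (lem b b′ c)
    where
    lem : ∀ b b′ c → b -ᶻ (b′ -ᶻ 0ℤ) +ᶻ c ≡ b -ᶻ b′ +ᶻ c
    lem = ℤR.solve-∀

  real-++ : ∀ {S T y z} → Real S y → Real T z → Real (S ++ T) (y +ᶻ z)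
  real-++ {y = y} {z} (S′ , p , eq) (T′ , q , eq′) = S′ ++ T′ , Permₚ.++⁺ p q ,
    ≋-trans (zprod-++ S′ T′) (≋-trans (·-congʳ (zprod S′) eq′) (·-congˡ (z , false) eq))

  -- A block inserted after a reflection contributes the inverse of its product.
  insert : ∀ S T {z} → HasRef S → zprod T ≋ (z , false) →
           ∃ λ S′ → S′ ↭ S ++ T × zprod S′ ≋ (proj₁ (zprod S) -ᶻ z , proj₂ (zprod S))
  insert ((b , true) ∷ S) T {z} _ eq = (b , true) ∷ (T ++ S) , prep _ (++-comm T S) ,
    ≋-trans (·-congʳ (b , true) (≋-trans (zprod-++ T S) (·-congˡ (zprod S) eq))) (step (zprod S))
    where
    lem : ∀ b z w → b -ᶻ (z +ᶻ w) ≡ b -ᶻ w -ᶻ z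
    lem = ℤR.solve-∀
    lem′ : ∀ b z w c → b -ᶻ (z +ᶻ w) +ᶻ c ≡ b -ᶻ w +ᶻ c -ᶻ z
    lem′ = ℤR.solve-∀
    step : ∀ e → (b , true) · ((z , false) · e) ≋ (proj₁ ((b , true) · e) -ᶻ z , proj₂ ((b , true) · e))
    step (w , false) = ≡⇒≋ (lem b z w)
    step (w , true)  = ≡⇒≋ (lem′ b z w c)
  insert ((x , false) ∷ S) T {z} (there h) eq with S′ , p , eq′ ← insert S T h eq =
    (x , false) ∷ S′ , prep _ p , ≋-trans (·-congʳ (x , false) eq′) (≡⇒≋ (sym (ℤₚ.+-assoc x _ (-ᶻ z))))

  real-- : ∀ {S T y z} → HasRef S → Real S y → Real T z → Real (S ++ T) (y -ᶻ z)
  real-- {S} {T} {y} {z} h (S′ , p , eq) (T′ , q , eq′) with R , r , eq″ ← insert S′ T′ (Permₚ.Any-resp-↭ (↭-sym p) h) eq′ =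
    R , ↭-trans r (Permₚ.++⁺ p q) , ≋-trans eq″ (step eq)
    where
    lem : ∀ a y z → a -ᶻ y ≡ a -ᶻ z -ᶻ (y -ᶻ z)
    lem = ℤR.solve-∀
    step : ∀ {e} → e ≋ (y , false) → (proj₁ e -ᶻ z , proj₂ e) ≋ (y -ᶻ z , false)
    step {a , .false} (d , refl) = ∣-resp (lem a y z) d , refl

  -- The part that can be inverted is the one inserted after a reflection of the other, and the
  -- reflection may be in either. Where only divisibility of the exponent counts, both outcomes
  -- serve.
  real-± : ∀ S T {y z} → HasRef (S ++ T) → Real S y → Real T z → Real (S ++ T) (y -ᶻ z) ⊎ Real (S ++ T) (z -ᶻ y)
  real-± S T h r s with Anyₚ.++⁻ S h
  ... | inj₁ h′ = inj₁ (real-- h′ r s)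
  ... | inj₂ h′ = inj₂ (real-↭ (++-comm T S) (real-- h′ s r))

  -- A contribution relative to a context `C`: two rotations contribute `x - y` only if some
  -- reflection outside the pair is present, which `Real` cannot express.
  Rel : List E → ℤ → Set
  Rel T z = ∀ {C a} → HasRef C → Real C a → Real (C ++ T) (a +ᶻ z)

  rel-[] : Rel [] 0ℤ
  rel-[] {C} {a} h r = real-↭ (↭-reflexive (sym (++-identityʳ C))) (real-≡ (sym (ℤₚ.+-identityʳ a)) r)

  rel⁺ : ∀ {T z} → Real T z → Rel T z
  rel⁺ s h r = real-++ r s

  rel⁻ : ∀ {T z} → Real T z → Rel T (-ᶻ z)
  rel⁻ s h r = real-- h r s

  rel-++ : ∀ {S T y z} → Rel S y → Rel T z → Rel (S ++ T) (y +ᶻ z)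
  rel-++ {S} {T} {y} {z} f g {C} {a} h r =
    real-↭ (↭-assoc C S T) (real-≡ (ℤₚ.+-assoc a y z) (g (Anyₚ.++⁺ˡ h) (f h r)))

  module _ {I : Set} (el : I → List E) (v : I → ℤ) where

    real-expand : (∀ i → Real (el i) (v i)) → ∀ is → Real (expand el is) (sumBy v is)
    real-expand real []       = real-[]
    real-expand real (i ∷ is) = real-++ (real i) (real-expand real is)

    rel-expand : (∀ i → Rel (el i) (v i)) → ∀ is → Rel (expand el is) (sumBy v is)
    rel-expand rel []       = rel-[]
    rel-expand rel (i ∷ is) {C} {a} = rel-++ {el i} {expand el is} (rel i) (rel-expand rel is) {C} {a}

  record Good (L : ℕ) (S : List E) : Set where
    constructor good
    field
      T U   : List E
      perm  : T ++ U ↭ S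
      size  : length T ≡ L
      real  : Real T 0ℤ

  good-resp : ∀ {L L′ S S′} → L ≡ L′ → S ↭ S′ → Good L S → Good L′ S′
  good-resp refl p (good T U q s r) = good T U (↭-trans q p) s r

  good-weaken : ∀ {L S S′} U′ → S ++ U′ ↭ S′ → Good L S → Good L S′
  good-weaken U′ p (good T U q s r) = good T (U ++ U′) (↭-trans (↭-sym (↭-assoc T U U′)) (↭-trans (Permₚ.++⁺ʳ U′ q) p)) s r

  good-all : ∀ {T L z} → length T ≡ L → Real T z → + N ∣ z → Good L T
  good-all {T} {z = z} l r d = good T [] (↭-reflexive (++-identityʳ T)) l (real-resp {y = z} (∣-resp (lem z) d) r)
    where
    lem : ∀ z → z ≡ z -ᶻ 0ℤ
    lem = ℤR.solve-∀

  separate : ∀ S → ∃₂ λ xs bs → map rot xs ++ map ref bs ↭ S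
  separate []              = [] , [] , ↭-refl
  separate ((x , false) ∷ S) with xs , bs , p ← separate S = x ∷ xs , bs , prep _ p
  separate ((b , true)  ∷ S) with xs , bs , p ← separate S = xs , b ∷ bs , ↭-trans (Permₚ.shift (ref b) (map rot xs) (map ref bs)) (prep _ p)

  module _ {I : Set} (el : I → List E) (v : I → ℤ) (s : ℕ) (size : ∀ i → length (el i) ≡ s) (real : ∀ i → Real (el i) (v i)) where

    good-chosen : ∀ {l items} sel rest → sel ++ rest ↭ items → length sel ≡ l → + N ∣ sumBy v sel → Good (l * s) (expand el items)
    good-chosen sel rest p refl d = good-weaken (expand el rest)
      (expand-split el sel rest p)
      (good-all (expand-length el (All.universal size sel)) (real-expand el v real sel) d)

    -- To cancel `δ`, the terms in `plus` are the inverted ones: they follow a reflection of `C`,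
    -- and the total exponent is δ + minus - plus.
    good-signed : ∀ {C δ l items} plus minus rest → HasRef C → Real C δ → (plus ++ minus) ++ rest ↭ items → length (plus ++ minus) ≡ l →
                  + N ∣ (sumBy v plus -ᶻ sumBy v minus) -ᶻ δ → Good (length C + l * s) (C ++ expand el items)
    good-signed {C} {δ} {items = items} plus minus rest h r p refl d = good-weaken (expand el rest) perm
      (good-all (trans (length-++ C) (cong (λ n → length C + n) (trans (expand-length el (All.universal size (minus ++ plus))) (cong (_* s) (Permₚ.↭-length (++-comm minus plus))))))
        (real-↭ (↭-trans (↭-assoc C (expand el minus) (expand el plus)) (Permₚ.++⁺ˡ C (↭-reflexive (sym (expand-++ el minus plus)))))
          (real-- (Anyₚ.++⁺ˡ h) (real-++ r (real-expand el v real minus)) (real-expand el v real plus)))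
        (∣-resp (lem (sumBy v plus) (sumBy v minus) δ) (∣-neg d)))
      where
      lem : ∀ p m d → -ᶻ ((p -ᶻ m) -ᶻ d) ≡ (d +ᶻ m) -ᶻ p
      lem = ℤR.solve-∀
      perm : (C ++ expand el (minus ++ plus)) ++ expand el rest ↭ C ++ expand el items
      perm = ↭-trans (↭-assoc C (expand el (minus ++ plus)) (expand el rest)) (Permₚ.++⁺ˡ C
        (expand-split el (minus ++ plus) rest (↭-trans (Permₚ.++⁺ʳ rest (++-comm minus plus)) p)))

  refs : List (ℤ × ℤ) → List E
  refs = expand (λ (b , b′) → ref b ∷ ref b′ ∷ [])

  refVal : ℤ × ℤ → ℤ
  refVal (b , b′) = b -ᶻ b′ +ᶻ c

  real-refs : ∀ ps → Real (refs ps) (sumBy refVal ps)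
  real-refs = real-expand _ refVal (λ (b , b′) → real-ref b b′)

  refs-flat : ∀ ps → refs ps ≡ map ref (flat ps)
  refs-flat []       = refl
  refs-flat (_ ∷ ps) = cong (λ l → _ ∷ _ ∷ l) (refs-flat ps)

  refs-length : ∀ ps → length (refs ps) ≡ length ps * 2
  refs-length ps = expand-length _ (All.universal (λ _ → refl) ps)

  rots : List ℤ → List E
  rots = expand (λ x → rot x ∷ [])

  rots-expand : ∀ xs → rots xs ≡ map rot xs
  rots-expand []       = refl
  rots-expand (x ∷ xs) = cong (rot x ∷_) (rots-expand xs)

  good-exact : ∀ {l n} → (∀ xs bs → length xs + length bs ≡ n → Good l (rots xs ++ map ref bs)) → ∀ S → n ≤ length S → Good l S
  good-exact {n = n} claim S le with A , B , refl , l ← splitLength n S le with xs , bs , p ← separate A =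
    good-weaken B (Permₚ.++⁺ʳ B (↭-trans (Permₚ.++⁺ʳ (map ref bs) (↭-reflexive (rots-expand xs))) p)) (claim xs bs
      (trans (sym (trans (length-++ (map rot xs)) (cong₂ _+_ (length-map rot xs) (length-map ref bs)))) (trans (Permₚ.↭-length p) l)))

  -- Terms that multiply, suitably ordered, into the subgroup generated by αᵈ. With `d = 2` these
  -- are pairs that settle parity; with `d = s` they are the blocks that `combine` merges.
  record Block (d s : ℕ) : Set where
    constructor block
    field
      els   : List E
      val   : ℤ
      real  : Real els val
      size  : length els ≡ s
      div   : + d ∣ val
  Blocks : ℕ → ℕ → List E → Set
  Blocks d n S = ∃₂ λ (items : List (Block d 2)) R → expand Block.els items ++ R ↭ S × n ≤ length items

  blocks-++ : ∀ {d m n S T} → Blocks d m S → Blocks d n T → Blocks d (m + n) (S ++ T)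
  blocks-++ (is , R , p , l) (js , Q , q , l′) = is ++ js , R ++ Q ,
    ↭-trans (Permₚ.++⁺ʳ (R ++ Q) (↭-reflexive (expand-++ Block.els is js))) (↭-trans (lem (expand Block.els is) (expand Block.els js) R Q) (Permₚ.++⁺ p q)) ,
    ℕₚ.≤-trans (l +≤ l′) (ℕₚ.≤-reflexive (sym (length-++ is)))
    where
    lem : ∀ a b c d → (a ++ b) ++ (c ++ d) ↭ (a ++ c) ++ (b ++ d)
    lem = solve 4 (λ a b c d → (a ⊕ b) ⊕ (c ⊕ d) ⊜ (a ⊕ c) ⊕ (b ⊕ d)) ↭-refl
      where open ++-Solver E

  pair-class : ∀ {d} (el : ℤ → E) {P : ℤ → Set} → (∀ x y → P x → P y → Σ (Block d 2) λ b → Block.els b ≡ el x ∷ el y ∷ []) →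
               ∀ n xs → All P xs → 2 * n ≤ length xs → Blocks d n (map el xs)
  pair-class el mk zero    xs           _            _  = [] , map el xs , ↭-refl , z≤n
  pair-class el mk (suc n) (x ∷ [])     _            le = contradiction le (ℕₚ.<⇒≱ (ℕₚ.≤-trans (s≤s (s≤s z≤n)) (ℕₚ.≤-reflexive (sym (ℕₚ.*-suc 2 n)))))
  pair-class el mk (suc n) []           _            ()
  pair-class el mk (suc n) (x ∷ y ∷ xs) (p ∷ q ∷ ps) le
    with b , e ← mk x y p q
    with is , R , perm , l ← pair-class el mk n xs ps (ℕ.s≤s⁻¹ (ℕ.s≤s⁻¹ (subst (_≤ suc (suc (length xs))) (ℕₚ.*-suc 2 n) le)))
    = b ∷ is , R , ↭-trans (↭-reflexive (trans (++-assoc (Block.els b) _ R) (cong (_++ (expand Block.els is ++ R)) e))) (prep _ (prep _ perm)) , s≤s l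

  rot-pair : ∀ a x y → Parity a x → Parity a y → Σ (Block 2 2) λ b → Block.els b ≡ rot x ∷ rot y ∷ []
  rot-pair a x y p q = block _ _ (real-++ (real-rot x) (real-rot y)) refl (∣-resp (lem a x y) (∣-sum (∣-sum p q) (∣-self a))) , refl
    where
    lem : ∀ a x y → (x -ᶻ a) +ᶻ (y -ᶻ a) +ᶻ a *ᶻ + 2 ≡ x +ᶻ y
    lem = ℤR.solve-∀

-- Dihedral groups, n odd

module OddDihedral (k : ℕ) (1≤k : 1 ≤ k) where
  open Odd k
  open Model M 0ℤ ∣-zero

  good-rots-refs : ∀ {δ l xs} ps → 1 ≤ length ps → + M ∣ sumBy refVal ps -ᶻ δ → Signed id M l δ xs →
                   Good (length ps * 2 + l) (refs ps ++ rots xs)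
  good-rots-refs {l = l} ps@(_ ∷ _) _ d (signed plus minus rest perm size div) =
    good-resp (cong₂ _+_ (refs-length ps) (ℕₚ.*-identityʳ l)) ↭-refl
      (good-signed _ id 1 (λ _ → refl) real-rot plus minus rest (here refl) (real-resp d (real-refs ps)) perm size div)

  refs-perm : ∀ {bs} ps ls X → flat ps ++ ls ↭ bs → refs ps ++ X ++ map ref ls ↭ X ++ map ref bs
  refs-perm ps ls X p = ↭-trans (Permₚ.shifts (refs ps) X) (Permₚ.++⁺ˡ X
    (↭-trans (↭-reflexive (trans (cong (_++ map ref ls) (refs-flat ps)) (sym (map-++ ref (flat ps) ls)))) (Permₚ.map⁺ ref p)))

  finish : ∀ {L bs} ps ls xs → flat ps ++ ls ↭ bs → Good L (refs ps ++ rots xs) → Good L (rots xs ++ map ref bs)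
  finish ps ls xs p = good-weaken (map ref ls) (↭-trans (↭-assoc (refs ps) (rots xs) _) (refs-perm ps ls (rots xs) p))

  pairs-zero : ∀ {ps} → All (λ p → res (proj₁ p) ≡ res (proj₂ p)) ps → + M ∣ sumBy refVal ps
  pairs-zero = sumBy-∣ refVal ∘ All.map λ {(b , b′)} e → ∣-resp (sym (ℤₚ.+-identityʳ (b -ᶻ b′))) (res-∣ {b} {b′} e)

  good-rots : ∀ {xs} bs → Chosen id M (2 * M) xs → Good (2 * M) (rots xs ++ map ref bs)
  good-rots bs (chosen sel rest p size d) =
    good-resp (ℕₚ.*-identityʳ (2 * M)) ↭-refl
      (good-weaken (map ref bs) ↭-refl (good-chosen _ id 1 (λ _ → refl) real-rot sel rest p size d))

  no-refs : ∀ xs bs → M + 2 * M ≤ suc (length xs) → Good (2 * M) (rots xs ++ map ref bs)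
  no-refs xs bs le = good-rots bs (egz-multi (egz M) id 2 xs le)

  -- The two reflections make all signs available and set the target `b - b′`; `weighted` fills the
  -- other 2M - 2 places, or finds 2M rotations with sum 0.
  few-refs : ∀ xs b b′ bs → suc (5 * k) ≤ length xs → Good (2 * M) (rots xs ++ map ref (b ∷ b′ ∷ bs))
  few-refs xs b b′ bs le = go (weighted id (b -ᶻ b′) xs le)
    where
    lem : ∀ k → 2 + 4 * k ≡ 2 * suc (2 * k)
    lem = ℕR.solve-∀
    lem′ : ∀ b b′ → 0ℤ ≡ (b -ᶻ b′ +ᶻ 0ℤ) +ᶻ 0ℤ -ᶻ (b -ᶻ b′)
    lem′ = ℤR.solve-∀
    go : Chosen id M (2 * M) xs ⊎ Signed id M (4 * k) (b -ᶻ b′) xs → Good (2 * M) (rots xs ++ map ref (b ∷ b′ ∷ bs))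
    go (inj₁ ch) = good-rots (b ∷ b′ ∷ bs) ch
    go (inj₂ s) = good-resp (lem k) ↭-refl (finish ((b , b′) ∷ []) bs xs ↭-refl
      (good-rots-refs ((b , b′) ∷ []) (s≤s z≤n) (∣-resp (lem′ b b′) ∣-zero) s))

  -- By pigeonhole, ls and its translate by -σ share a residue.
  difference : ∀ σ ls → AllPairs (λ b b′ → res b ≢ res b′) ls → M < 2 * length ls → ¬ + M ∣ σ →
               ∃₂ λ b b′ → ∃ λ rest → b ∷ b′ ∷ rest ↭ ls × + M ∣ σ -ᶻ (b -ᶻ b′)
  difference σ ls dis M< σ≢0 with Any.any? (λ b → (b -ᶻ σ) ∈ᴹ? ls) ls
  ... | yes i with b , b∈ , i′ ← find i with b′ , b′∈ , d ← find i′ = go (extract′ b∈)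
    where
    extract′ : ∀ {A : Set} {x : A} {xs} → x ∈ᴸ xs → ∃ λ ys → x ∷ ys ↭ xs
    extract′ x∈ with _ , ys , refl , p ← extract x∈ = ys , p
    lem′ : ∀ b s → -ᶻ (b -ᶻ s -ᶻ b) ≡ s
    lem′ = ℤR.solve-∀
    lem″ : ∀ b s b′ → -ᶻ (b -ᶻ s -ᶻ b′) ≡ s -ᶻ (b -ᶻ b′)
    lem″ = ℤR.solve-∀
    go : (∃ λ ys → b ∷ ys ↭ ls) → _
    go (ys , p) with Permₚ.∈-resp-↭ (↭-sym p) b′∈
    ... | here refl = contradiction (∣-resp (lem′ b σ) (∣-neg d)) σ≢0
    ... | there b′∈ys = let zs , q = extract′ b′∈ys in b , b′ , zs , ↭-trans (prep b q) p , ∣-resp (lem″ b σ b′) (∣-neg d)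
  ... | no ¬i = contradiction (incongruent-length inc) (ℕₚ.<⇒≱ (subst (M <_) len M<))
    where
    lem : ∀ b b′ s → (b -ᶻ s) -ᶻ (b′ -ᶻ s) ≡ b -ᶻ b′
    lem = ℤR.solve-∀
    inc₁ : Incongruent ls
    inc₁ = AllPairs.map (λ {b} {b′} ne d → ne (∣-res {b} {b′} d)) dis
    inc : Incongruent (map (_-ᶻ σ) ls ++ ls)
    inc = AllPairsₚ.++⁺ (AllPairsₚ.map⁺ (AllPairs.map (λ {b} {b′} ne d → ne (∣-resp (lem b b′ σ) d)) inc₁)) inc₁
            (Allₚ.map⁺ (All.map (λ {b} → Allₚ.¬Any⇒All¬ ls) (Allₚ.¬Any⇒All¬ ls ¬i)))
    len : 2 * length ls ≡ length (map (_-ᶻ σ) ls ++ ls)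
    len = trans (cong (λ n → length ls + n) (ℕₚ.+-identityʳ _)) (sym (trans (length-++ (map (_-ᶻ σ) ls)) (cong (_+ length ls) (length-map _ ls))))

  module Many (xs bs : List ℤ) (len : length xs + length bs ≡ 3 * M)
              (ps : List (ℤ × ℤ)) (ls : List ℤ) (perm : flat ps ++ ls ↭ bs)
              (eqs : All (λ p → res (proj₁ p) ≡ res (proj₂ p)) ps) (dis : AllPairs (λ b b′ → res b ≢ res b′) ls) where

    ls≤M : length ls ≤ M
    ls≤M = length-bound res M res< dis

    total : length xs + (2 * length ps + length ls) ≡ 3 * M
    total = trans (cong (λ n → length xs + n) (sym (trans (sym (Permₚ.↭-length perm)) (trans (length-++ (flat ps)) (cong (_+ length ls) (flat-length ps)))))) len

    split : ∀ n → n ≤ length ps → ∃ λ qs → ∃ λ ms → flat qs ++ ms ↭ bs × length qs ≡ n × All (λ p → res (proj₁ p) ≡ res (proj₂ p)) qs × ∃ λ us → us ++ ls ≡ ms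
    split n le with qs , rs , refl , l ← splitLength n ps le =
      qs , flat rs ++ ls , flat-rest qs rs refl perm , l , Allₚ.++⁻ˡ qs eqs , flat rs , refl

    only-pairs : M ≤ length ps → Good (2 * M) (rots xs ++ map ref bs)
    only-pairs le with qs , ms , p , l , es , _ ← split M le =
      good-weaken (rots xs ++ map ref ms) (refs-perm qs ms (rots xs) p)
        (good-all (trans (refs-length qs) (trans (cong (_* 2) l) (ℕₚ.*-comm M 2))) (real-refs qs) (pairs-zero es))

    -- With at most `k` unpaired reflections, the rotations number at least 2(M - |ps|) + k, which
    -- is what `zero-fill` asks for.
    with-cancelling : length ls ≤ k → 1 ≤ length ps → length ps < M → Good (2 * M) (rots xs ++ map ref bs)
    with-cancelling ls≤k 1≤ps ps<M =
      good-resp (trans (cong (_+ 2 * a) (ℕₚ.*-comm (length ps) 2)) (trans (sym (ℕₚ.*-distribˡ-+ 2 (length ps) a)) (cong (2 *_) eq))) ↭-refl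
        (finish ps ls xs perm (good-rots-refs ps 1≤ps (∣-resp (sym (ℤₚ.+-identityʳ _)) (pairs-zero eqs))
          (zero-fill id a xs (≤-by 1 (ℕₚ.≤-reflexive (sym total) +≤ ls≤k) (lem k (length ps) (length ls) a (length xs) eq)))))
      where
      a = M ∸ length ps
      eq : length ps + a ≡ M
      eq = ℕₚ.m+[n∸m]≡n (ℕₚ.<⇒≤ ps<M)
      lem : ∀ k p l a x → p + a ≡ suc (2 * k) → 2 * a + k + (x + (2 * p + l) + k) + 1 ≡ x + (3 * suc (2 * k) + l)
      lem k p l a x eq = trans (lem₁ k p l a x) (trans (cong (λ t → 2 * t + (x + l + 2 * k + 1)) eq) (lem₂ k l x))
        where
        lem₁ : ∀ k p l a x → 2 * a + k + (x + (2 * p + l) + k) + 1 ≡ 2 * (p + a) + (x + l + 2 * k + 1)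
        lem₁ = ℕR.solve-∀
        lem₂ : ∀ k l x → 2 * suc (2 * k) + (x + l + 2 * k + 1) ≡ x + (3 * suc (2 * k) + l)
        lem₂ = ℕR.solve-∀

    zero-rots-eq : ∀ m p l a x → p + a ≡ m → 2 * a + (x + (2 * p + l) + m) + 0 ≡ x + (3 * m + l)
    zero-rots-eq m p l a x refl = lem p l a x
      where
      lem : ∀ p l a x → 2 * a + (x + (2 * p + l) + (p + a)) + 0 ≡ x + (3 * (p + a) + l)
      lem = ℕR.solve-∀

    zero-rots : All (λ x → + M ∣ x) xs → length ps < M → Good (2 * M) (rots xs ++ map ref bs)
    zero-rots zs ps<M with ys , ws , refl , l ← splitLength (2 * (M ∸ length ps)) xs
                             (≤-by 0 (ℕₚ.≤-reflexive (sym total) +≤ ls≤M) (zero-rots-eq M (length ps) (length ls) _ (length xs) (ℕₚ.m+[n∸m]≡n (ℕₚ.<⇒≤ ps<M)))) =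
      good-weaken (rots ws ++ map ref ls) perm′
        (good-all (trans (length-++ (rots ys)) (trans (cong₂ _+_ (trans (expand-length _ (All.universal (λ _ → refl) ys)) (trans (ℕₚ.*-identityʳ _) l)) (refs-length ps)) eq))
          (real-++ (real-expand _ id real-rot ys) (real-refs ps)) (∣-sum (sumBy-∣ id (Allₚ.++⁻ˡ ys zs)) (pairs-zero eqs)))
      where
      a = M ∸ length ps
      eq : 2 * a + length ps * 2 ≡ 2 * M
      eq = trans (cong (λ n → 2 * a + n) (ℕₚ.*-comm (length ps) 2)) (trans (sym (ℕₚ.*-distribˡ-+ 2 a (length ps))) (cong (2 *_) (trans (ℕₚ.+-comm a _) (ℕₚ.m+[n∸m]≡n (ℕₚ.<⇒≤ ps<M)))))
      perm′ : (rots ys ++ refs ps) ++ rots ws ++ map ref ls ↭ rots (ys ++ ws) ++ map ref bs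
      perm′ = ↭-trans (↭-assoc (rots ys) (refs ps) _) (↭-trans (Permₚ.++⁺ˡ (rots ys) (refs-perm ps ls (rots ws) perm))
        (↭-trans (↭-sym (↭-assoc (rots ys) (rots ws) _)) (Permₚ.++⁺ʳ (map ref bs) (↭-reflexive (sym (expand-++ _ ys ws))))))

    double : ∀ k l → suc (suc (2 * k)) + (l + l) + 0 ≡ 2 * l + (suc k + suc k)
    double = ℕR.solve-∀

    -- More than `k` distinct reflections realise every nonzero difference, so any nonzero signed
    -- sum of a suitable even number of rotations will do; `x` guarantees one.
    difference-rots : ∀ x xs′ → x ∷ xs′ ↭ xs → ¬ + M ∣ x → k < length ls → length ps < M → Good (2 * M) (rots xs ++ map ref bs)
    difference-rots x xs′ px x≢0 k<ls ps<M = go (+ M ∣? (x +ᶻ sumBy id ws))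
      where
      -- The cap at M - 2 reserves four places: two for the reflections with the required
      -- difference, two for `x` and one more rotation.
      s = length ps ⊓ (M ∸ 2)
      a = (M ∸ 2) ∸ s
      2+s+a : 2 + (s + a) ≡ M
      2+s+a = trans (cong (λ n → 2 + n) (ℕₚ.m+[n∸m]≡n (ℕₚ.m⊓n≤n (length ps) (M ∸ 2)))) (ℕₚ.m+[n∸m]≡n (s≤s (ℕₚ.≤-trans 1≤k (ℕₚ.m≤m+n k _))))
      ps≤s : length ps ≤ suc s
      ps≤s with ℕₚ.⊓-sel (length ps) (M ∸ 2)
      ... | inj₁ e = ℕₚ.≤-trans (ℕₚ.≤-reflexive (sym e)) (ℕₚ.n≤1+n _)
      ... | inj₂ e = ℕₚ.≤-trans (ℕ.s≤s⁻¹ ps<M) (ℕₚ.≤-trans (ℕₚ.m≤n+m∸n (2 * k) 1) (s≤s (ℕₚ.≤-reflexive (sym e))))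
      enough : suc (2 * a) ≤ length xs′
      enough = ≤-by 0 (ℕₚ.≤-reflexive (sym total) +≤ ls≤M +≤ ps≤s +≤ ps≤s)
                 (trans (cong (λ n → suc (2 * a) + (n + (2 * length ps + length ls) + M + suc s + suc s) + 0) (sym (Permₚ.↭-length px)))
                   (lem (length ps) (length ls) s a (length xs′) M 2+s+a))
        where
        lem : ∀ p l s a x m → 2 + (s + a) ≡ m → suc (2 * a) + (suc x + (2 * p + l) + m + suc s + suc s) + 0 ≡ x + (3 * m + l + p + p)
        lem p l s a x m refl = lem′ p l s a x
          where
          lem′ : ∀ p l s a x → suc (2 * a) + (suc x + (2 * p + l) + (2 + (s + a)) + suc s + suc s) + 0 ≡ x + (3 * (2 + (s + a)) + l + p + p)
          lem′ = ℕR.solve-∀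
      chosen-rots = splitLength (suc (2 * a)) xs′ enough
      ws us : List ℤ
      ws = proj₁ chosen-rots
      us = proj₁ (proj₂ chosen-rots)
      ws++us : ws ++ us ≡ xs′
      ws++us = proj₁ (proj₂ (proj₂ chosen-rots))
      |ws| : length ws ≡ suc (2 * a)
      |ws| = proj₂ (proj₂ (proj₂ chosen-rots))

      rest-perm : (x ∷ ws) ++ us ↭ xs
      rest-perm = ↭-trans (↭-reflexive (cong (x ∷_) ws++us)) px

      size-eq : suc s * 2 + (2 + 2 * a) ≡ 2 * M
      size-eq = trans (lem s a) (cong (2 *_) 2+s+a)
        where
        lem : ∀ s a → suc s * 2 + (2 + 2 * a) ≡ 2 * (2 + (s + a))
        lem = ℕR.solve-∀

      assemble : ∀ σ → ¬ + M ∣ σ → (∀ δ → + M ∣ σ -ᶻ δ → Signed id M (2 + 2 * a) δ xs) → Good (2 * M) (rots xs ++ map ref bs)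
      assemble σ σ≢0 signs with b , b′ , rest , p , d ← difference σ ls dis (≤-by 0 (k<ls +≤ k<ls) (double k (length ls))) σ≢0
                           with qs , _ , q , l , es , vs , refl ← split s (ℕₚ.m⊓n≤m (length ps) (M ∸ 2)) =
        good-resp (trans (cong (λ n → suc n * 2 + (2 + 2 * a)) l) size-eq) ↭-refl
          (finish ((b , b′) ∷ qs) (vs ++ rest) xs perm′
            (good-rots-refs ((b , b′) ∷ qs) (s≤s z≤n) (∣-resp (lem″ b b′ (sumBy refVal qs)) (pairs-zero es)) (signs (b -ᶻ b′) d)))
        where
        lem″ : ∀ b b′ s → s ≡ (b -ᶻ b′ +ᶻ 0ℤ) +ᶻ s -ᶻ (b -ᶻ b′)
        lem″ = ℤR.solve-∀
        perm′ : b ∷ b′ ∷ flat qs ++ (vs ++ rest) ↭ bs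
        perm′ = ↭-trans (↭-trans (↭-reflexive (cong (λ t → b ∷ b′ ∷ t) (sym (++-assoc (flat qs) vs rest)))) (↭-sym (Permₚ.shifts (flat qs ++ vs) (b ∷ b′ ∷ []))))
                  (↭-trans (Permₚ.++⁺ˡ (flat qs ++ vs) p) (↭-trans (↭-assoc (flat qs) vs ls) q))

      go : Dec (+ M ∣ x +ᶻ sumBy id ws) → Good (2 * M) (rots xs ++ map ref bs)
      go (no σ≢0) = assemble _ σ≢0 λ δ d → signed (x ∷ ws) [] us (↭-trans (↭-reflexive (cong (_++ us) (++-identityʳ (x ∷ ws)))) rest-perm)
        (trans (cong length (++-identityʳ (x ∷ ws))) (cong suc |ws|)) (∣-resp (lem (x +ᶻ sumBy id ws) δ) d)
        where
        lem : ∀ a d → a -ᶻ d ≡ (a -ᶻ 0ℤ) -ᶻ d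
        lem = ℤR.solve-∀
      -- If the sum vanishes, reversing the sign of `x` gives -2x, which is nonzero because `M` is
      -- odd.
      go (yes σ≡0) = assemble (sumBy id ws -ᶻ x) (λ d → x≢0 (half {z = x} ∣-refl (∣-resp (lem x (sumBy id ws)) (∣-diff σ≡0 d))))
        λ δ d → signed ws (x ∷ []) us (↭-trans (Permₚ.++⁺ʳ us (++-comm ws (x ∷ []))) rest-perm)
          (trans (Permₚ.↭-length (++-comm ws (x ∷ []))) (cong suc |ws|)) (∣-resp (lem′ (sumBy id ws) x δ) d)
        where
        lem : ∀ x w → (x +ᶻ w) -ᶻ (w -ᶻ x) ≡ x +ᶻ x
        lem = ℤR.solve-∀
        lem′ : ∀ w x d → w -ᶻ x -ᶻ d ≡ w -ᶻ (x +ᶻ 0ℤ) -ᶻ d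
        lem′ = ℤR.solve-∀

    many-refs : k < length bs → Good (2 * M) (rots xs ++ map ref bs)
    many-refs k<bs with M ℕₚ.≤? length ps | length ls ℕₚ.≤? k | All.all? (+ M ∣?_) xs
    ... | yes le | _        | _      = only-pairs le
    ... | no M≰  | no ls≰k  | yes zs = zero-rots zs (ℕₚ.≰⇒> M≰)
    ... | no M≰  | no ls≰k  | no ¬zs with x , xs′ , x≢0 , p ← extract (Allₚ.¬All⇒Any¬ (+ M ∣?_) xs ¬zs) =
      difference-rots x xs′ p x≢0 (ℕₚ.≰⇒> ls≰k) (ℕₚ.≰⇒> M≰)
    ... | no M≰  | yes ls≤k | _      = with-cancelling ls≤k (nonempty ps refl) (ℕₚ.≰⇒> M≰)
      where
      nonempty : ∀ qs → qs ≡ ps → 1 ≤ length qs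
      nonempty (_ ∷ _) _    = s≤s z≤n
      nonempty []      refl = contradiction (subst (k <_) (sym (Permₚ.↭-length perm)) k<bs) (ℕₚ.≤⇒≯ ls≤k)

  -- The threshold `k` suits both sides: at most `k` reflections leave 5k + 3 rotations for
  -- `weighted`, while more than `k` distinct residues are more than half of ℤ/M.
  odd-dihedral : ∀ xs bs → length xs + length bs ≡ 3 * M → Good (2 * M) (rots xs ++ map ref bs)
  odd-dihedral xs []           len = no-refs xs [] (≤-by 1 (ℕₚ.≤-reflexive (sym len)) (lem M (length xs)))
    where
    lem : ∀ m x → (m + 2 * m) + (x + 0) + 1 ≡ suc x + 3 * m
    lem = ℕR.solve-∀
  odd-dihedral xs (b ∷ [])     len = no-refs xs (b ∷ []) (≤-by 0 (ℕₚ.≤-reflexive (sym len)) (lem M (length xs)))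
    where
    lem : ∀ m x → (m + 2 * m) + (x + 1) + 0 ≡ suc x + 3 * m
    lem = ℕR.solve-∀
  odd-dihedral xs (b ∷ b′ ∷ bs) len with suc (suc (length bs)) ℕₚ.≤? k
  ... | yes t≤k = few-refs xs b b′ bs (≤-by 2 (ℕₚ.≤-reflexive (sym len) +≤ t≤k) (lem k (length xs) (length bs)))
    where
    lem : ∀ k x t → suc (5 * k) + (x + suc (suc t) + k) + 2 ≡ x + (3 * suc (2 * k) + suc (suc t))
    lem = ℕR.solve-∀
  ... | no t≰k = finish′ (pair-up res (b ∷ b′ ∷ bs))
    where
    finish′ : Pairing res (b ∷ b′ ∷ bs) → Good (2 * M) (rots xs ++ map ref (b ∷ b′ ∷ bs))
    finish′ (pairing ps ls perm eqs dis) = Many.many-refs xs (b ∷ b′ ∷ bs) len ps ls perm eqs dis (ℕₚ.≰⇒> t≰k)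

-- Dicyclic groups, n odd

cancel-2 : ∀ {a b} → 2 * a ≤ suc (2 * b) → a ≤ b
cancel-2 {a} {b} le = ℕ.s≤s⁻¹ (ℕₚ.*-cancelˡ-< 2 a (suc b) (≤-by 0 le (lem a b)))
  where
  lem : ∀ a b → suc (2 * a) + suc (2 * b) + 0 ≡ 2 * suc b + 2 * a
  lem = ℕR.solve-∀

module OddDicyclic (k : ℕ) (1≤k : 1 ≤ k) where
  open Odd k

  N : ℕ
  N = 2 * M

  -- Abstract because this proof occurs in every type below, where unfolding it is expensive.
  abstract
    N∣2M : + N ∣ + M +ᶻ + M
    N∣2M = ∣-resp (trans (pos-* 2 M) (lem (+ M))) ∣-refl
      where
      lem : ∀ m → + 2 *ᶻ m ≡ m +ᶻ m
      lem = ℤR.solve-∀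

  open Model N (+ M) N∣2M

  N∣ : ∀ {z} → + 2 ∣ z → + M ∣ z → + N ∣ z
  N∣ = double-∣

  open Block

  -- The exponent is `b - b′ + M` with `M` odd, so it is reflections of opposite parity that form an
  -- even pair.
  ref-item : ∀ a b b′ → Parity a b → Parity (a +ᶻ 1ℤ) b′ → Block 2 2
  ref-item a b b′ p q = block (ref b ∷ ref b′ ∷ []) (b -ᶻ b′ +ᶻ + M) (real-ref b b′) refl
    (∣-resp (trans (lem a b b′ (+ k)) (cong (b -ᶻ b′ +ᶻ_) (sym pos-M))) (∣-sum (∣-diff p q) (∣-self (+ k))))
    where
    lem : ∀ a b b′ k → (b -ᶻ a) -ᶻ (b′ -ᶻ (a +ᶻ 1ℤ)) +ᶻ k *ᶻ + 2 ≡ b -ᶻ b′ +ᶻ (1ℤ +ᶻ + 2 *ᶻ k)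
    lem = ℤR.solve-∀

  pair-rots : ∀ a xs → All (Parity a) xs → ∃ λ n → length xs ≤ suc (2 * n) × Blocks 2 n (rots xs)
  pair-rots a xs ps with even-or-odd (length xs)
  ... | n , inj₁ e = n , ℕₚ.≤-trans (ℕₚ.≤-reflexive e) (ℕₚ.n≤1+n _) ,
    subst (Blocks 2 n) (sym (rots-expand xs)) (pair-class rot (rot-pair a) n xs ps (ℕₚ.≤-reflexive (sym e)))
  ... | n , inj₂ e = n , ℕₚ.≤-reflexive e ,
    subst (Blocks 2 n) (sym (rots-expand xs)) (pair-class rot (rot-pair a) n xs ps (ℕₚ.≤-trans (ℕₚ.n≤1+n _) (ℕₚ.≤-reflexive (sym e))))

  pair-refs : ∀ a j ms ns → j ≤ length ms → j ≤ length ns → All (Parity a) ms → All (Parity (a +ᶻ 1ℤ)) ns → Blocks 2 j (map ref ms ++ map ref ns)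
  pair-refs a zero    ms       ns       _       _        _        _        = [] , _ , ↭-refl , z≤n
  pair-refs a (suc j) (b ∷ ms) (b′ ∷ ns) (s≤s l) (s≤s l′) (p ∷ ps) (q ∷ qs) with is , R , perm , le ← pair-refs a j ms ns l l′ ps qs =
    ref-item a b b′ p q ∷ is , R , prep _ (↭-trans (prep _ perm) (↭-sym (Permₚ.shift (ref b′) (map ref ms) (map ref ns)))) , s≤s le

  all-items-eq : ∀ n₁ n₂ j e o → e + o + 2 * j + (suc (2 * n₁) + suc (2 * n₂)) + 0 ≡ 2 + 2 * (n₁ + n₂ + j) + (e + o)
  all-items-eq = ℕR.solve-∀

  -- The 2 accounts for one unpaired rotation of each parity.
  all-items : ∀ {a} j ev od ms ns → j ≤ length ms → j ≤ length ns → All (Parity 0ℤ) ev → All (Parity 1ℤ) od →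
              All (Parity a) ms → All (Parity (a +ᶻ 1ℤ)) ns →
              ∃ λ n → length ev + length od + 2 * j ≤ 2 + 2 * n × Blocks 2 n ((rots ev ++ rots od) ++ (map ref ms ++ map ref ns))
  all-items j ev od ms ns l l′ pe po pm pn
    with n₁ , le₁ , is₁ ← pair-rots 0ℤ ev pe with n₂ , le₂ , is₂ ← pair-rots 1ℤ od po =
    (n₁ + n₂) + j , ≤-by 0 (le₁ +≤ le₂) (all-items-eq n₁ n₂ j (length ev) (length od)) , blocks-++ (blocks-++ is₁ is₂) (pair-refs _ j ms ns l l′ pm pn)

  -- The pairs are even, so only the condition modulo `M` is left: 3M - 1 pairs contain 2M pairs
  -- with sum 0, that is, 4M = 2N terms.
  good-egz : ∀ {S} n → 3 * M ≤ suc n → Blocks 2 n S → Good (2 * N) S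
  good-egz {S} n le (items , R , p , l) = go (egz-multi (egz M) val 2 items (ℕₚ.≤-trans le (s≤s l)))
    where
    go : Chosen val M (2 * M) items → Good (2 * N) S
    go (chosen sel rest q size′ d) = good-resp (ℕₚ.*-comm (2 * M) 2) ↭-refl
      (good-weaken R p (good-chosen els val 2 size real sel rest q size′ (N∣ (sumBy-∣ val (All.universal div sel)) d)))

  -- Its reflection allows every further pair to be inverted, and with the 4k pairs from `weighted`
  -- the length is 4 + 8k = 2N.
  record Core (C : List E) : Set where
    field
      δ       : ℤ
      hasRef  : HasRef C
      real-δ  : Real C δ
      even-δ  : + 2 ∣ δ
      size-4  : length C ≡ 4

  good-core : ∀ {C S} n → Core C → suc (5 * k) ≤ n → Blocks 2 n S → Good (2 * N) (C ++ S)
  good-core {C} {S} n core le (items , R , p , l) = go (weighted val δ items (ℕₚ.≤-trans le l))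
    where
    open Core core
    size-eq : ∀ k → 4 + 4 * k * 2 ≡ 2 * (2 * suc (2 * k))
    size-eq = ℕR.solve-∀
    go : Chosen val M (2 * M) items ⊎ Signed val M (4 * k) δ items → Good (2 * N) (C ++ S)
    go (inj₁ (chosen sel rest q size′ d)) = good-resp (ℕₚ.*-comm (2 * M) 2) ↭-refl
      (good-weaken (C ++ R) (↭-trans (Permₚ.shifts (expand els items) C) (Permₚ.++⁺ˡ C p))
        (good-chosen els val 2 size real sel rest q size′ (N∣ (sumBy-∣ val (All.universal div sel)) d)))
    go (inj₂ (signed plus minus rest q size′ d)) = good-resp (trans (cong (_+ 4 * k * 2) size-4) (size-eq k)) ↭-refl
      (good-weaken R (↭-trans (↭-assoc C (expand els items) R) (Permₚ.++⁺ˡ C p))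
        (good-signed els val 2 size real plus minus rest hasRef real-δ q size′
          (N∣ (∣-diff (∣-diff (sumBy-∣ val (All.universal div plus)) (sumBy-∣ val (All.universal div minus))) even-δ) d)))

  -- Any 4M rotations of equal parity have an even sum, so the cyclic theorem modulo `M` with four
  -- blocks suffices.
  good-rots : ∀ a xs → All (Parity a) xs → 5 * M ≤ suc (length xs) → Good (2 * N) (rots xs)
  good-rots a xs ps le = go (egz-multi (egz M) id 4 xs le)
    where
    lem : ∀ m → 4 * m * 1 ≡ 2 * (2 * m)
    lem = ℕR.solve-∀
    sum-parity : ∀ {ys} → All (Parity a) ys → + 2 ∣ sumBy id ys -ᶻ + length ys *ᶻ a
    sum-parity [] = ∣-zero
    sum-parity {y ∷ ys} (q ∷ qs) = ∣-resp (lem′ y (sumBy id ys) (+ length ys) a) (∣-sum q (sum-parity qs))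
      where
      lem′ : ∀ y s l a → (y -ᶻ a) +ᶻ (s -ᶻ l *ᶻ a) ≡ (y +ᶻ s) -ᶻ (1ℤ +ᶻ l) *ᶻ a
      lem′ = ℤR.solve-∀
    go : Chosen id M (4 * M) xs → Good (2 * N) (rots xs)
    go (chosen sel rest p size′ d) = good-resp (lem M) ↭-refl (good-chosen _ id 1 (λ _ → refl) real-rot sel rest p size′ (N∣ even-sum d))
      where
      lem″ : ∀ s l → (s -ᶻ l) +ᶻ l ≡ s
      lem″ = ℤR.solve-∀
      four : ∀ m a → + 2 *ᶻ m *ᶻ a *ᶻ + 2 ≡ + 4 *ᶻ m *ᶻ a
      four = ℤR.solve-∀
      even-sum : + 2 ∣ sumBy id sel
      even-sum = ∣-resp (lem″ (sumBy id sel) (+ length sel *ᶻ a)) (∣-sum (sum-parity (Allₚ.++⁻ˡ sel (Permₚ.All-resp-↭ (↭-sym p) ps)))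
        (∣-resp (trans (four (+ M) a) (cong (_*ᶻ a) (trans (sym (pos-* 4 M)) (cong +_ (sym size′))))) (∣-self (+ 2 *ᶻ + M *ᶻ a))))

pairing-length : ∀ {ps : List (ℤ × ℤ)} {ls ys} → flat ps ++ ls ↭ ys → 2 * length ps + length ls ≡ length ys
pairing-length {ps} {ls} p = trans (sym (trans (length-++ (flat ps)) (cong (_+ length ls) (flat-length ps)))) (Permₚ.↭-length p)

-- The count for `many-in-one-class`: of 6M terms, four form the core, and at most M reflections and
-- k + 1 rotations stay unpaired. This leaves at least 9k paired terms, hence 4k + 1 pairs as k ≥ 1.
central-arith : ∀ k q p₂ p₃ l₁ l₂ l₃ m n x → 1 ≤ k → 2 * suc (suc q) + l₁ ≡ m → 2 * p₂ + l₂ ≡ l₁ + n → 2 * p₃ + l₃ ≡ x →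
        x + (m + n) ≡ 6 * suc (2 * k) → l₂ ≤ suc (2 * k) → l₃ ≤ suc k → 2 + 2 * k * 2 ≤ suc (q + p₂ + p₃)
central-arith k q p₂ p₃ l₁ l₂ l₃ m n x 1≤k refl e₂ refl e h₂ h₃ =
  cancel-2 (≤-by 0 (ℕₚ.≤-reflexive (sym e) +≤ ℕₚ.≤-reflexive (sym e₂) +≤ h₂ +≤ h₃ +≤ 1≤k) (lem k q p₂ p₃ l₁ l₂ l₃ n))
  where
  lem : ∀ k q p₂ p₃ l₁ l₂ l₃ n → 2 * (2 + 2 * k * 2) + ((2 * p₃ + l₃ + (2 * suc (suc q) + l₁ + n)) + (2 * p₂ + l₂) + suc (2 * k) + suc k + k) + 0
        ≡ suc (2 * suc (q + p₂ + p₃)) + (6 * suc (2 * k) + (l₁ + n) + l₂ + l₃ + 1)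
  lem = ℕR.solve-∀

module OddDicyclicBound (k : ℕ) (1≤k : 1 ≤ k) where
  open Odd k
  open OddDicyclic k 1≤k
  open Model N (+ M) N∣2M

  -- Pairs of rotations or of reflections that agree up to sign modulo the centre {1, αᴹ}.
  record CentralPair : Set where
    constructor central
    field
      els   : List E
      val   : ℤ
      rel   : Rel els val
      size  : length els ≡ 2
      div   : + M ∣ val
  open CentralPair

  central-rot : ∀ x y → fold x ≡ fold y → CentralPair
  central-rot x y e with fold-≡ x y e
  ... | inj₁ d = central (rot x ∷ rot y ∷ []) (x -ᶻ y) (λ {C} {a} → rel-++ {rot x ∷ []} {rot y ∷ []} (rel⁺ (real-rot x)) (rel⁻ (real-rot y)) {C} {a}) refl d
  ... | inj₂ d = central (rot x ∷ rot y ∷ []) (x +ᶻ y) (rel⁺ (real-++ (real-rot x) (real-rot y))) refl d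

  refVal-div : ∀ {b b′} → res b ≡ res b′ → + M ∣ b -ᶻ b′ +ᶻ + M
  refVal-div {b} {b′} e = ∣-sum (res-∣ {b} {b′} e) ∣-refl

  central-ref : ∀ b b′ → res b ≡ res b′ → CentralPair
  central-ref b b′ e = central (ref b ∷ ref b′ ∷ []) (b -ᶻ b′ +ᶻ + M) (rel⁺ (real-ref b b′)) refl (refVal-div {b} {b′} e)

  central-pairs : (el : ℤ → E) (f : ℤ → ℕ) → (∀ x y → f x ≡ f y → Σ CentralPair λ i → els i ≡ el x ∷ el y ∷ []) →
                  ∀ {ps} → All (λ p → f (proj₁ p) ≡ f (proj₂ p)) ps → ∃ λ is → expand els is ≡ map el (flat ps) × length is ≡ length ps
  central-pairs el f mk []                     = [] , refl , refl
  central-pairs el f mk {(x , y) ∷ ps} (e ∷ es) with i , eq ← mk x y e with is , eq′ , l ← central-pairs el f mk es =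
    i ∷ is , cong₂ _++_ eq eq′ , cong suc l

  parity-shift : ∀ {a b b′} → Parity a b → Parity a b′ → + 2 ∣ b -ᶻ b′
  parity-shift {a} {b} {b′} p q = ∣-resp (lem a b b′) (∣-diff p q)
    where
    lem : ∀ a b b′ → (b -ᶻ a) -ᶻ (b′ -ᶻ a) ≡ b -ᶻ b′
    lem = ℤR.solve-∀

  even-2M : ∀ x y → + 2 ∣ x → + 2 ∣ y → + 2 ∣ (x +ᶻ + M) +ᶻ (y +ᶻ + M)
  even-2M x y p q = ∣-resp (lem x y (+ M)) (∣-sum (∣-sum p q) (∣-self (+ M)))
    where
    lem : ∀ x y m → (x +ᶻ y) +ᶻ m *ᶻ + 2 ≡ (x +ᶻ m) +ᶻ (y +ᶻ m)
    lem = ℤR.solve-∀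

  -- Reflections of equal parity that agree modulo `M` are equal, and two such pairs multiply to α²ᴹ
  -- = 1 while supplying a reflection. All other pairs used have central products, so only a
  -- condition modulo 2 remains, and `egz 2` selects 4k of them.
  many-in-one-class : ∀ {a} xs ms ns → All (Parity a) ms → 3 + M ≤ length ms → length xs + (length ms + length ns) ≡ 6 * M →
                      Good (2 * N) (rots xs ++ (map ref ms ++ map ref ns))
  many-in-one-class {a} xs ms ns pm M<ms len = go₁ (pair-up res ms)
    where
    go₁ : Pairing res ms → Good (2 * N) (rots xs ++ (map ref ms ++ map ref ns))
    go₁ (pairing ps₁ ls₁ perm₁ eqs₁ dis₁) = go₂ ps₁ refl (pair-up res (ls₁ ++ ns)) (pair-up fold xs)
      where
      ls₁≤M : length ls₁ ≤ M
      ls₁≤M = length-bound res M res< dis₁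
      2≤ps₁ : 2 ≤ length ps₁
      -- At least 3 of these reflections are paired; their number is even, so there are two pairs.
      2≤ps₁ = cancel-2 (≤-by 0 (M<ms +≤ ls₁≤M) (trans (cong (λ n → 4 + (n + M) + 0) (sym (pairing-length {ps₁} {ls₁} perm₁))) (lem (length ps₁) (length ls₁) M)))
        where
        lem : ∀ p l m → 4 + (2 * p + l + m) + 0 ≡ suc (2 * p) + (3 + m + l)
        lem = ℕR.solve-∀
      go₂ : ∀ ps → ps ≡ ps₁ → Pairing res (ls₁ ++ ns) → Pairing fold xs → Good (2 * N) (rots xs ++ (map ref ms ++ map ref ns))
      go₂ []             e _ _ = contradiction (subst (λ ps → 2 ≤ length ps) (sym e) 2≤ps₁) λ ()
      go₂ (_ ∷ [])       e _ _ = contradiction (subst (λ ps → 2 ≤ length ps) (sym e) 2≤ps₁) λ { (s≤s ()) }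
      go₂ ((b₁ , b₁′) ∷ (b₂ , b₂′) ∷ qs) refl (pairing ps₂ ls₂ perm₂ eqs₂ dis₂) (pairing ps₃ ls₃ perm₃ eqs₃ dis₃) =
        go₃ (central-pairs ref res (λ x y e → central-ref x y e , refl) (Allₚ.++⁺ (All.tail (All.tail eqs₁)) eqs₂))
            (central-pairs rot fold central-rot-els eqs₃)
        where
        central-rot-els : ∀ x y → fold x ≡ fold y → Σ CentralPair λ i → els i ≡ rot x ∷ rot y ∷ []
        central-rot-els x y e = central-rot x y e , els-≡
          where
          els-≡ : els (central-rot x y e) ≡ rot x ∷ rot y ∷ []
          els-≡ with fold-≡ x y e
          ... | inj₁ _ = refl
          ... | inj₂ _ = refl
        core : List E
        core = ref b₁ ∷ ref b₁′ ∷ ref b₂ ∷ ref b₂′ ∷ []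
        δ : ℤ
        δ = (b₁ -ᶻ b₁′ +ᶻ + M) +ᶻ (b₂ -ᶻ b₂′ +ᶻ + M)
        parities : All (Parity a) (flat ps₁)
        parities = Allₚ.++⁻ˡ (flat ps₁) (Permₚ.All-resp-↭ (↭-sym perm₁) pm)
        N∣δ : + N ∣ δ
        N∣δ = N∣ (even-δ parities)
                 (∣-sum (refVal-div {b₁} {b₁′} (All.head eqs₁)) (refVal-div {b₂} {b₂′} (All.head (All.tail eqs₁))))
          where
          even-δ : All (Parity a) (flat ps₁) → + 2 ∣ δ
          even-δ (p ∷ q ∷ r ∷ s ∷ _) = even-2M (b₁ -ᶻ b₁′) (b₂ -ᶻ b₂′) (parity-shift {a} {b₁} {b₁′} p q) (parity-shift {a} {b₂} {b₂′} r s)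
        go₃ : (∃ λ is → expand els is ≡ map ref (flat (qs ++ ps₂)) × length is ≡ length (qs ++ ps₂)) →
              (∃ λ js → expand els js ≡ map rot (flat ps₃) × length js ≡ length ps₃) → Good (2 * N) (rots xs ++ (map ref ms ++ map ref ns))
        go₃ (is , eq , l) (js , eq′ , l′) = go₄ (egz-multi (egz 2) w (2 * k) (is ++ js) enough)
          where
          w : CentralPair → ℤ
          w i = quotient (div i)
          fold-bound : length ls₃ ≤ suc k
          fold-bound = length-bound fold (suc k) fold< dis₃
          enough : 2 + 2 * k * 2 ≤ suc (length (is ++ js))
          enough = subst (λ n → 2 + 2 * k * 2 ≤ suc n) (sym (trans (length-++ is) (cong₂ _+_ (trans l (length-++ qs)) l′)))
            (central-arith k (length qs) (length ps₂) (length ps₃) (length ls₁) (length ls₂) (length ls₃) (length ms) (length ns) (length xs) 1≤k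
              (pairing-length {(b₁ , b₁′) ∷ (b₂ , b₂′) ∷ qs} {ls₁} perm₁) (trans (pairing-length {ps₂} {ls₂} perm₂) (length-++ ls₁)) (pairing-length {ps₃} {ls₃} perm₃) len (length-bound res M res< dis₂) fold-bound)
          go₄ : Chosen w 2 (2 * k * 2) (is ++ js) → Good (2 * N) (rots xs ++ (map ref ms ++ map ref ns))
          go₄ (chosen sel rest p size′ d) = good-weaken (expand els rest ++ (map ref ls₂ ++ map rot ls₃)) perm
            (good-all (trans (cong (λ n → 4 + n) (trans (expand-length els (All.universal size sel)) (cong (_* 2) size′))) (size-eq k))
              (rel-expand els val rel sel (here refl) (real-++ (real-ref b₁ b₁′) (real-ref b₂ b₂′)))
              (∣-sum N∣δ (N∣ (∣-resp (sym (sumBy-* (+ M) val w (All.universal (λ i → _∣_.equality (div i)) sel))) (∣m⇒∣m*n (+ M) d))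
                             (sumBy-∣ val (All.universal div sel)))))
            where
            size-eq : ∀ k → 4 + 2 * k * 2 * 2 ≡ 2 * (2 * suc (2 * k))
            size-eq = ℕR.solve-∀
            shuffle : ∀ c s r l₂ l₃ → (c ++ s) ++ (r ++ (l₂ ++ l₃)) ↭ (c ++ (s ++ r)) ++ (l₂ ++ l₃)
            shuffle = solve 5 (λ c s r l₂ l₃ → (c ⊕ s) ⊕ (r ⊕ (l₂ ⊕ l₃)) ⊜ (c ⊕ (s ⊕ r)) ⊕ (l₂ ⊕ l₃)) ↭-refl
              where open ++-Solver E
            regroup : ∀ c q f₂ f₃ l₂ l₃ → (c ++ ((q ++ f₂) ++ f₃)) ++ (l₂ ++ l₃) ↭ (f₃ ++ l₃) ++ ((c ++ q) ++ (f₂ ++ l₂))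
            regroup = solve 6 (λ c q f₂ f₃ l₂ l₃ → (c ⊕ ((q ⊕ f₂) ⊕ f₃)) ⊕ (l₂ ⊕ l₃) ⊜ (f₃ ⊕ l₃) ⊕ ((c ⊕ q) ⊕ (f₂ ⊕ l₂))) ↭-refl
              where open ++-Solver E
            items-perm : expand els sel ++ expand els rest ↭ (map ref (flat qs) ++ map ref (flat ps₂)) ++ map rot (flat ps₃)
            items-perm = ↭-trans (expand-split els sel rest p)
              (↭-reflexive (trans (expand-++ els is js) (cong₂ _++_ (trans eq (trans (cong (map ref) (flat-++ qs ps₂)) (map-++ ref (flat qs) (flat ps₂)))) eq′)))
            refs-perm : map ref (flat ps₁) ++ (map ref (flat ps₂) ++ map ref ls₂) ↭ map ref ms ++ map ref ns
            refs-perm = ↭-trans (Permₚ.++⁺ˡ (map ref (flat ps₁)) (↭-trans (map-split ref (flat ps₂) ls₂ perm₂) (↭-reflexive (map-++ ref ls₁ ns))))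
              (↭-trans (↭-sym (↭-assoc (map ref (flat ps₁)) (map ref ls₁) (map ref ns))) (Permₚ.++⁺ʳ (map ref ns) (map-split ref (flat ps₁) ls₁ perm₁)))
            perm : (core ++ expand els sel) ++ (expand els rest ++ (map ref ls₂ ++ map rot ls₃)) ↭ rots xs ++ (map ref ms ++ map ref ns)
            perm = ↭-trans (shuffle core (expand els sel) (expand els rest) (map ref ls₂) (map rot ls₃))
              (↭-trans (Permₚ.++⁺ʳ (map ref ls₂ ++ map rot ls₃) (Permₚ.++⁺ˡ core items-perm))
              (↭-trans (regroup core (map ref (flat qs)) (map ref (flat ps₂)) (map rot (flat ps₃)) (map ref ls₂) (map rot ls₃))
                (Permₚ.++⁺ (↭-trans (map-split rot (flat ps₃) ls₃ perm₃) (↭-reflexive (sym (rots-expand xs)))) refs-perm)))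

  core-refs : ∀ {a} b₁ b₂ b₃ b₄ → Parity a b₁ → Parity a b₂ → Parity a b₃ → Parity a b₄ → Core (ref b₁ ∷ ref b₂ ∷ ref b₃ ∷ ref b₄ ∷ [])
  core-refs {a} b₁ b₂ b₃ b₄ p q r s = record
    { δ = _ ; hasRef = here refl ; real-δ = real-++ (real-ref b₁ b₂) (real-ref b₃ b₄) ; size-4 = refl
    ; even-δ = even-2M (b₁ -ᶻ b₂) (b₃ -ᶻ b₄) (parity-shift {a} {b₁} {b₂} p q) (parity-shift {a} {b₃} {b₄} r s) }

  -- Reflections of equal parity have the odd exponent `b - b′ + M`; the odd rotation `y` corrects
  -- this, and `x` brings the size to four.
  core-mixed : ∀ {a} x y b b′ → Parity 0ℤ x → Parity 1ℤ y → Parity a b → Parity a b′ → Core (rot x ∷ rot y ∷ ref b ∷ ref b′ ∷ [])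
  core-mixed {a} x y b b′ p q r s = record
    { δ = _ ; hasRef = there (there (here refl)) ; real-δ = real-++ (real-rot x) (real-++ (real-rot y) (real-ref b b′)) ; size-4 = refl
    ; even-δ = ∣-resp (trans (lem x y (b -ᶻ b′) (+ k)) (cong (λ m → x +ᶻ (y +ᶻ (b -ᶻ b′ +ᶻ m))) (sym pos-M)))
                 (∣-sum (∣-sum (∣-sum p q) (parity-shift {a} {b} {b′} r s)) (∣-self (1ℤ +ᶻ + k))) }
    where
    lem : ∀ x y d k → ((x -ᶻ 0ℤ) +ᶻ (y -ᶻ 1ℤ) +ᶻ d) +ᶻ (1ℤ +ᶻ k) *ᶻ + 2 ≡ x +ᶻ (y +ᶻ (d +ᶻ (1ℤ +ᶻ + 2 *ᶻ k)))
    lem = ℤR.solve-∀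

  5k< : ∀ {n} → 10 * k + 3 ≤ 2 + 2 * n → suc (5 * k) ≤ n
  5k< {n} le = cancel-2 (≤-by 0 le (lem k n))
    where
    lem : ∀ k n → 2 * suc (5 * k) + (2 + 2 * n) + 0 ≡ suc (2 * n) + (10 * k + 3)
    lem = ℕR.solve-∀

  Split : List ℤ → List ℤ → List ℤ → List ℤ → List E
  Split ev od ms ns = (rots ev ++ rots od) ++ (map ref ms ++ map ref ns)

  -- Unpaired are at most one reflection and one rotation of each parity; the other 6M - 3 or more
  -- terms form at least 3M - 1 pairs.
  balanced : ∀ {a} ev od ms ns → All (Parity 0ℤ) ev → All (Parity 1ℤ) od → All (Parity a) ms → All (Parity (a +ᶻ 1ℤ)) ns →
             length ns ≤ length ms → 6 * M ≤ length ev + length od + 2 * length ns + 1 → Good (2 * N) (Split ev od ms ns)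
  balanced ev od ms ns pe po pm pn ns≤ms le with n , le′ , is ← all-items (length ns) ev od ms ns ns≤ms ℕₚ.≤-refl pe po pm pn =
    good-egz n (cancel-2 (≤-by 0 (le +≤ le′) (lem n M (length ev + length od + 2 * length ns)))) is
    where
    lem : ∀ n m t → 2 * (3 * m) + (t + 1 + (2 + 2 * n)) + 0 ≡ suc (2 * suc n) + (6 * m + t)
    lem = ℕR.solve-∀

  mixed : ∀ {a} x y b b′ ev od ms ns → All (Parity 0ℤ) (x ∷ ev) → All (Parity 1ℤ) (y ∷ od) → All (Parity a) (b ∷ b′ ∷ ms) → All (Parity (a +ᶻ 1ℤ)) ns →
          length ns ≤ length ms → 10 * k + 3 ≤ length ev + length od + 2 * length ns → Good (2 * N) (Split (x ∷ ev) (y ∷ od) (b ∷ b′ ∷ ms) ns)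
  mixed {a} x y b b′ ev od ms ns (p ∷ pe) (q ∷ po) (r ∷ s ∷ pm) pn ns≤ms le with n , le′ , is ← all-items (length ns) ev od ms ns ns≤ms ℕₚ.≤-refl pe po pm pn =
    good-resp refl perm (good-core n (core-mixed {a} x y b b′ p q r s) (5k< (ℕₚ.≤-trans le le′)) is)
    where
    perm : rot x ∷ rot y ∷ ref b ∷ ref b′ ∷ Split ev od ms ns ↭ Split (x ∷ ev) (y ∷ od) (b ∷ b′ ∷ ms) ns
    perm = prep _ (↭-trans (prep _ (↭-sym (Permₚ.shifts (rots ev ++ rots od) (ref b ∷ ref b′ ∷ []))))
      (↭-sym (Permₚ.++⁺ʳ (map ref (b ∷ b′ ∷ ms) ++ map ref ns) (Permₚ.shift (rot y) (rots ev) (rots od)))))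

  one-sided : ∀ {a} j b₁ b₂ b₃ b₄ ev od ms ns → All (Parity 0ℤ) ev → All (Parity 1ℤ) od → All (Parity a) (b₁ ∷ b₂ ∷ b₃ ∷ b₄ ∷ ms) → All (Parity (a +ᶻ 1ℤ)) ns →
              j ≤ length ms → j ≤ length ns → 10 * k + 3 ≤ length ev + length od + 2 * j → Good (2 * N) (Split ev od (b₁ ∷ b₂ ∷ b₃ ∷ b₄ ∷ ms) ns)
  one-sided {a} j b₁ b₂ b₃ b₄ ev od ms ns pe po (p ∷ q ∷ r ∷ s ∷ pm) pn j≤ms j≤ns le with n , le′ , is ← all-items j ev od ms ns j≤ms j≤ns pe po pm pn =
    good-resp refl (↭-sym (Permₚ.shifts (rots ev ++ rots od) (ref b₁ ∷ ref b₂ ∷ ref b₃ ∷ ref b₄ ∷ [])))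
      (good-core n (core-refs {a} b₁ b₂ b₃ b₄ p q r s) (5k< (ℕₚ.≤-trans le le′)) is)

  -- If all rotations have one parity, only one of them stays unpaired, so two unmatched reflections
  -- can be afforded.
  lone : ∀ {a} p ys ms ns → All (Parity p) ys → All (Parity a) ms → All (Parity (a +ᶻ 1ℤ)) ns → length ns ≤ length ms →
         6 * M ≤ length ys + 2 * length ns + 2 → Good (2 * N) (rots ys ++ (map ref ms ++ map ref ns))
  lone p ys ms ns py pm pn ns≤ms le with n , le′ , is ← pair-rots p ys py =
    good-egz (n + length ns) (cancel-2 (≤-by 0 (le +≤ le′) (lem n M (length ys) (length ns)))) (blocks-++ is (pair-refs _ (length ns) ms ns ns≤ms ℕₚ.≤-refl pm pn))
    where
    lem : ∀ n m y s → 2 * (3 * m) + (y + 2 * s + 2 + suc (2 * n)) + 0 ≡ suc (2 * suc (n + s)) + (6 * m + y)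
    lem = ℕR.solve-∀

  no-odd : ∀ ev ms ns → rots ev ++ (map ref ms ++ map ref ns) ↭ Split ev [] ms ns
  no-odd ev ms ns = ↭-reflexive (cong (_++ (map ref ms ++ map ref ns)) (sym (++-identityʳ (rots ev))))

  -- The surplus `d` counts reflections without a partner of opposite parity. A core absorbs two or
  -- four reflections of the larger class; when the rotations for a mixed core do not exist, all
  -- rotations have one parity and fewer are lost in pairing.
  by-excess : ∀ a ev od ms ns d → All (Parity 0ℤ) ev → All (Parity 1ℤ) od → All (Parity a) ms → All (Parity (a +ᶻ 1ℤ)) ns →
              length ms ≡ d + length ns → length ev + length od + (length ms + length ns) ≡ 6 * M → Good (2 * N) (Split ev od ms ns)
  by-excess a ev od ms ns 0 pe po pm pn eq len = balanced ev od ms ns pe po pm pn (ℕₚ.≤-reflexive (sym eq))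
    (≤-by 1 (ℕₚ.≤-reflexive (sym len)) (trans (cong (λ s → 6 * M + (length ev + length od + (s + length ns)) + 1) eq) (lem (6 * M) (length ev + length od) (length ns))))
    where
    lem : ∀ m t n → m + (t + (n + n)) + 1 ≡ t + 2 * n + 1 + m
    lem = ℕR.solve-∀
  by-excess a ev od ms ns 1 pe po pm pn eq len = balanced ev od ms ns pe po pm pn (ℕₚ.≤-trans (ℕₚ.n≤1+n _) (ℕₚ.≤-reflexive (sym eq)))
    (≤-by 0 (ℕₚ.≤-reflexive (sym len)) (trans (cong (λ s → 6 * M + (length ev + length od + (s + length ns)) + 0) eq) (lem (6 * M) (length ev + length od) (length ns))))
    where
    lem : ∀ m t n → m + (t + (suc n + n)) + 0 ≡ t + 2 * n + 1 + m
    lem = ℕR.solve-∀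
  by-excess a (x ∷ ev) (y ∷ od) (b ∷ b′ ∷ ms) ns 2 pe po pm pn eq len = mixed x y b b′ ev od ms ns pe po pm pn (ℕₚ.≤-reflexive (sym m≡n))
    (≤-by k (ℕₚ.≤-reflexive (sym len) +≤ 1≤k) (trans (cong (λ m → 10 * k + 3 + (suc (length ev) + suc (length od) + (suc (suc m) + length ns) + k) + k) m≡n) (lem k (length ev) (length od) (length ns))))
    where
    m≡n : length ms ≡ length ns
    m≡n = ℕₚ.suc-injective (ℕₚ.suc-injective eq)
    lem : ∀ k e o n → 10 * k + 3 + (suc e + suc o + (suc (suc n) + n) + k) + k ≡ e + o + 2 * n + (6 * suc (2 * k) + 1)
    lem = ℕR.solve-∀
  by-excess a [] od ms ns 2 pe po pm pn eq len = lone 1ℤ od ms ns po pm pn (ℕₚ.≤-trans (ℕₚ.m≤n+m _ 2) (ℕₚ.≤-reflexive (sym eq)))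
    (≤-by 0 (ℕₚ.≤-reflexive (sym len)) (trans (cong (λ s → 6 * M + (length od + (s + length ns)) + 0) eq) (lem (6 * M) (length od) (length ns))))
    where
    lem : ∀ m t n → m + (t + (suc (suc n) + n)) + 0 ≡ t + 2 * n + 2 + m
    lem = ℕR.solve-∀
  by-excess a ev@(_ ∷ _) [] ms ns 2 pe po pm pn eq len = good-resp refl (no-odd ev ms ns) (lone 0ℤ ev ms ns pe pm pn (ℕₚ.≤-trans (ℕₚ.m≤n+m _ 2) (ℕₚ.≤-reflexive (sym eq)))
    (≤-by 0 (ℕₚ.≤-reflexive (sym len)) (trans (cong (λ s → 6 * M + (length ev + 0 + (s + length ns)) + 0) eq) (lem (6 * M) (length ev) (length ns)))))
    where
    lem : ∀ m t n → m + (t + 0 + (suc (suc n) + n)) + 0 ≡ t + 2 * n + 2 + m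
    lem = ℕR.solve-∀
  -- A core of four takes one reflection more than the surplus, so one reflection of the smaller
  -- class loses its partner.
  by-excess a ev od (b₁ ∷ b₂ ∷ b₃ ∷ b₄ ∷ ms) (n ∷ ns) 3 pe po pm pn eq len =
    one-sided (length ns) b₁ b₂ b₃ b₄ ev od ms (n ∷ ns) pe po pm pn (ℕₚ.≤-reflexive (sym m≡n)) (ℕₚ.n≤1+n _)
      (≤-by 0 (ℕₚ.≤-reflexive (sym len) +≤ 1≤k +≤ 1≤k) (trans (cong (λ m → 10 * k + 3 + (length ev + length od + (4 + m + suc (length ns)) + k + k) + 0) m≡n) (lem k (length ev + length od) (length ns))))
    where
    m≡n : length ms ≡ length ns
    m≡n = ℕₚ.+-cancelˡ-≡ 4 _ _ eq
    lem : ∀ k t n → 10 * k + 3 + (t + (4 + n + suc n) + k + k) + 0 ≡ t + 2 * n + (6 * suc (2 * k) + 1 + 1)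
    lem = ℕR.solve-∀
  by-excess a (x ∷ ev) (y ∷ od) (b ∷ b′ ∷ b″ ∷ []) [] 3 pe po pm pn eq len = mixed x y b b′ ev od (b″ ∷ []) [] pe po pm pn z≤n
    (≤-by 0 (ℕₚ.≤-reflexive (sym len) +≤ 1≤k +≤ 1≤k) (lem k (length ev) (length od)))
    where
    lem : ∀ k e o → 10 * k + 3 + (suc e + suc o + 3 + k + k) + 0 ≡ e + o + 0 + (6 * suc (2 * k) + 1 + 1)
    lem = ℕR.solve-∀
  by-excess a [] od ms [] 3 pe po pm pn eq len = good-weaken (map ref ms ++ []) ↭-refl (good-rots 1ℤ od po
    (≤-by k (ℕₚ.≤-reflexive (sym len) +≤ 1≤k) (trans (cong (λ s → 5 * M + (length od + (s + 0) + k) + k) eq) (lem k (length od)))))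
    where
    lem : ∀ k t → 5 * suc (2 * k) + (t + 3 + k) + k ≡ suc t + (6 * suc (2 * k) + 1)
    lem = ℕR.solve-∀
  by-excess a ev@(_ ∷ _) [] ms [] 3 pe po pm pn eq len = good-weaken (map ref ms ++ []) (no-odd ev ms []) (good-rots 0ℤ ev pe
    (≤-by k (ℕₚ.≤-reflexive (sym len) +≤ 1≤k) (trans (cong (λ s → 5 * M + (length ev + 0 + (s + 0) + k) + k) eq) (lem k (length ev)))))
    where
    lem : ∀ k t → 5 * suc (2 * k) + (t + 0 + 3 + k) + k ≡ suc t + (6 * suc (2 * k) + 1)
    lem = ℕR.solve-∀
  by-excess a ev od (b₁ ∷ b₂ ∷ b₃ ∷ b₄ ∷ ms) ns (suc (suc (suc (suc d)))) pe po pm pn eq len = go (4 + d ℕₚ.≤? 2 + M)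
    where
    m≡ : length ms ≡ d + length ns
    m≡ = ℕₚ.+-cancelˡ-≡ 4 _ _ eq
    lem : ∀ k d t n → 10 * k + 3 + (t + (4 + (d + n) + n) + (2 + suc (2 * k))) + 0 ≡ t + 2 * n + (6 * suc (2 * k) + (4 + d))
    lem = ℕR.solve-∀
    go : Dec (4 + d ≤ 2 + M) → Good (2 * N) (Split ev od (b₁ ∷ b₂ ∷ b₃ ∷ b₄ ∷ ms) ns)
    -- Outside the surplus there are 6M - (4 + d) terms, and `one-sided` needs 10k + 3 = 5M - 2 of
    -- them; this is where M + 2 comes from.
    go (yes d≤) = one-sided (length ns) b₁ b₂ b₃ b₄ ev od ms ns pe po pm pn (ℕₚ.≤-trans (ℕₚ.m≤n+m _ d) (ℕₚ.≤-reflexive (sym m≡))) ℕₚ.≤-refl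
      (≤-by 0 (ℕₚ.≤-reflexive (sym len) +≤ d≤) (trans (cong (λ m → 10 * k + 3 + (length ev + length od + (4 + m + length ns) + (2 + M)) + 0) m≡) (lem k d (length ev + length od) (length ns))))
    go (no d≰) = good-resp refl (Permₚ.++⁺ʳ (map ref (b₁ ∷ b₂ ∷ b₃ ∷ b₄ ∷ ms) ++ map ref ns) (↭-reflexive (expand-++ _ ev od)))
      (many-in-one-class {a} (ev ++ od) (b₁ ∷ b₂ ∷ b₃ ∷ b₄ ∷ ms) ns pm
        (ℕₚ.≤-trans (ℕₚ.≰⇒> d≰) (ℕₚ.≤-trans (ℕₚ.m≤m+n (4 + d) (length ns)) (ℕₚ.≤-reflexive (sym eq))))
        (trans (cong (_+ (length (b₁ ∷ b₂ ∷ b₃ ∷ b₄ ∷ ms) + length ns)) (length-++ ev)) len))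

  odd-dicyclic : ∀ xs bs → length xs + length bs ≡ 6 * M → Good (2 * N) (rots xs ++ map ref bs)
  odd-dicyclic xs bs len with ev , od , p , pe , po ← split-parity xs with b₀ , b₁ , q , p₀ , p₁ ← split-parity bs = go (ℕₚ.≤-total (length b₁) (length b₀))
    where
    count : ∀ us vs {ws : List ℤ} → us ++ vs ↭ ws → length ws ≡ length us + length vs
    count us vs r = trans (sym (Permₚ.↭-length r)) (length-++ us)
    rots-perm : rots ev ++ rots od ↭ rots xs
    rots-perm = expand-split _ ev od p
    q′ : b₁ ++ b₀ ↭ bs
    q′ = ↭-trans (++-comm b₁ b₀) q
    -- When the odd reflections are the larger class, `a = 1` and the even ones have to be read as
    -- having parity 1 + 1.
    up : ∀ z → + 2 ∣ z -ᶻ 0ℤ → + 2 ∣ z -ᶻ (1ℤ +ᶻ 1ℤ)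
    up z d = ∣-resp (lem z) (∣-diff d (∣-refl {+ 2}))
      where
      lem : ∀ z → z -ᶻ 0ℤ -ᶻ + 2 ≡ z -ᶻ + 2
      lem = ℤR.solve-∀
    len′ : ∀ us vs → us ++ vs ↭ bs → length ev + length od + (length us + length vs) ≡ 6 * M
    len′ us vs r = trans (sym (cong₂ _+_ (count ev od p) (count us vs r))) len
    go : length b₁ ≤ length b₀ ⊎ length b₀ ≤ length b₁ → Good (2 * N) (rots xs ++ map ref bs)
    go (inj₁ le) = good-resp refl (Permₚ.++⁺ rots-perm (map-split ref b₀ b₁ q))
      (by-excess 0ℤ ev od b₀ b₁ (length b₀ ∸ length b₁) pe po p₀ p₁ (sym (ℕₚ.m∸n+n≡m le)) (len′ b₀ b₁ q))
    go (inj₂ le) = good-resp refl (Permₚ.++⁺ rots-perm (map-split ref b₁ b₀ q′))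
      (by-excess 1ℤ ev od b₁ b₀ (length b₁ ∸ length b₀) pe po p₁ (All.map (λ {z} → up z) p₀) (sym (ℕₚ.m∸n+n≡m le)) (len′ b₁ b₀ q′))

-- Groups with n even

module Even (N : ℕ) (c : ℤ) (N∣2c : + N ∣ c +ᶻ c) (2∣c : + 2 ∣ c) where
  open Model N c N∣2c
  open Block public

  Blocked : ℕ → List E → Set
  Blocked s S = ∃₂ λ (b : Block s s) U → els b ++ U ↭ S

  -- Blocks whose product lies in the subgroup of index s of ⟨α⟩ are combined by the theorem for the cyclic quotient.
  combine : ∀ s q ℓ → .{{_ : NonZero q}} → N ≡ q * s → (∀ S → ℓ ≤ length S → Blocked s S) → ∀ S → ℓ + (q + q) * s ≤ length S + (s + s) → Good N S
  combine s q ℓ N≡qs base S le = go (blocks els s ℓ size base (ℕ.pred (q + q)) S (≤-by 0 le eq))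
    where
    w : Block s s → ℤ
    w b = quotient (div b)
    suc-pred : suc (ℕ.pred (q + q)) ≡ q + q
    suc-pred = ℕₚ.suc-pred (q + q) {{ℕ.>-nonZero (ℕₚ.≤-trans (ℕ.>-nonZero⁻¹ q) (ℕₚ.m≤m+n q q))}}
    eq : ℓ + ℕ.pred (q + q) * s + (length S + (s + s)) + 0 ≡ length S + s + (ℓ + (q + q) * s)
    eq = trans (lem ℓ (ℕ.pred (q + q)) s (length S)) (cong (λ r → length S + s + (ℓ + r * s)) suc-pred)
      where
      lem : ∀ ℓ p s l → ℓ + p * s + (l + (s + s)) + 0 ≡ l + s + (ℓ + (s + p * s))
      lem = ℕR.solve-∀
    go : (∃₂ λ bs rest → expand els bs ++ rest ↭ S × length bs ≡ ℕ.pred (q + q)) → Good N S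
    go (bs , rest , p , l) = go′ (egz q w bs (ℕₚ.≤-reflexive (sym (trans (cong suc l) suc-pred))))
      where
      go′ : Chosen w q q bs → Good N S
      go′ (chosen sel rest′ p′ size′ (divides r e)) = good-resp (sym N≡qs) ↭-refl (good-weaken rest p
        (good-chosen els val s size real sel rest′ p′ size′ (divides r (begin
          sumBy val sel       ≡⟨ sumBy-* (+ s) val w (All.universal (λ b → _∣_.equality (div b)) sel) ⟩
          sumBy w sel *ᶻ + s  ≡⟨ cong (_*ᶻ + s) e ⟩
          r *ᶻ + q *ᶻ + s     ≡⟨ ℤₚ.*-assoc r (+ q) (+ s) ⟩
          r *ᶻ (+ q *ᶻ + s)   ≡⟨ cong (r *ᶻ_) (trans (sym (pos-* q s)) (cong +_ (sym N≡qs))) ⟩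
          r *ᶻ + N            ∎))))
        where open ≡-Reasoning

  -- Here `c` is even, so, unlike in the odd dicyclic case, reflections of equal parity form even
  -- pairs.
  ref-pair : ∀ a b b′ → Parity a b → Parity a b′ → Σ (Block 2 2) λ i → els i ≡ ref b ∷ ref b′ ∷ []
  ref-pair a b b′ p q = block _ _ (real-ref b b′) refl (∣-sum (∣-resp (lem a b b′) (∣-diff p q)) 2∣c) , refl
    where
    lem : ∀ a b b′ → (b -ᶻ a) -ᶻ (b′ -ᶻ a) ≡ b -ᶻ b′
    lem = ℤR.solve-∀

  Quarters : List ℤ → List ℤ → List ℤ → List ℤ → List E
  Quarters r₀ r₁ f₀ f₁ = (map rot r₀ ++ map rot r₁) ++ (map ref f₀ ++ map ref f₁)

  module _ {r₀ r₁ f₀ f₁} (pr₀ : All (Parity 0ℤ) r₀) (pr₁ : All (Parity 1ℤ) r₁) (pf₀ : All (Parity 0ℤ) f₀) (pf₁ : All (Parity 1ℤ) f₁) where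

    all-pairs : ∀ a b c d → 2 * a ≤ length r₀ → 2 * b ≤ length r₁ → 2 * c ≤ length f₀ → 2 * d ≤ length f₁ → Blocks 2 ((a + b) + (c + d)) (Quarters r₀ r₁ f₀ f₁)
    all-pairs a b c d la lb lc ld =
      blocks-++ (blocks-++ (pair-class rot (rot-pair 0ℤ) a r₀ pr₀ la) (pair-class rot (rot-pair 1ℤ) b r₁ pr₁ lb))
                (blocks-++ (pair-class ref (ref-pair 0ℤ) c f₀ pf₀ lc) (pair-class ref (ref-pair 1ℤ) d f₁ pf₁ ld))

  enough-pairs : ∀ {S} m n → .{{_ : NonZero m}} → m + m ≤ suc n → Blocks 2 n S → Blocked (2 * m) S
  enough-pairs {S} m n le (items , R , p , l) = go (egz m w items (ℕₚ.≤-trans le (s≤s l)))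
    where
    w : Block 2 2 → ℤ
    w b = quotient (div b)
    go : Chosen w m m items → Blocked (2 * m) S
    go (chosen sel rest p′ size′ (divides r e)) =
      block (expand els sel) (sumBy val sel) (real-expand els val real sel)
        (trans (expand-length els (All.universal size sel)) (trans (cong (_* 2) size′) (ℕₚ.*-comm m 2)))
        (divides r (begin
          sumBy val sel       ≡⟨ sumBy-* (+ 2) val w (All.universal (λ b → _∣_.equality (div b)) sel) ⟩
          sumBy w sel *ᶻ + 2  ≡⟨ cong (_*ᶻ + 2) e ⟩
          r *ᶻ + m *ᶻ + 2     ≡⟨ lem r (+ m) ⟩
          r *ᶻ (+ 2 *ᶻ + m)   ≡⟨ cong (r *ᶻ_) (sym (pos-* 2 m)) ⟩
          r *ᶻ + (2 * m)      ∎)) ,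
      expand els rest ++ R ,
      expand-rest els sel rest p′ p
      where
      open ≡-Reasoning
      lem : ∀ r m → r *ᶻ m *ᶻ + 2 ≡ r *ᶻ (+ 2 *ᶻ m)
      lem = ℤR.solve-∀

  -- All four classes modulo ⟨α²⟩ have odd size.
  OddCase : ℕ → Set
  OddCase m = ∀ {r₀ r₁ f₀ f₁} → All (Parity 0ℤ) r₀ → All (Parity 1ℤ) r₁ → All (Parity 0ℤ) f₀ → All (Parity 1ℤ) f₁ →
              ∀ a b c d → length r₀ ≡ suc (2 * a) → length r₁ ≡ suc (2 * b) → length f₀ ≡ suc (2 * c) → length f₁ ≡ suc (2 * d) →
              2 + ((a + b) + (c + d)) ≡ 2 * m → Blocked (2 * m) (Quarters r₀ r₁ f₀ f₁)

  -- If some class has even size, at most three of the 4m terms stay unpaired, which leaves the 2m -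
  -- 1 pairs required modulo `m`. If all four sizes are odd, one pair is missing and `odd-case`
  -- takes over.
  by-parities : ∀ m → .{{_ : NonZero m}} → OddCase m → ∀ {r₀ r₁ f₀ f₁} → All (Parity 0ℤ) r₀ → All (Parity 1ℤ) r₁ → All (Parity 0ℤ) f₀ → All (Parity 1ℤ) f₁ →
                (length r₀ + length r₁) + (length f₀ + length f₁) ≡ 4 * m → Blocked (2 * m) (Quarters r₀ r₁ f₀ f₁)
  by-parities m odd-case {r₀} {r₁} {f₀} {f₁} pr₀ pr₁ pf₀ pf₁ len
    with even-or-odd (length r₀) | even-or-odd (length r₁) | even-or-odd (length f₀) | even-or-odd (length f₁)
  ... | a , pa | b , pb | c′ , pc | d , pd = go pa pb pc pd
    where
    Half : ℕ → ℕ → Set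
    Half n l = l ≡ 2 * n ⊎ l ≡ suc (2 * n)
    lower : ∀ n {l} → Half n l → 2 * n ≤ l
    lower n (inj₁ refl) = ℕₚ.≤-refl
    lower n (inj₂ refl) = ℕₚ.n≤1+n _
    upper : ∀ n {l} → Half n l → l ≤ suc (2 * n)
    upper n (inj₁ refl) = ℕₚ.n≤1+n _
    upper n (inj₂ refl) = ℕₚ.≤-refl
    by-pairs : Half a (length r₀) → Half b (length r₁) → Half c′ (length f₀) → Half d (length f₁) →
               (length r₀ + length r₁) + (length f₀ + length f₁) ≤ 3 + 2 * ((a + b) + (c′ + d)) → Blocked (2 * m) (Quarters r₀ r₁ f₀ f₁)
    by-pairs pa pb pc pd le = enough-pairs m _ (cancel-2 (≤-by 0 (ℕₚ.≤-trans (ℕₚ.≤-reflexive (sym len)) le) (lem m ((a + b) + (c′ + d)))))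
      (all-pairs pr₀ pr₁ pf₀ pf₁ a b c′ d (lower a pa) (lower b pb) (lower c′ pc) (lower d pd))
      where
      lem : ∀ m n → 2 * (m + m) + (3 + 2 * n) + 0 ≡ suc (2 * suc n) + 4 * m
      lem = ℕR.solve-∀
    go : Half a (length r₀) → Half b (length r₁) → Half c′ (length f₀) → Half d (length f₁) → Blocked (2 * m) (Quarters r₀ r₁ f₀ f₁)
    go (inj₂ ea) (inj₂ eb) (inj₂ ec) (inj₂ ed) = odd-case pr₀ pr₁ pf₀ pf₁ a b c′ d ea eb ec ed
      (ℕₚ.*-cancelˡ-≡ _ _ 2 (trans (lem a b c′ d) (trans (sym (cong₂ _+_ (cong₂ _+_ ea eb) (cong₂ _+_ ec ed))) (trans len (ℕₚ.*-assoc 2 2 m)))))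
      where
      lem : ∀ a b c d → 2 * (2 + ((a + b) + (c + d))) ≡ (suc (2 * a) + suc (2 * b)) + (suc (2 * c) + suc (2 * d))
      lem = ℕR.solve-∀
    go pa@(inj₁ ea) pb pc pd = by-pairs pa pb pc pd (ℕₚ.≤-trans ((ℕₚ.≤-reflexive ea +≤ upper b pb) +≤ (upper c′ pc +≤ upper d pd)) (ℕₚ.≤-reflexive (lem a b c′ d)))
      where
      lem : ∀ a b c d → (2 * a + suc (2 * b)) + (suc (2 * c) + suc (2 * d)) ≡ 3 + 2 * ((a + b) + (c + d))
      lem = ℕR.solve-∀
    go pa pb@(inj₁ eb) pc pd = by-pairs pa pb pc pd (ℕₚ.≤-trans ((upper a pa +≤ ℕₚ.≤-reflexive eb) +≤ (upper c′ pc +≤ upper d pd)) (ℕₚ.≤-reflexive (lem a b c′ d)))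
      where
      lem : ∀ a b c d → (suc (2 * a) + 2 * b) + (suc (2 * c) + suc (2 * d)) ≡ 3 + 2 * ((a + b) + (c + d))
      lem = ℕR.solve-∀
    go pa pb pc@(inj₁ ec) pd = by-pairs pa pb pc pd (ℕₚ.≤-trans ((upper a pa +≤ upper b pb) +≤ (ℕₚ.≤-reflexive ec +≤ upper d pd)) (ℕₚ.≤-reflexive (lem a b c′ d)))
      where
      lem : ∀ a b c d → (suc (2 * a) + suc (2 * b)) + (2 * c + suc (2 * d)) ≡ 3 + 2 * ((a + b) + (c + d))
      lem = ℕR.solve-∀
    go pa pb pc pd@(inj₁ ed) = by-pairs pa pb pc pd (ℕₚ.≤-trans ((upper a pa +≤ upper b pb) +≤ (upper c′ pc +≤ ℕₚ.≤-reflexive ed)) (ℕₚ.≤-reflexive (lem a b c′ d)))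
      where
      lem : ∀ a b c d → (suc (2 * a) + suc (2 * b)) + (suc (2 * c) + 2 * d) ≡ 3 + 2 * ((a + b) + (c + d))
      lem = ℕR.solve-∀

  even-base : ∀ m → .{{_ : NonZero m}} → OddCase m → ∀ S → 4 * m ≤ length S → Blocked (2 * m) S
  even-base m odd-case S le
    with S₁ , S₂ , refl , l ← splitLength (4 * m) S le
    with xs , bs , p ← separate S₁
    with r₀ , r₁ , pr , pr₀ , pr₁ ← split-parity xs
    with f₀ , f₁ , pf , pf₀ , pf₁ ← split-parity bs
    = finish (by-parities m odd-case pr₀ pr₁ pf₀ pf₁ (trans len (trans (Permₚ.↭-length perm) l)))
    where
    perm : Quarters r₀ r₁ f₀ f₁ ↭ S₁
    perm = ↭-trans (Permₚ.++⁺ (map-split rot r₀ r₁ pr) (map-split ref f₀ f₁ pf)) p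
    len : (length r₀ + length r₁) + (length f₀ + length f₁) ≡ length (Quarters r₀ r₁ f₀ f₁)
    len = sym (trans (length-++ (map rot r₀ ++ map rot r₁)) (cong₂ _+_
      (trans (length-++ (map rot r₀)) (cong₂ _+_ (length-map rot r₀) (length-map rot r₁)))
      (trans (length-++ (map ref f₀)) (cong₂ _+_ (length-map ref f₀) (length-map ref f₁)))))
    finish : Blocked (2 * m) (Quarters r₀ r₁ f₀ f₁) → Blocked (2 * m) (S₁ ++ S₂)
    finish (b , U , q) = b , U ++ S₂ , ↭-trans (↭-sym (↭-assoc (els b) U S₂)) (Permₚ.++⁺ʳ S₂ (↭-trans q perm))

  quadruple : ∀ {x y b b′} {r₀ r₁ f₀ f₁} → rot x ∷ rot y ∷ ref b ∷ ref b′ ∷ Quarters r₀ r₁ f₀ f₁ ↭ Quarters (x ∷ r₀) (y ∷ r₁) (b ∷ f₀) (b′ ∷ f₁)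
  quadruple {x} {y} {b} {b′} {r₀} {r₁} {f₀} {f₁} = prep _
    (↭-sym (↭-trans (Permₚ.++⁺ʳ (map ref (b ∷ f₀) ++ map ref (b′ ∷ f₁)) (Permₚ.shift (rot y) (map rot r₀) (map rot r₁)))
      (prep _ (↭-trans (Permₚ.++⁺ˡ (map rot r₀ ++ map rot r₁) (prep _ (Permₚ.shift (ref b′) (map ref f₀) (map ref f₁))))
        (Permₚ.shifts (map rot r₀ ++ map rot r₁) (ref b ∷ ref b′ ∷ []))))))

  -- One term of each class gives an even exponent. If it is 2 modulo 4, inverting the odd rotation
  -- `y` changes it by 2y, which is also 2 modulo 4.
  odd-case-2 : OddCase 2
  odd-case-2 {x ∷ r₀} {y ∷ r₁} {b ∷ f₀} {b′ ∷ f₁} (px ∷ _) (py ∷ _) (pb ∷ _) (pb′ ∷ _) _ _ _ _ _ _ _ _ _ = choose (+ 4 ∣? z)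
    where
    core : Real (ref b ∷ ref b′ ∷ []) (b -ᶻ b′ +ᶻ c)
    core = real-ref b b′
    z : ℤ
    z = ((b -ᶻ b′ +ᶻ c) +ᶻ x) +ᶻ y
    perm : ∀ {T} → T ↭ rot x ∷ rot y ∷ ref b ∷ ref b′ ∷ [] → T ++ Quarters r₀ r₁ f₀ f₁ ↭ Quarters (x ∷ r₀) (y ∷ r₁) (b ∷ f₀) (b′ ∷ f₁)
    perm q = ↭-trans (Permₚ.++⁺ʳ _ q) (quadruple {x} {y} {b} {b′} {r₀} {r₁} {f₀} {f₁})
    T↭ : ref b ∷ ref b′ ∷ rot x ∷ rot y ∷ [] ↭ rot x ∷ rot y ∷ ref b ∷ ref b′ ∷ []
    T↭ = ++-comm (ref b ∷ ref b′ ∷ []) (rot x ∷ rot y ∷ [])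
    plus : Real (ref b ∷ ref b′ ∷ rot x ∷ rot y ∷ []) z
    plus = real-++ (real-++ core (real-rot x)) (real-rot y)
    minus : Real (ref b ∷ ref b′ ∷ rot x ∷ rot y ∷ []) (((b -ᶻ b′ +ᶻ c) +ᶻ x) -ᶻ y)
    minus = real-- (here refl) (real-++ core (real-rot x)) (real-rot y)
    choose : Dec (+ 4 ∣ z) → Blocked 4 (Quarters (x ∷ r₀) (y ∷ r₁) (b ∷ f₀) (b′ ∷ f₁))
    choose (yes d) = block _ z plus refl d , Quarters r₀ r₁ f₀ f₁ , perm T↭
    choose (no ¬d) = block _ _ minus refl (four-∣ (parity-of 2∣z)) , Quarters r₀ r₁ f₀ f₁ , perm T↭
      where
      lem₁ : ∀ b b′ c x y → ((b -ᶻ 0ℤ) -ᶻ (b′ -ᶻ 1ℤ)) +ᶻ c +ᶻ ((x -ᶻ 0ℤ) +ᶻ (y -ᶻ 1ℤ)) ≡ ((b -ᶻ b′ +ᶻ c) +ᶻ x) +ᶻ y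
      lem₁ = ℤR.solve-∀
      2∣z : + 2 ∣ z
      2∣z = ∣-resp (lem₁ b b′ c x y) (∣-sum (∣-sum (∣-diff pb pb′) 2∣c) (∣-sum px py))
      parity-of : (d : + 2 ∣ z) → + 2 ∣ quotient d -ᶻ 0ℤ ⊎ + 2 ∣ quotient d -ᶻ 1ℤ
      parity-of d = parity (quotient d)
      lem₂ : ∀ v → v *ᶻ + 2 *ᶻ + 2 ≡ v *ᶻ + 4
      lem₂ = ℤR.solve-∀
      lem₃ : ∀ u v → (u -ᶻ 0ℤ) ≡ v *ᶻ + 2 → u *ᶻ + 2 ≡ v *ᶻ + 4
      lem₃ u v e = trans (cong (_*ᶻ + 2) (trans (sym (ℤₚ.+-identityʳ u)) e)) (lem₂ v)
      lem₄ : ∀ a u y → (a +ᶻ y ≡ u *ᶻ + 2) → a -ᶻ y ≡ ((u -ᶻ 1ℤ) -ᶻ (y -ᶻ 1ℤ)) *ᶻ + 2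
      lem₄ a u y e = trans (step a y) (trans (cong (λ t → t -ᶻ y *ᶻ + 2) e) (step′ u y))
        where
        step : ∀ a y → a -ᶻ y ≡ (a +ᶻ y) -ᶻ y *ᶻ + 2
        step = ℤR.solve-∀
        step′ : ∀ u y → u *ᶻ + 2 -ᶻ y *ᶻ + 2 ≡ ((u -ᶻ 1ℤ) -ᶻ (y -ᶻ 1ℤ)) *ᶻ + 2
        step′ = ℤR.solve-∀
      four-∣ : + 2 ∣ quotient 2∣z -ᶻ 0ℤ ⊎ + 2 ∣ quotient 2∣z -ᶻ 1ℤ → + 4 ∣ ((b -ᶻ b′ +ᶻ c) +ᶻ x) -ᶻ y
      four-∣ (inj₁ (divides v e)) = contradiction (divides v (trans (_∣_.equality 2∣z) (lem₃ (quotient 2∣z) v e))) ¬d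
      four-∣ (inj₂ d) with divides r e ← ∣-diff d py =
        divides r (trans (lem₄ ((b -ᶻ b′ +ᶻ c) +ᶻ x) (quotient 2∣z) y (_∣_.equality 2∣z)) (trans (cong (_*ᶻ + 2) e) (lem₂ r)))

module PrimeBase (k : ℕ) (1≤k : 1 ≤ k) (prime : Prime (suc (2 * k))) (N : ℕ) where
  open Odd k
  open Model N 0ℤ ∣-zero
  open Even N 0ℤ ∣-zero ∣-zero

  -- A `Block` freed from size and divisibility, so that a single rotation can be a summand whose
  -- sign is switched.
  record Part : Set where
    constructor part
    field
      terms : List E
      value : ℤ
      realp : Real terms value
  open Part

  toPart : Block 2 2 → Part
  toPart b = part (els b) (val b) (real b)

  parts : List (Block 2 2) → List Part
  parts = map toPart

  parts-expand : ∀ is → expand terms (parts is) ≡ expand els is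
  parts-expand []       = refl
  parts-expand (i ∷ is) = cong (els i ++_) (parts-expand is)

  parts-sum : ∀ is → sumBy value (parts is) ≡ sumBy val is
  parts-sum []       = refl
  parts-sum (i ∷ is) = cong (val i +ᶻ_) (parts-sum is)

  -- Each nonzero part may be inverted, so the M - 1 parts give all residues modulo M.
  switch : ∀ (f q : Part) is → suc (suc (length is)) ≡ M → HasRef (terms f ++ terms q) → length (terms f ++ terms q) ≡ 4 →
           ¬ + M ∣ value q → All (λ i → ¬ + M ∣ val i) is → + 2 ∣ value f +ᶻ value q → Blocked (2 * M) ((terms f ++ terms q) ++ expand els is)
  -- With the parts in `A` positive and the others negative, the exponent is f + 2a - s, where `s`
  -- is the sum over `all`; hence the doubled values and the target s - f.
  switch f q is l hasRef four q≢0 is≢0 ev = go (Cover.cover (λ i → value i +ᶻ value i) prime (sumBy value all -ᶻ value f) all nonzero (ℕₚ.≤-reflexive (sym (trans (cong (suc ∘ suc) (length-map toPart is)) l))))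
    where
    all : List Part
    all = q ∷ parts is
    double-nonzero : ∀ z → ¬ + M ∣ z → ¬ + M ∣ z +ᶻ z
    double-nonzero z ¬d d = ¬d (half {z = z} ∣-refl d)
    nonzero : All (λ i → ¬ + M ∣ value i +ᶻ value i) all
    nonzero = double-nonzero (value q) q≢0 ∷ Allₚ.map⁺ (All.map (λ {i} → double-nonzero (val i)) is≢0)
    whole : List E
    whole = (terms f ++ terms q) ++ expand els is
    go : (∃₂ λ A B → A ++ B ↭ all × + M ∣ sumBy (λ i → value i +ᶻ value i) A -ᶻ (sumBy value all -ᶻ value f)) → Blocked (2 * M) whole
    go (A , B , p , d) = finish (real-± (terms f ++ expand terms A) (expand terms B) (Permₚ.Any-resp-↭ (↭-sym perm) (Anyₚ.++⁺ˡ hasRef))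
                            (real-++ (realp f) (real-expand terms value realp A)) (real-expand terms value realp B))
      where
      perm : (terms f ++ expand terms A) ++ expand terms B ↭ whole
      perm = ↭-trans (↭-assoc (terms f) (expand terms A) (expand terms B)) (↭-trans (Permₚ.++⁺ˡ (terms f)
        (↭-trans (expand-split terms A B p) (↭-reflexive (cong (terms q ++_) (parts-expand is)))))
        (↭-sym (↭-assoc (terms f) (terms q) (expand els is))))
      a b s : ℤ
      a = sumBy value A
      b = sumBy value B
      s = sumBy value all
      s≡ : s ≡ a +ᶻ b
      s≡ = trans (sumBy-↭ value (↭-sym p)) (sumBy-++ value A B)
      double-sum : ∀ as → sumBy (λ i → value i +ᶻ value i) as ≡ sumBy value as +ᶻ sumBy value as
      double-sum []       = refl
      double-sum (x ∷ as) = trans (cong (value x +ᶻ value x +ᶻ_) (double-sum as)) (lem (value x) (sumBy value as))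
        where
        lem : ∀ x s → x +ᶻ x +ᶻ (s +ᶻ s) ≡ (x +ᶻ s) +ᶻ (x +ᶻ s)
        lem = ℤR.solve-∀
      lem₁ : ∀ a b f → (a +ᶻ a) -ᶻ ((a +ᶻ b) -ᶻ f) ≡ (f +ᶻ a) -ᶻ b
      lem₁ = ℤR.solve-∀
      M∣ : + M ∣ (value f +ᶻ a) -ᶻ b
      M∣ = ∣-resp (trans (cong₂ (λ u v → u -ᶻ (v -ᶻ value f)) (double-sum A) s≡) (lem₁ a b (value f))) d
      lem₂ : ∀ f q s a b → q +ᶻ s ≡ a +ᶻ b → (f +ᶻ q) +ᶻ s -ᶻ b *ᶻ + 2 ≡ (f +ᶻ a) -ᶻ b
      lem₂ f q s a b e = trans (step f q s b) (trans (cong (λ t → f +ᶻ t -ᶻ b *ᶻ + 2) e) (step′ f a b))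
        where
        step : ∀ f q s b → (f +ᶻ q) +ᶻ s -ᶻ b *ᶻ + 2 ≡ f +ᶻ (q +ᶻ s) -ᶻ b *ᶻ + 2
        step = ℤR.solve-∀
        step′ : ∀ f a b → f +ᶻ (a +ᶻ b) -ᶻ b *ᶻ + 2 ≡ (f +ᶻ a) -ᶻ b
        step′ = ℤR.solve-∀
      two∣ : + 2 ∣ (value f +ᶻ a) -ᶻ b
      two∣ = ∣-resp (lem₂ (value f) (value q) (sumBy value (parts is)) a b s≡)
        (∣-diff (∣-sum ev (∣-resp (sym (parts-sum is)) (sumBy-∣ val (All.universal div is)))) (∣-self b))
      size≡ : length ((terms f ++ expand terms A) ++ expand terms B) ≡ 2 * M
      size≡ = trans (Permₚ.↭-length perm) (trans (length-++ (terms f ++ terms q)) (trans (cong₂ _+_ four (expand-length els (All.universal size is))) (trans (lem (length is)) (cong (2 *_) l))))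
        where
        lem : ∀ n → 4 + n * 2 ≡ 2 * suc (suc n)
        lem = ℕR.solve-∀
      T : List E
      T = (terms f ++ expand terms A) ++ expand terms B
      finish : Real T ((value f +ᶻ a) -ᶻ b) ⊎ Real T (b -ᶻ (value f +ᶻ a)) → Blocked (2 * M) whole
      finish (inj₁ r) = block T _ r size≡ (double-∣ two∣ M∣) , [] , ↭-trans (↭-reflexive (++-identityʳ T)) perm
      finish (inj₂ r) = block T _ r size≡ (∣-resp (neg-diff (value f +ᶻ a) b) (∣-neg (double-∣ two∣ M∣))) , [] , ↭-trans (↭-reflexive (++-identityʳ T)) perm

  zero-pairs : ∀ {S} is R → expand els is ++ R ↭ S → All (λ i → + M ∣ val i) is → M ≤ length is → Blocked (2 * M) S
  zero-pairs is R p zs le with as , bs , refl , l ← splitLength M is le =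
    block (expand els as) (sumBy val as) (real-expand els val real as)
      (trans (expand-length els (All.universal size as)) (trans (cong (_* 2) l) (ℕₚ.*-comm M 2)))
      (double-∣ (sumBy-∣ val (All.universal div as)) (sumBy-∣ val (Allₚ.++⁻ˡ as zs))) ,
    expand els bs ++ R , expand-rest els as bs ↭-refl p

  by-zeros : ∀ (is : List (Block 2 2)) → ∃₂ λ zs ns → zs ++ ns ↭ is × All (λ i → + M ∣ val i) zs × All (λ i → ¬ + M ∣ val i) ns
  by-zeros [] = [] , [] , ↭-refl , [] , []
  by-zeros (i ∷ is) with by-zeros is | + M ∣? val i
  ... | zs , ns , p , pz , pn | yes d = i ∷ zs , ns , prep i p , d ∷ pz , pn
  ... | zs , ns , p , pz , pn | no ¬d = zs , i ∷ ns , ↭-trans (Permₚ.shift i zs ns) (prep i p) , pz , ¬d ∷ pn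

  -- Of the 2M - 2 pairs, either `M` vanish modulo `M`, and these alone suffice, or at least M - 1
  -- do not, and M - 2 of them together with `q` are what `switch` needs.
  nonzero-quadruple : ∀ (f q : Part) {S} → HasRef (terms f ++ terms q) → length (terms f ++ terms q) ≡ 4 → ¬ + M ∣ value q → + 2 ∣ value f +ᶻ value q →
                      ∀ n → 2 + n ≡ 2 * M → Blocks 2 n S → Blocked (2 * M) ((terms f ++ terms q) ++ S)
  nonzero-quadruple f q {S} hasRef four q≢0 ev n eq (is , R , p , l) = go (by-zeros is)
    where
    m = ℕ.pred (2 * k)
    m+2 : suc (suc m) ≡ M
    m+2 = cong suc (ℕₚ.suc-pred (2 * k) {{ℕ.>-nonZero (ℕₚ.≤-trans 1≤k (ℕₚ.m≤m+n k _))}})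
    Q = terms f ++ terms q
    go : (∃₂ λ zs ns → zs ++ ns ↭ is × All (λ i → + M ∣ val i) zs × All (λ i → ¬ + M ∣ val i) ns) → Blocked (2 * M) (Q ++ S)
    go (zs , ns , p′ , pz , pn) = decide (M ℕₚ.≤? length zs)
      where
      items-perm : expand els zs ++ (expand els ns ++ R) ↭ S
      items-perm = expand-rest els zs ns p′ p
      decide : Dec (M ≤ length zs) → Blocked (2 * M) (Q ++ S)
      decide (yes le) = zero-pairs zs (Q ++ (expand els ns ++ R)) (↭-trans (Permₚ.shifts (expand els zs) Q) (Permₚ.++⁺ˡ Q items-perm)) pz le
      decide (no M≰) = use (splitLength m ns enough)
        where
        enough : m ≤ length ns
        enough = ≤-by 1 (l +≤ ℕₚ.≰⇒> M≰) (lem m (length zs) (length ns) (length is) M n m+2 (trans (sym (length-++ zs)) (Permₚ.↭-length p′)) eq)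
          where
          lem : ∀ m z n i M p → suc (suc m) ≡ M → z + n ≡ i → 2 + p ≡ 2 * M → m + (i + M) + 1 ≡ n + (p + suc z)
          lem m z n _ _ p refl refl e = trans (lem₁ m z n) (cong (λ t → n + (t + suc z)) (ℕₚ.suc-injective (ℕₚ.suc-injective (trans (lem₂ m) (sym e)))))
            where
            lem₁ : ∀ m z n → m + (z + n + suc (suc m)) + 1 ≡ n + (2 + (m + m) + suc z)
            lem₁ = ℕR.solve-∀
            lem₂ : ∀ m → 2 + (2 + (m + m)) ≡ 2 * suc (suc m)
            lem₂ = ℕR.solve-∀
        lem′ : ∀ q a b z r → (q ++ a) ++ (b ++ (z ++ r)) ↭ q ++ (z ++ ((a ++ b) ++ r))
        lem′ = solve 5 (λ q a b z r → (q ⊕ a) ⊕ (b ⊕ (z ⊕ r)) ⊜ q ⊕ (z ⊕ ((a ⊕ b) ⊕ r))) ↭-refl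
          where open ++-Solver E
        use : (∃₂ λ as bs → as ++ bs ≡ ns × length as ≡ m) → Blocked (2 * M) (Q ++ S)
        use (as , bs , refl , la) =
          let b , U , r = switch f q as (trans (cong (suc ∘ suc) la) m+2) hasRef four q≢0 (Allₚ.++⁻ˡ as pn) ev
          in b , U ++ (expand els bs ++ (expand els zs ++ R)) ,
             ↭-trans (↭-sym (↭-assoc (els b) U _)) (↭-trans (Permₚ.++⁺ʳ (expand els bs ++ (expand els zs ++ R)) r)
               (↭-trans (lem′ Q (expand els as) (expand els bs) (expand els zs) R)
                 (Permₚ.++⁺ˡ Q (↭-trans (Permₚ.++⁺ˡ (expand els zs) (↭-reflexive (cong (_++ R) (sym (expand-++ els as bs))))) items-perm))))

  blocked-↭ : ∀ {s S S′} → S ↭ S′ → Blocked s S → Blocked s S′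
  blocked-↭ p (b , U , q) = b , U , ↭-trans q p

  -- The quadruple needs a part that is nonzero modulo `M`: a rotation, or two reflections of
  -- different classes that differ modulo `M`. If there is none, all rotations vanish and all
  -- reflections agree modulo `M`, and pairs within a class are already trivial.
  odd-case : OddCase M
  odd-case {r₀} {r₁} {f₀} {f₁} pr₀ pr₁ pf₀ pf₁ a b c d ea eb ec ed eq = locate (head r₀ ea) (head r₁ eb) (head f₀ ec) (head f₁ ed)
    where
    Quad : Set
    Quad = Blocked (2 * M) (Quarters r₀ r₁ f₀ f₁)

    Head : List ℤ → Set
    Head xs = ∃₂ λ x ys → x ∷ ys ↭ xs

    head : ∀ {n} xs → length xs ≡ suc n → Head xs
    head (x ∷ xs) _ = x , xs , ↭-refl

    use : ∀ {x y e e′ u v w z} → x ∷ u ↭ r₀ → y ∷ v ↭ r₁ → e ∷ w ↭ f₀ → e′ ∷ z ↭ f₁ → (¬ + M ∣ x ⊎ ¬ + M ∣ y) ⊎ ¬ + M ∣ e -ᶻ e′ → Quad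
    use {x} {y} {e} {e′} {u} {v} {w} {z} p₀ p₁ q₀ q₁ nz = blocked-↭ perm (go (Permₚ.All-resp-↭ (↭-sym p₀) pr₀) (Permₚ.All-resp-↭ (↭-sym p₁) pr₁) (Permₚ.All-resp-↭ (↭-sym q₀) pf₀) (Permₚ.All-resp-↭ (↭-sym q₁) pf₁) nz)
      where
      four : List E
      four = rot x ∷ rot y ∷ ref e ∷ ref e′ ∷ []
      perm : four ++ Quarters u v w z ↭ Quarters r₀ r₁ f₀ f₁
      perm = ↭-trans (quadruple {x} {y} {e} {e′} {u} {v} {w} {z})
        (Permₚ.++⁺ (Permₚ.++⁺ (Permₚ.map⁺ rot p₀) (Permₚ.map⁺ rot p₁)) (Permₚ.++⁺ (Permₚ.map⁺ ref q₀) (Permₚ.map⁺ ref q₁)))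
      pred-length : ∀ {t n} {ts ss : List ℤ} → t ∷ ts ↭ ss → length ss ≡ suc (2 * n) → 2 * n ≤ length ts
      pred-length p l = ℕₚ.≤-reflexive (ℕₚ.suc-injective (trans (sym l) (sym (Permₚ.↭-length p))))
      even-total : ∀ x y e e′ → Parity 0ℤ x → Parity 1ℤ y → Parity 0ℤ e → Parity 1ℤ e′ → + 2 ∣ (x +ᶻ y) +ᶻ (e -ᶻ e′)
      even-total x y e e′ px py pe pe′ = ∣-resp (lem x y (e -ᶻ e′)) (∣-sum (∣-sum px py) (∣-resp (lem′ e e′) (∣-diff pe pe′)))
        where
        lem : ∀ x y d → (x -ᶻ 0ℤ) +ᶻ (y -ᶻ 1ℤ) +ᶻ (d +ᶻ 1ℤ) ≡ (x +ᶻ y) +ᶻ d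
        lem = ℤR.solve-∀
        lem′ : ∀ e e′ → (e -ᶻ 0ℤ) -ᶻ (e′ -ᶻ 1ℤ) ≡ (e -ᶻ e′) +ᶻ 1ℤ
        lem′ = ℤR.solve-∀
      go : All (Parity 0ℤ) (x ∷ u) → All (Parity 1ℤ) (y ∷ v) → All (Parity 0ℤ) (e ∷ w) → All (Parity 1ℤ) (e′ ∷ z) →
           (¬ + M ∣ x ⊎ ¬ + M ∣ y) ⊎ ¬ + M ∣ e -ᶻ e′ → Blocked (2 * M) (four ++ Quarters u v w z)
      go (px ∷ pu) (py ∷ pv) (pe ∷ pw) (pe′ ∷ pz) = cases
        where
        items : Blocks 2 ((a + b) + (c + d)) (Quarters u v w z)
        items = all-pairs pu pv pw pz a b c d (pred-length {n = a} p₀ ea) (pred-length {n = b} p₁ eb) (pred-length {n = c} q₀ ec) (pred-length {n = d} q₁ ed)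
        ev : + 2 ∣ (x +ᶻ y) +ᶻ (e -ᶻ e′)
        ev = even-total x y e e′ px py pe pe′
        refsPart : Part
        refsPart = part (ref e ∷ ref e′ ∷ []) (e -ᶻ e′ +ᶻ 0ℤ) (real-ref e e′)
        rotPart : ℤ → Part
        rotPart t = part (rot t ∷ []) t (real-rot t)
        join : Part → Part → Part
        join p q = part (terms p ++ terms q) (value p +ᶻ value q) (real-++ (realp p) (realp q))
        cases : (¬ + M ∣ x ⊎ ¬ + M ∣ y) ⊎ ¬ + M ∣ e -ᶻ e′ → Blocked (2 * M) (four ++ Quarters u v w z)
        cases (inj₁ (inj₁ ne)) = blocked-↭ (Permₚ.++⁺ʳ (Quarters u v w z) (++-comm (rot y ∷ ref e ∷ ref e′ ∷ []) (rot x ∷ [])))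
          (nonzero-quadruple (join (rotPart y) refsPart) (rotPart x) (there (here refl)) refl ne (∣-resp (lem x y (e -ᶻ e′)) ev) _ eq items)
          where
          lem : ∀ x y d → (x +ᶻ y) +ᶻ d ≡ (y +ᶻ (d +ᶻ 0ℤ)) +ᶻ x
          lem = ℤR.solve-∀
        cases (inj₁ (inj₂ ne)) = blocked-↭ (Permₚ.++⁺ʳ (Quarters u v w z) (prep (rot x) (++-comm (ref e ∷ ref e′ ∷ []) (rot y ∷ []))))
          (nonzero-quadruple (join (rotPart x) refsPart) (rotPart y) (there (here refl)) refl ne (∣-resp (lem x y (e -ᶻ e′)) ev) _ eq items)
          where
          lem : ∀ x y d → (x +ᶻ y) +ᶻ d ≡ (x +ᶻ (d +ᶻ 0ℤ)) +ᶻ y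
          lem = ℤR.solve-∀
        cases (inj₂ ne) = nonzero-quadruple (join (rotPart x) (rotPart y)) refsPart (there (there (here refl))) refl
          (λ h → ne (∣-resp (ℤₚ.+-identityʳ (e -ᶻ e′)) h)) (∣-resp (lem x y (e -ᶻ e′)) ev) _ eq items
          where
          lem : ∀ x y d → (x +ᶻ y) +ᶻ d ≡ (x +ᶻ y) +ᶻ (d +ᶻ 0ℤ)
          lem = ℤR.solve-∀

    constant : ∀ e → All (λ x → + M ∣ x) r₀ → All (λ x → + M ∣ x) r₁ → All (λ f → + M ∣ e -ᶻ f) f₀ → All (λ f → + M ∣ e -ᶻ f) f₁ → Quad
    constant e zr₀ zr₁ zf₀ zf₁ = go (blocks-++ (blocks-++ (pair-class rot (zero-rots 0ℤ) a r₀ (All.zip (pr₀ , zr₀)) (le a ea)) (pair-class rot (zero-rots 1ℤ) b r₁ (All.zip (pr₁ , zr₁)) (le b eb)))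
                                               (blocks-++ (pair-class ref (zero-refs 0ℤ) c f₀ (All.zip (pf₀ , zf₀)) (le c ec)) (pair-class ref (zero-refs 1ℤ) d f₁ (All.zip (pf₁ , zf₁)) (le d ed))))
      where
      le : ∀ n {l} → l ≡ suc (2 * n) → 2 * n ≤ l
      le n refl = ℕₚ.n≤1+n _
      zero-rots : ∀ p x y → Parity p x × + M ∣ x → Parity p y × + M ∣ y → Σ (Block (2 * M) 2) λ i → els i ≡ rot x ∷ rot y ∷ []
      zero-rots p x y (px , zx) (py , zy) = block _ _ (real-++ (real-rot x) (real-rot y)) refl (double-∣ (div (proj₁ (rot-pair p x y px py))) (∣-sum zx zy)) , refl
      lem : ∀ e x y → (e -ᶻ y) -ᶻ (e -ᶻ x) ≡ x -ᶻ y +ᶻ 0ℤ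
      lem = ℤR.solve-∀
      zero-refs : ∀ p x y → Parity p x × + M ∣ e -ᶻ x → Parity p y × + M ∣ e -ᶻ y → Σ (Block (2 * M) 2) λ i → els i ≡ ref x ∷ ref y ∷ []
      zero-refs p x y (px , zx) (py , zy) = block _ _ (real-ref x y) refl (double-∣ (div (proj₁ (ref-pair p x y px py))) (∣-resp (lem e x y) (∣-diff zy zx))) , refl
      M≤ : M ≤ (a + b) + (c + d)
      M≤ = ≤-by k (ℕₚ.≤-reflexive (sym eq) +≤ 1≤k) (arith k ((a + b) + (c + d)))
        where
        arith : ∀ k n → suc (2 * k) + (2 + n + k) + k ≡ n + (2 * suc (2 * k) + 1)
        arith = ℕR.solve-∀
      go : Blocks (2 * M) ((a + b) + (c + d)) (Quarters r₀ r₁ f₀ f₁) → Quad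
      go (is , R , p , l) with as , bs , refl , la ← splitLength M is (ℕₚ.≤-trans M≤ l) =
        block (expand els as) (sumBy val as) (real-expand els val real as)
          (trans (expand-length els (All.universal size as)) (trans (cong (_* 2) la) (ℕₚ.*-comm M 2)))
          (sumBy-∣ val (All.universal div as)) ,
        expand els bs ++ R , expand-rest els as bs ↭-refl p

    locate : Head r₀ → Head r₁ → Head f₀ → Head f₁ → Quad
    locate (x , u , p₀) (y , v , p₁) (e , w , q₀) (e′ , z , q₁)
      with All.all? (+ M ∣?_) r₀ | All.all? (+ M ∣?_) r₁ | All.all? (λ f → + M ∣? (e -ᶻ f)) f₁ | All.all? (λ f → + M ∣? (e -ᶻ f)) f₀
    ... | no ¬z₀ | _ | _ | _ = let x , u , ne , p = extract (Allₚ.¬All⇒Any¬ (+ M ∣?_) r₀ ¬z₀) in use p p₁ q₀ q₁ (inj₁ (inj₁ ne))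
    ... | yes _ | no ¬z₁ | _ | _ = let y , v , ne , p = extract (Allₚ.¬All⇒Any¬ (+ M ∣?_) r₁ ¬z₁) in use p₀ p q₀ q₁ (inj₁ (inj₂ ne))
    ... | yes _ | yes _ | no ¬c₁ | _ = let e′ , z , ne , p = extract (Allₚ.¬All⇒Any¬ (λ f → + M ∣? (e -ᶻ f)) f₁ ¬c₁) in use p₀ p₁ q₀ p (inj₂ ne)
    -- All of `f₁` agrees with `e` modulo `M` and `e″` does not, so `e″` in place of `e` differs
    -- from `e′`.
    ... | yes _ | yes _ | yes c₁ | no ¬c₀ =
      let e″ , w , ne , p = extract (Allₚ.¬All⇒Any¬ (λ f → + M ∣? (e -ᶻ f)) f₀ ¬c₀)
      in use p₀ p₁ p q₁ (inj₂ λ h → ne (∣-resp (lem e e′ e″) (∣-diff (All.head (Permₚ.All-resp-↭ (↭-sym q₁) c₁)) h)))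
      where
      lem : ∀ e e′ e″ → (e -ᶻ e′) -ᶻ (e″ -ᶻ e′) ≡ e -ᶻ e″
      lem = ℤR.solve-∀
    ... | yes z₀ | yes z₁ | yes c₁ | yes c₀ = constant e z₀ z₁ c₀ c₁

-- The groups as quotients of the integer model

lcms : List ℕ → ℕ
lcms = foldr lcm 1

lcms-least : ∀ {e xs} → All (ℕᵈ._∣ e) xs → lcms xs ℕᵈ.∣ e
lcms-least []       = ℕᵈ.1∣ _
lcms-least (p ∷ ps) = lcm-least p (lcms-least ps)

∣-lcms : ∀ {x xs} → x ∈ᴸ xs → x ℕᵈ.∣ lcms xs
∣-lcms {xs = x ∷ xs} (here refl) = m∣lcm[m,n] x (lcms xs)
∣-lcms {xs = y ∷ xs} (there p)   = ℕᵈ.∣-trans (∣-lcms p) (n∣lcm[m,n] y (lcms xs))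

-- Names for the three elements of the extremal sequence, so that multiplicities are counted on
-- names and not in the group.
data Kind : Set where
  zeroᵏ oneᵏ refᵏ : Kind

count : (Kind → ℕ) → List Kind → ℕ
count w []       = 0
count w (κ ∷ κs) = w κ + count w κs

count-++ : ∀ w κs ls → count w (κs ++ ls) ≡ count w κs + count w ls
count-++ w []       ls = refl
count-++ w (κ ∷ κs) ls = trans (cong (λ n → w κ + n) (count-++ w κs ls)) (sym (ℕₚ.+-assoc (w κ) _ _))

count-↭ : ∀ w {κs ls} → κs ↭ ls → count w κs ≡ count w ls
count-↭ w Perm.refl       = refl
count-↭ w (prep κ p)      = cong (λ n → w κ + n) (count-↭ w p)
count-↭ w (swap κ l p)    = trans (cong (λ n → w κ + (w l + n)) (count-↭ w p)) (lem (w κ) (w l) _)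
  where
  lem : ∀ a b c → a + (b + c) ≡ b + (a + c)
  lem = ℕR.solve-∀
count-↭ w (Perm.trans p q) = trans (count-↭ w p) (count-↭ w q)

count-replicate : ∀ w κ n → count w (replicate n κ) ≡ n * w κ
count-replicate w κ zero    = refl
count-replicate w κ (suc n) = cong (λ m → w κ + m) (count-replicate w κ n)

isZero isOne isRef : Kind → ℕ
isZero zeroᵏ = 1
isZero _     = 0
isOne oneᵏ   = 1
isOne _      = 0
isRef refᵏ   = 1
isRef _      = 0

count-total : ∀ κs → count isZero κs + (count isOne κs + count isRef κs) ≡ length κs
count-total []           = refl
count-total (zeroᵏ ∷ κs) = cong suc (count-total κs)
count-total (oneᵏ ∷ κs)  = trans (ℕₚ.+-suc _ _) (cong suc (count-total κs))
count-total (refᵏ ∷ κs)  = trans (trans (cong (λ n → count isZero κs + n) (ℕₚ.+-suc _ _)) (ℕₚ.+-suc _ _)) (cong suc (count-total κs))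

module Transfer (N : ℕ) {{N≢0 : NonZero N}} (c : ℤ) (N∣2c : + N ∣ c +ᶻ c) (G : FinGroup) where
  open FinGroup G hiding (_≟_)
  open Model N c N∣2c using (E; rot; ref; zprod; _≋_; _,_; ≋-refl; ≋-sym; ≋-trans; ·-congʳ; Good; good) renaming (_·_ to infixl 7 _·_)

  -- A homomorphism modulo `N` with trivial kernel, which is what lifts product-one sequences back
  -- to the group; `large` makes the search in `ord` long enough to find every order up to `2 * N`.
  record Representation : Set where
    field
      φ      : Carrier → E
      φ-ε    : φ ε ≡ rot 0ℤ
      φ-∙    : ∀ g h → φ (g ∙ h) ≋ φ g · φ h
      φ-ker  : ∀ g → φ g ≋ rot 0ℤ → g ≡ ε
      α τ    : Carrier
      φ-α    : φ α ≡ rot 1ℤ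
      φ-τ    : φ τ ≡ ref 0ℤ
      large  : 2 * N ≤ length elements

  module _ (rep : Representation) where
    open Representation rep

    ≡⇒≋ : ∀ {e f} → e ≡ f → e ≋ f
    ≡⇒≋ refl = ≋-refl

    φ-prod : ∀ T → φ (prod T) ≋ zprod (map φ T)
    φ-prod []      = ≡⇒≋ φ-ε
    φ-prod (g ∷ T) = ≋-trans (φ-∙ g (prod T)) (·-congʳ (φ g) (φ-prod T))

    φ-pow : ∀ g k → φ (pow g k) ≋ zprod (replicate k (φ g))
    φ-pow g zero    = ≡⇒≋ φ-ε
    φ-pow g (suc k) = ≋-trans (φ-∙ g (pow g k)) (·-congʳ (φ g) (φ-pow g k))

    φ-unit : ∀ g k → pow g k ≡ ε → rot 0ℤ ≋ zprod (replicate k (φ g))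
    φ-unit g k e = subst (_≋ zprod (replicate k (φ g))) (trans (cong φ e) φ-ε) (φ-pow g k)

    split-map : ∀ {A B : Set} (f : A → B) {xs ys zs} → xs ++ ys ≡ map f zs → ∃₂ λ us vs → xs ≡ map f us × ys ≡ map f vs × us ++ vs ≡ zs
    split-map f {[]}     {zs = zs}     eq = [] , zs , refl , eq , refl
    split-map f {x ∷ xs} {zs = z ∷ zs} eq with refl , eq′ ← ∷-injective eq with us , vs , refl , refl , refl ← split-map f {xs} eq′ =
      z ∷ us , vs , refl , refl , refl

    pull-back : ∀ {A B : Set} (f : A → B) {T U S} → T ++ U ↭ map f S → ∃₂ λ T₀ U₀ → T ≡ map f T₀ × T₀ ++ U₀ ↭ S
    pull-back f {T} {U} {S} p with zs , eq , q ← Permₚ.↭-map-inv f (↭-sym p) with us , vs , e , _ , refl ← split-map f {T} eq = us , vs , e , ↭-sym q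

    realise : ∀ {l S} → Good l (map φ S) → ∃ λ T → IsSubseq T S × length T ≡ l × ProductOne T
    realise (good T U p size (T′ , q , eq)) with T₀ , U₀ , refl , p₀ ← pull-back φ {T} p with T₁ , e , q₁ ← Permₚ.↭-map-inv φ (↭-sym q) =
      T₀ , (U₀ , p₀) , trans (sym (length-map φ T₀)) size , (T₁ , ↭-sym q₁ , φ-ker (prod T₁) (≋-trans (φ-prod T₁) (subst (λ t → zprod t ≋ rot 0ℤ) e eq)))

    kind : Kind → Carrier
    kind zeroᵏ = ε
    kind oneᵏ  = α
    kind refᵏ  = τ

    no-ref-product : ∀ κs → count isRef κs ≡ 0 → zprod (map φ (map kind κs)) ≡ rot (+ count isOne κs)
    no-ref-product []           _ = refl
    no-ref-product (zeroᵏ ∷ κs) h rewrite φ-ε | no-ref-product κs h = refl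
    no-ref-product (oneᵏ ∷ κs)  h rewrite φ-α | no-ref-product κs h = refl

    one-ref-product : ∀ κs → count isRef κs ≡ 1 → proj₂ (zprod (map φ (map kind κs))) ≡ true
    one-ref-product (zeroᵏ ∷ κs) h rewrite φ-ε = one-ref-product κs h
    one-ref-product (oneᵏ ∷ κs)  h rewrite φ-α = one-ref-product κs h
    one-ref-product (refᵏ ∷ κs)  h rewrite φ-τ | no-ref-product κs (ℕₚ.suc-injective h) = refl

    extremal : ℕ → List Kind
    extremal e = replicate (ℕ.pred e) zeroᵏ ++ (replicate (ℕ.pred N) oneᵏ ++ refᵏ ∷ [])

    -- A single reflection cannot cancel, so `τ` is not chosen; then `N` divides the number of
    -- chosen copies of `α`, which is below `N` and hence 0; and only e - 1 copies of 1 exist.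
    extremal-free : ∀ e κs U → κs ++ U ↭ extremal e → length κs ≡ suc (ℕ.pred e) → ¬ zprod (map φ (map kind κs)) ≋ rot 0ℤ
    extremal-free e κs U p l eq = go (count isRef κs) refl
      where
      bound : ∀ w (f : ℕ → ℕ → ℕ) → (∀ n n′ → n * w zeroᵏ + (n′ * w oneᵏ + (w refᵏ + 0)) ≡ f n n′) → count w κs ≤ f (ℕ.pred e) (ℕ.pred N)
      bound w f h = ℕₚ.≤-trans (ℕₚ.m≤m+n (count w κs) (count w U)) (ℕₚ.≤-reflexive (trans (sym (count-++ w κs U)) (trans (count-↭ w p)
        (trans (count-++ w (replicate (ℕ.pred e) zeroᵏ) _) (trans (cong₂ _+_ (count-replicate w zeroᵏ (ℕ.pred e)) (trans (count-++ w (replicate (ℕ.pred N) oneᵏ) _) (cong (_+ (w refᵏ + 0)) (count-replicate w oneᵏ (ℕ.pred N))))) (h _ _))))))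
      zeros≤ : count isZero κs ≤ ℕ.pred e
      zeros≤ = bound isZero (λ n _ → n) λ n n′ → lem n n′
        where
        lem : ∀ n n′ → n * 1 + (n′ * 0 + (0 + 0)) ≡ n
        lem = ℕR.solve-∀
      ones≤ : count isOne κs ≤ ℕ.pred N
      ones≤ = bound isOne (λ _ n → n) λ n n′ → lem n n′
        where
        lem : ∀ n n′ → n * 0 + (n′ * 1 + (0 + 0)) ≡ n′
        lem = ℕR.solve-∀
      ref≤ : count isRef κs ≤ 1
      ref≤ = bound isRef (λ _ _ → 1) λ n n′ → lem n n′
        where
        lem : ∀ n n′ → n * 0 + (n′ * 0 + (1 + 0)) ≡ 1
        lem = ℕR.solve-∀
      go : ∀ r → count isRef κs ≡ r → ⊥
      go 0 h = ℕₚ.<⇒≱ (ℕₚ.≤-reflexive (sym l)) (ℕₚ.≤-trans (ℕₚ.≤-reflexive (trans (sym (count-total κs)) (trans (cong₂ (λ o r → count isZero κs + (o + r)) no-ones h) (ℕₚ.+-identityʳ _)))) zeros≤)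
        where
        N∣ones : + N ∣ + count isOne κs -ᶻ 0ℤ
        N∣ones = _≋_.val-≋ (subst (_≋ rot 0ℤ) (no-ref-product κs h) eq)
        no-ones : count isOne κs ≡ 0
        no-ones = sym (Residue.∣-small N {0} {count isOne κs} (ℕ.>-nonZero⁻¹ N) (ℕₚ.≤-trans (s≤s ones≤) (ℕₚ.≤-reflexive (ℕₚ.suc-pred N))) z≤n N∣ones)
      go 1 h = case trans (sym (one-ref-product κs h)) (_≋_.sign-≡ eq) of λ ()
      go (suc (suc r)) h = ℕₚ.<⇒≱ (s≤s (s≤s z≤n)) (subst (_≤ 1) h ref≤)

    lower-bound : .{{_ : NonZero exp}} → ∀ m → SProp m → exp + N ≤ m
    lower-bound m sprop = ℕₚ.≮⇒≥ λ m< → refute (sprop (map kind (extremal exp)) (ℕ.s≤s⁻¹ (ℕₚ.≤-trans m< (ℕₚ.≤-reflexive (sym len)))))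
      where
      len : suc (length (map kind (extremal exp))) ≡ exp + N
      len = trans (cong suc (trans (length-map kind (extremal exp)) (trans (length-++ (replicate (ℕ.pred exp) zeroᵏ))
              (cong₂ _+_ (length-replicate (ℕ.pred exp)) (trans (length-++ (replicate (ℕ.pred N) oneᵏ)) (trans (cong (_+ 1) (length-replicate (ℕ.pred N))) (trans (ℕₚ.+-comm _ 1) (ℕₚ.suc-pred N))))))))
              (cong (_+ N) (ℕₚ.suc-pred exp))
      refute : (∃ λ T → IsSubseq T (map kind (extremal exp)) × length T ≡ exp × ProductOne T) → ⊥
      refute (T , (U , p) , l , T′ , q , e) with κs , us , refl , p′ ← pull-back kind {T} p with κs′ , refl , q′ ← Permₚ.↭-map-inv kind (↭-sym q) =
        extremal-free exp κs′ us (↭-trans (Permₚ.++⁺ʳ us (↭-sym q′)) p′)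
          (trans (sym (Permₚ.↭-length q′)) (trans (sym (length-map kind κs)) (trans l (sym (ℕₚ.suc-pred exp)))))
          (≋-trans (≋-sym (φ-prod (map kind κs′))) (≡⇒≋ (trans (cong φ e) φ-ε)))

    -- The lower end `k` varies because `ordFrom` raises it while searching; `j` is a known exponent
    -- that annihilates `g` and so bounds the search.
    record OrdSpec (g : Carrier) (k j d : ℕ) : Set where
      field
        ≥k   : k ≤ d
        ≤j   : d ≤ j
        unit : pow g d ≡ ε
        min  : ∀ i → k ≤ i → i < d → pow g i ≢ ε

    ordFrom-spec : ∀ g k f j → k ≤ j → j < k + f → pow g j ≡ ε → OrdSpec g k j (ordFrom g k f)
    ordFrom-spec g k zero    j k≤j j< e = contradiction k≤j (ℕₚ.<⇒≱ (subst (j <_) (ℕₚ.+-identityʳ k) j<))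
    ordFrom-spec g k (suc f) j k≤j j< e with FinGroup._≟_ G (pow g k) ε
    ... | yes p = record { ≥k = ℕₚ.≤-refl ; ≤j = k≤j ; unit = p ; min = λ i k≤i i<k → contradiction k≤i (ℕₚ.<⇒≱ i<k) }
    ... | no ¬p with ordFrom-spec g (suc k) f j (ℕₚ.≤∧≢⇒< k≤j λ { refl → ¬p e }) (subst (j <_) (ℕₚ.+-suc k f) j<) e
    ...   | record { ≥k = a ; ≤j = b ; unit = u ; min = m } = record { ≥k = ℕₚ.<⇒≤ a ; ≤j = b ; unit = u ; min = min′ }
      where
      min′ : ∀ i → k ≤ i → i < ordFrom g (suc k) f → pow g i ≢ ε
      min′ i k≤i i<d with k ℕₚ.≟ i
      ... | yes refl = ¬p
      ... | no k≢i = m i (ℕₚ.≤∧≢⇒< k≤i k≢i) i<d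

    ord-spec : ∀ g j → 1 ≤ j → j ≤ 2 * N → pow g j ≡ ε → OrdSpec g 1 j (ord g)
    ord-spec g j 1≤j j≤ = ordFrom-spec g 1 (length elements) j 1≤j (s≤s (ℕₚ.≤-trans j≤ large))

    pow-rot : ∀ g x → φ g ≡ rot x → ∀ k → φ (pow g k) ≋ rot (+ k *ᶻ x)
    pow-rot g x e zero    = ≡⇒≋ (trans φ-ε refl)
    pow-rot g x e (suc k) = ≋-trans (φ-∙ g (pow g k)) (≋-trans (·-congʳ (φ g) (pow-rot g x e k)) (≡⇒≋ (trans (cong (_· rot (+ k *ᶻ x)) e) (cong rot (lem (+ k) x)))))
      where
      lem : ∀ k x → x +ᶻ k *ᶻ x ≡ (1ℤ +ᶻ k) *ᶻ x
      lem = ℤR.solve-∀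

    pow-unit : ∀ g x → φ g ≡ rot x → ∀ k → + N ∣ + k *ᶻ x → pow g k ≡ ε
    pow-unit g x e k d = φ-ker (pow g k) (≋-trans (pow-rot g x e k) (∣-resp (sym (ℤₚ.+-identityʳ _)) d , refl))

    unit-pow : ∀ g x → φ g ≡ rot x → ∀ k → pow g k ≡ ε → + N ∣ + k *ᶻ x
    unit-pow g x e k u = ∣-resp (lem (proj₁ (φ (pow g k))) (+ k *ᶻ x)) (∣-diff (subst (λ f → + N ∣ proj₁ f) (sym (trans (cong φ u) φ-ε)) ∣-zero) (_≋_.val-≋ (pow-rot g x e k)))
      where
      lem : ∀ a b → a -ᶻ (a -ᶻ b) ≡ b
      lem = ℤR.solve-∀

    ord-rot : ∀ g x → φ g ≡ rot x → OrdSpec g 1 N (ord g)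
    ord-rot g x e = ord-spec g N (ℕ.>-nonZero⁻¹ N) (ℕₚ.m≤m+n N _) (pow-unit g x e N (∣-resp (ℤₚ.*-comm x (+ N)) (∣-self x)))

    -- The remainder of `l` modulo the order again annihilates `g`, so by minimality it is 0.
    ord-rot-∣ : ∀ g x → φ g ≡ rot x → ∀ l → N ℕᵈ.∣ l → ord g ℕᵈ.∣ l
    ord-rot-∣ g x e l N∣l = ℕᵈ.m%n≡0⇒n∣m l d (r≡0 (l ℕᵐ.% d) refl)
      where
      open OrdSpec (ord-rot g x e)
      d = ord g
      instance
        d≢0 : NonZero d
        d≢0 = ℕ.>-nonZero ≥k
      remainder : + N ∣ + (l ℕᵐ.% d) *ᶻ x
      remainder = ∣-resp (trans (cong (λ t → t *ᶻ x -ᶻ + (l ℕᵐ./ d) *ᶻ (+ d *ᶻ x)) (trans (cong +_ (ℕᵐ.m≡m%n+[m/n]*n l d)) (cong (λ t → + (l ℕᵐ.% d) +ᶻ t) (pos-* (l ℕᵐ./ d) d)))) (lem (+ (l ℕᵐ.% d)) (+ (l ℕᵐ./ d)) (+ d) x))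
        (∣-diff (∣m⇒∣m*n {+ N} {+ l} x (∣ᵤ⇒∣ N∣l)) (∣-mul (+ (l ℕᵐ./ d)) (unit-pow g x e d unit)))
        where
        lem : ∀ r q d x → (r +ᶻ q *ᶻ d) *ᶻ x -ᶻ q *ᶻ (d *ᶻ x) ≡ r *ᶻ x
        lem = ℤR.solve-∀
      r≡0 : ∀ r → l ℕᵐ.% d ≡ r → l ℕᵐ.% d ≡ 0
      r≡0 zero    eq = eq
      r≡0 (suc r) eq = contradiction (pow-unit g x e (l ℕᵐ.% d) remainder) (min (l ℕᵐ.% d) (subst (1 ≤_) (sym eq) (s≤s z≤n)) (ℕᵐ.m%n<n l d))

    N∣exp : N ℕᵈ.∣ exp
    N∣exp = ℕᵈ.∣-trans (∣⇒∣ᵤ (∣-resp (ℤₚ.*-identityʳ (+ ord α)) (unit-pow α 1ℤ φ-α (ord α) (OrdSpec.unit (ord-rot α 1ℤ φ-α))))) (∣-lcms (∈-map⁺ ord (complete α)))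

    exp-∣ : ∀ l → (∀ g → ord g ℕᵈ.∣ l) → exp ℕᵈ.∣ l
    exp-∣ l h = lcms-least (Allₚ.map⁺ (All.universal h elements))

    isS : ∀ {e} → 0 < e → exp ≡ e → (∀ S → e + N ≤ length S → Good e (map φ S)) → IsS (e + N)
    isS 0<e refl upper = (λ S le → realise (upper S le)) , lower-bound {{ℕ.>-nonZero 0<e}}

module CyclicArithmetic (N : ℕ) {{N≢0 : NonZero N}} where
  open import Defs using (_⊕_; ⊖_; [_])

  %-∣ : ∀ m → + N ∣ + (m ℕᵐ.% N) -ᶻ + m
  %-∣ m = divides (-ᶻ + (m ℕᵐ./ N)) (trans (cong (λ t → + (m ℕᵐ.% N) -ᶻ t) (trans (cong +_ (ℕᵐ.m≡m%n+[m/n]*n m N)) (cong (λ t → + (m ℕᵐ.% N) +ᶻ t) (pos-* (m ℕᵐ./ N) N)))) (lem (+ (m ℕᵐ.% N)) (+ (m ℕᵐ./ N)) (+ N)))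
    where
    lem : ∀ r q n → r -ᶻ (r +ᶻ q *ᶻ n) ≡ (-ᶻ q) *ᶻ n
    lem = ℤR.solve-∀

  val : Fin N → ℤ
  val i = + toℕ i

  val-⊕ : ∀ i j → + N ∣ val (i ⊕ j) -ᶻ (val i +ᶻ val j)
  val-⊕ i j = ∣-resp (cong (λ t → + t -ᶻ (val i +ᶻ val j)) (sym (Finₚ.toℕ-fromℕ< _))) (%-∣ (toℕ i + toℕ j))

  val-⊖ : ∀ j → + N ∣ val (⊖ j) -ᶻ (-ᶻ val j)
  val-⊖ j = ∣-resp (trans (cong (λ t → + ((N ∸ toℕ j) ℕᵐ.% N) -ᶻ t +ᶻ + N) (pos-∸)) (trans (lem (+ ((N ∸ toℕ j) ℕᵐ.% N)) (+ N) (val j)) (cong (λ t → + t -ᶻ (-ᶻ val j)) (sym (Finₚ.toℕ-fromℕ< _)))))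
    (∣-sum (%-∣ (N ∸ toℕ j)) ∣-refl)
    where
    pos-∸ : + (N ∸ toℕ j) ≡ + N -ᶻ val j
    pos-∸ = sym (trans (ℤₚ.[+m]-[+n]≡m⊖n N (toℕ j)) (ℤₚ.⊖-≥ (ℕₚ.<⇒≤ (Finₚ.toℕ<n j))))
    lem : ∀ r n j → r -ᶻ (n -ᶻ j) +ᶻ n ≡ r -ᶻ (-ᶻ j)
    lem = ℤR.solve-∀

  val-[] : ∀ m → + N ∣ val [ m ] -ᶻ + m
  val-[] m = ∣-resp (cong (λ t → + t -ᶻ + m) (sym (Finₚ.toℕ-fromℕ< _))) (%-∣ m)

  val-small : ∀ m → m < N → val [ m ] ≡ + m
  val-small m m<N = cong +_ (trans (Finₚ.toℕ-fromℕ< _) (ℕᵐ.m<n⇒m%n≡m m<N))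

  val-zero : ∀ i → + N ∣ val i -ᶻ 0ℤ → i ≡ [ 0 ]
  val-zero i d = Finₚ.toℕ-injective (trans (sym (Residue.∣-small N (ℕ.>-nonZero⁻¹ N) (Finₚ.toℕ<n i) z≤n d)) (sym (ℤₚ.+-injective (val-small 0 (ℕ.>-nonZero⁻¹ N)))))

  elems-length : length (elemsFinBool N) ≡ N * 2
  elems-length = trans (pairs (allFin N)) (cong (_* 2) (length-tabulate {n = N} (λ i → i)))
    where
    pairs : ∀ (is : List (Fin N)) → length (cartesianProduct is (false ∷ true ∷ [])) ≡ length is * 2
    pairs []       = refl
    pairs (_ ∷ is) = cong (suc ∘ suc) (pairs is)

module DihedralRep (N : ℕ) {{N≢0 : NonZero N}} (1<N : 1 < N) where
  open import Defs using (_⊕_; ⊖_; [_])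
  open CyclicArithmetic N
  open Model N 0ℤ ∣-zero using (rot; ref; _≋_; _,_; ≋-trans; ·-congʳ)
  open Transfer N 0ℤ ∣-zero (Dihedral N)
  open FinGroup (Dihedral N)

  dihedral : Representation
  dihedral = record
    { φ = λ (i , b) → val i , b
    ; φ-ε = cong rot (val-small 0 (ℕₚ.<-trans (s≤s z≤n) 1<N))
    ; φ-∙ = mult
    ; φ-ker = λ { (i , false) (d , refl) → cong (_, false) (val-zero i d) }
    ; α = [ 1 ] , false
    ; τ = [ 0 ] , true
    ; φ-α = cong rot (val-small 1 1<N)
    ; φ-τ = cong ref (val-small 0 (ℕₚ.<-trans (s≤s z≤n) 1<N))
    ; large = ℕₚ.≤-reflexive (trans (ℕₚ.*-comm 2 N) (sym elems-length))
    }
    where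
    minus : ∀ i j → + N ∣ val (i ⊕ (⊖ j)) -ᶻ (val i -ᶻ val j)
    minus i j = ∣-resp (lem (val (i ⊕ (⊖ j))) (val i) (val (⊖ j)) (val j)) (∣-sum (val-⊕ i (⊖ j)) (val-⊖ j))
      where
      lem : ∀ s i m j → (s -ᶻ (i +ᶻ m)) +ᶻ (m -ᶻ (-ᶻ j)) ≡ s -ᶻ (i -ᶻ j)
      lem = ℤR.solve-∀
    mult : ∀ g h → _ ≋ _
    mult (i , false) (j , b)     = val-⊕ i j , refl
    mult (i , true)  (j , false) = minus i j , refl
    mult (i , true)  (j , true)  = ∣-resp (cong (λ t → val (i ⊕ (⊖ j)) -ᶻ t) (sym (ℤₚ.+-identityʳ (val i -ᶻ val j)))) (minus i j) , refl

  open Representation dihedral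

  ref-square : ∀ i → pow (i , true) 2 ≡ ε
  ref-square i = φ-ker (pow (i , true) 2) (≋-trans (φ-pow dihedral (i , true) 2) (∣-resp (lem (val i)) ∣-zero , refl))
    where
    lem : ∀ x → 0ℤ ≡ x -ᶻ (x -ᶻ 0ℤ) +ᶻ 0ℤ -ᶻ 0ℤ
    lem = ℤR.solve-∀

  ref-order : ∀ i → ord (i , true) ≡ 2
  ref-order i = two _ refl
    where
    open OrdSpec (ord-spec dihedral (i , true) 2 (s≤s z≤n) (ℕₚ.≤-trans (s≤s (s≤s z≤n)) (ℕₚ.*-monoʳ-≤ 2 (ℕₚ.<⇒≤ 1<N))) (ref-square i))
    two : ∀ d → ord (i , true) ≡ d → d ≡ 2
    two 0 e = contradiction (subst (1 ≤_) e ≥k) λ ()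
    two 1 e = case _≋_.sign-≡ (φ-unit dihedral (i , true) 1 (subst (λ d → pow (i , true) d ≡ ε) e unit)) of λ ()
    two 2 e = refl
    two (suc (suc (suc d))) e = contradiction (subst (_≤ 2) e ≤j) λ { (s≤s (s≤s ())) }

  exp-divides : ∀ l → N ℕᵈ.∣ l → 2 ℕᵈ.∣ l → exp ℕᵈ.∣ l
  exp-divides l N∣l 2∣l = exp-∣ dihedral l λ where
    (i , false) → ord-rot-∣ dihedral (i , false) (val i) refl l N∣l
    (i , true)  → subst (ℕᵈ._∣ l) (sym (ref-order i)) 2∣l

  2∣exp : 2 ℕᵈ.∣ exp
  2∣exp = subst (ℕᵈ._∣ exp) (ref-order [ 0 ]) (∣-lcms (∈-map⁺ ord (complete ([ 0 ] , true))))

-- The divisibility proof is a parameter so that the representation maps into the very model in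
-- which the respective upper bound is proved.
module DicyclicRep (n : ℕ) {{n≢0 : NonZero n}} (N∣2n : + (2 * n) ∣ + n +ᶻ + n) where
  open import Defs using (_⊕_; ⊖_; [_])
  N : ℕ
  N = 2 * n

  instance
    N≢0 : NonZero N
    N≢0 = ℕₚ.m*n≢0 2 n

  n<N : n < N
  n<N = ℕₚ.m<m+n n (subst (0 <_) (sym (ℕₚ.+-identityʳ n)) (ℕ.>-nonZero⁻¹ n))

  1<N : 1 < N
  1<N = ℕₚ.≤-<-trans (ℕ.>-nonZero⁻¹ n) n<N

  open CyclicArithmetic N
  open Model N (+ n) N∣2n using (rot; ref; _≋_; _,_; ≋-trans; ·-congʳ; zprod)
  open Transfer N (+ n) N∣2n (Dicyclic n)
  open FinGroup (Dicyclic n)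

  dicyclic : Representation
  dicyclic = record
    { φ = λ (i , b) → val i , b
    ; φ-ε = cong rot (val-small 0 (ℕₚ.<-trans (s≤s z≤n) 1<N))
    ; φ-∙ = mult
    ; φ-ker = λ { (i , false) (d , refl) → cong (_, false) (val-zero i d) }
    ; α = [ 1 ] , false
    ; τ = [ 0 ] , true
    ; φ-α = cong rot (val-small 1 1<N)
    ; φ-τ = cong ref (val-small 0 (ℕₚ.<-trans (s≤s z≤n) 1<N))
    ; large = ℕₚ.≤-reflexive (trans (ℕₚ.*-comm 2 N) (sym elems-length))
    }
    where
    minus : ∀ i j → + N ∣ val (i ⊕ (⊖ j)) -ᶻ (val i -ᶻ val j)
    minus i j = ∣-resp (lem (val (i ⊕ (⊖ j))) (val i) (val (⊖ j)) (val j)) (∣-sum (val-⊕ i (⊖ j)) (val-⊖ j))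
      where
      lem : ∀ s i m j → (s -ᶻ (i +ᶻ m)) +ᶻ (m -ᶻ (-ᶻ j)) ≡ s -ᶻ (i -ᶻ j)
      lem = ℤR.solve-∀
    mult : ∀ g h → _ ≋ _
    mult (i , false) (j , b)     = val-⊕ i j , refl
    mult (i , true)  (j , false) = minus i j , refl
    mult (i , true)  (j , true)  = ∣-resp (lem (val ((i ⊕ (⊖ j)) ⊕ [ n ])) (val (i ⊕ (⊖ j))) (val [ n ]) (val i -ᶻ val j) (+ n))
      (∣-sum (∣-sum (val-⊕ (i ⊕ (⊖ j)) [ n ]) (minus i j)) (val-[] n)) , refl
      where
      lem : ∀ s a m d n → (s -ᶻ (a +ᶻ m)) +ᶻ (a -ᶻ d) +ᶻ (m -ᶻ n) ≡ s -ᶻ (d +ᶻ n)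
      lem = ℤR.solve-∀

  open Representation dicyclic

  ref-fourth : ∀ i → pow (i , true) 4 ≡ ε
  ref-fourth i = φ-ker (pow (i , true) 4) (≋-trans (φ-pow dicyclic (i , true) 4) (∣-resp (lem (val i) (+ n)) N∣2n , refl))
    where
    lem : ∀ x c → c +ᶻ c ≡ x -ᶻ (x -ᶻ (x -ᶻ (x -ᶻ 0ℤ) +ᶻ c)) +ᶻ c -ᶻ 0ℤ
    lem = ℤR.solve-∀

  -- Odd powers of αⁱτ are reflections, and its square is αⁿ, which is nontrivial because 0 < n < N.
  ref-order : 4 ≤ 2 * N → ∀ i → ord (i , true) ≡ 4
  ref-order 4≤ i = four _ refl
    where
    open OrdSpec (ord-spec dicyclic (i , true) 4 (s≤s z≤n) 4≤ (ref-fourth i))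
    lem : ∀ x c → -ᶻ (0ℤ -ᶻ (x -ᶻ (x -ᶻ 0ℤ) +ᶻ c)) ≡ c -ᶻ 0ℤ
    lem = ℤR.solve-∀
    not-odd : ∀ d → ord (i , true) ≡ d → proj₂ (zprod (replicate d (val i , true))) ≡ true → ⊥
    not-odd d e t = case trans (_≋_.sign-≡ (φ-unit dicyclic (i , true) d (subst (λ d → pow (i , true) d ≡ ε) e unit))) t of λ ()
    four : ∀ d → ord (i , true) ≡ d → d ≡ 4
    four 0 e = contradiction (subst (1 ≤_) e ≥k) λ ()
    four 1 e = ⊥-elim (not-odd 1 e refl)
    four 2 e = contradiction (Residue.∣-small N (ℕ.>-nonZero⁻¹ N) n<N z≤n
      (∣-resp (lem (val i) (+ n)) (∣-neg (_≋_.val-≋ (φ-unit dicyclic (i , true) 2 (subst (λ d → pow (i , true) d ≡ ε) e unit))))))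
      λ 0≡n → ℕₚ.<⇒≢ (ℕ.>-nonZero⁻¹ n) 0≡n
    four 3 e = ⊥-elim (not-odd 3 e refl)
    four 4 e = refl
    four (suc (suc (suc (suc (suc d))))) e = contradiction (subst (_≤ 4) e ≤j) λ { (s≤s (s≤s (s≤s (s≤s ())))) }

  4≤2N : 4 ≤ 2 * N
  4≤2N = ℕₚ.*-monoʳ-≤ 2 1<N

  exp-divides : ∀ l → N ℕᵈ.∣ l → 4 ℕᵈ.∣ l → exp ℕᵈ.∣ l
  exp-divides l N∣l 4∣l = exp-∣ dicyclic l λ where
    (i , false) → ord-rot-∣ dicyclic (i , false) (val i) refl l N∣l
    (i , true)  → subst (ℕᵈ._∣ l) (sym (ref-order 4≤2N i)) 4∣l

  4∣exp : 4 ℕᵈ.∣ exp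
  4∣exp = subst (ℕᵈ._∣ exp) (ref-order 4≤2N [ 0 ]) (∣-lcms (∈-map⁺ ord (complete ([ 0 ] , true))))

-- The values of the invariant in the four cases

prime-factor : ∀ m → 1 < m → ∃₂ λ p q → Prime p × m ≡ q * p
prime-factor m 1<m = go (PrimeFactorisation.factors f) (PrimeFactorisation.isFactorisation f) (PrimeFactorisation.factorsPrime f)
  where
  instance
    m≢0 : NonZero m
    m≢0 = ℕ.>-nonZero (ℕₚ.<-trans (s≤s z≤n) 1<m)
  f = factorise m
  go : ∀ ps → m ≡ product ps → All Prime ps → ∃₂ λ p q → Prime p × m ≡ q * p
  go []       e _        = contradiction e λ { refl → ℕₚ.<-irrefl refl 1<m }
  go (p ∷ ps) e (pr ∷ _) = p , product ps , pr , trans e (ℕₚ.*-comm p _)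

pos-∣ : ∀ {a b} → a ℕᵈ.∣ b → + a ∣ + b
pos-∣ = ∣ᵤ⇒∣

2∤odd : ∀ k → ¬ 2 ℕᵈ.∣ suc (2 * k)
2∤odd k d with ℕᵈ.∣m+n∣m⇒∣n (subst (2 ℕᵈ.∣_) (ℕₚ.+-comm 1 (2 * k)) d) (ℕᵈ.m∣m*n k)
... | d′ = contradiction (ℕᵈ.∣⇒≤ d′) λ { (s≤s ()) }

odd-form : ∀ n → ¬ 2 ℕᵈ.∣ n → ∃ λ k → n ≡ suc (2 * k)
odd-form n 2∤n with even-or-odd n
... | k , inj₁ e = contradiction (subst (2 ℕᵈ.∣_) (sym e) (ℕᵈ.m∣m*n k)) 2∤n
... | k , inj₂ e = k , e

module _ (k : ℕ) (1≤k : 1 ≤ k) where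
  open Odd k

  private
    three : ∀ m → 2 * m + m ≡ 3 * m
    three = ℕR.solve-∀

  odd-dihedral-s : FinGroup.IsS (Dihedral M) (3 * M)
  odd-dihedral-s = subst (FinGroup.IsS (Dihedral M)) (three M) (Transfer.isS M 0ℤ ∣-zero (Dihedral M) dihedral (s≤s z≤n) exp≡ upper)
    where
    open DihedralRep M (s≤s (ℕₚ.≤-trans 1≤k (ℕₚ.m≤m+n k _)))
    open FinGroup (Dihedral M) using (exp)
    open Model M 0ℤ ∣-zero
    open OddDihedral k 1≤k
    open Transfer.Representation dihedral using (φ)
    exp≡ : exp ≡ 2 * M
    exp≡ = ℕᵈ.∣-antisym (exp-divides (2 * M) (ℕᵈ.n∣m*n 2) (ℕᵈ.m∣m*n M)) (∣⇒∣ᵤ (double-∣ (pos-∣ 2∣exp) (pos-∣ (Transfer.N∣exp M 0ℤ ∣-zero (Dihedral M) dihedral))))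
    upper : ∀ S → 2 * M + M ≤ length S → Good (2 * M) (map φ S)
    upper S le = good-exact odd-dihedral (map φ S) (subst₂ _≤_ (three M) (sym (length-map φ S)) le)

  odd-dicyclic-s : FinGroup.IsS (Dicyclic M) (6 * M)
  odd-dicyclic-s = subst (FinGroup.IsS (Dicyclic M)) (six M) (Transfer.isS N (+ M) N∣2M (Dicyclic M) dicyclic (s≤s z≤n) exp≡ upper)
    where
    open OddDicyclic k 1≤k
    open OddDicyclicBound k 1≤k
    open DicyclicRep M N∣2M hiding (N)
    open FinGroup (Dicyclic M) using (exp)
    open Model N (+ M) N∣2M
    open Transfer.Representation dicyclic using (φ)
    six : ∀ m → 2 * (2 * m) + 2 * m ≡ 6 * m
    six = ℕR.solve-∀
    exp≡ : exp ≡ 2 * N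
    exp≡ = ℕᵈ.∣-antisym (exp-divides (2 * N) (ℕᵈ.n∣m*n 2) (subst (4 ℕᵈ.∣_) (ℕₚ.*-assoc 2 2 M) (ℕᵈ.m∣m*n M)))
      (lem 4∣exp (ℕᵈ.∣-trans (ℕᵈ.n∣m*n 2) (Transfer.N∣exp N (+ M) N∣2M (Dicyclic M) dicyclic)))
      where
      lem : ∀ {e} → 4 ℕᵈ.∣ e → M ℕᵈ.∣ e → 2 * N ℕᵈ.∣ e
      -- For e = 4q, oddness of `M` turns M ∣ 4q into M ∣ 2q; then 2M divides 2q and 4M divides 4q.
      lem (ℕᵈ.divides q refl) d = subst (2 * N ℕᵈ.∣_) (trans (sym (ℕₚ.*-assoc 2 2 q)) (ℕₚ.*-comm 4 q)) (ℕᵈ.*-monoʳ-∣ 2 (∣⇒∣ᵤ (double-∣ {+ (2 * q)} (pos-∣ (ℕᵈ.m∣m*n q))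
        (half {z = + (2 * q)} ∣-refl (∣-resp (cong +_ (eq q)) (pos-∣ d))))))
        where
        eq : ∀ q → q * 4 ≡ 2 * q + 2 * q
        eq = ℕR.solve-∀
    upper : ∀ S → 2 * N + N ≤ length S → Good (2 * N) (map φ S)
    upper S le = good-exact odd-dicyclic (map φ S) (subst₂ _≤_ (six M) (sym (length-map φ S)) le)

-- With s = 2m and base length 2s, extracting 2q - 1 blocks needs 2s + (2q - 2)s = 2N terms, so the
-- bound is met exactly.
combine-bound : ∀ m q N s → N ≡ q * (2 * m) → N + N ≤ s → 4 * m + (q + q) * (2 * m) ≤ s + (2 * m + 2 * m)
combine-bound m q _ s refl le = ≤-by 0 le (lem m q s)
  where
  lem : ∀ m q s → 4 * m + (q + q) * (2 * m) + s + 0 ≡ s + (2 * m + 2 * m) + (q * (2 * m) + q * (2 * m))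
  lem = ℕR.solve-∀

-- Either 4 divides `n`, or n/2 is odd; in the latter case n/2 exceeds 1 because n ≥ 3, and so it
-- has an odd prime factor.
even-dihedral-good : ∀ n .{{_ : NonZero n}} → 3 ≤ n → 2 ℕᵈ.∣ n → ∀ S → n + n ≤ length S → Model.Good n 0ℤ ∣-zero n S
even-dihedral-good n 3≤n (ℕᵈ.divides m refl) S le = go (even-or-odd m)
  where
  q≢0 : ∀ q p → m ≡ q * p → NonZero q
  q≢0 q p e = ℕ.≢-nonZero λ { refl → case subst (λ m → 3 ≤ m * 2) e 3≤n of λ () }
  open Even (m * 2) 0ℤ ∣-zero ∣-zero
  go : (∃ λ i → m ≡ 2 * i ⊎ m ≡ suc (2 * i)) → Model.Good (m * 2) 0ℤ ∣-zero (m * 2) S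
  go (q , inj₁ e) = combine 4 q 8 {{q≢0 q 2 (trans e (ℕₚ.*-comm 2 q))}} eq (even-base 2 odd-case-2) S (combine-bound 2 q (m * 2) (length S) eq le)
    where
    lem : ∀ q → 2 * q * 2 ≡ q * 4
    lem = ℕR.solve-∀
    eq : m * 2 ≡ q * 4
    eq = trans (cong (_* 2) e) (lem q)
  go (k , inj₂ e) with prime-factor m (ℕₚ.*-cancelʳ-< 2 1 m 3≤n)
  ... | p , q , pr , m≡qp with odd-form p (λ 2∣p → 2∤odd k (subst (2 ℕᵈ.∣_) (trans (sym m≡qp) e) (ℕᵈ.∣n⇒∣m*n q 2∣p)))
  ... | zero  , refl = contradiction pr ¬prime[1]
  ... | suc h , refl = combine (2 * P) q (4 * P) {{q≢0 q P m≡qp}} eq (even-base P (PrimeBase.odd-case (suc h) (s≤s z≤n) pr (m * 2))) S (combine-bound P q (m * 2) (length S) eq le)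
    where
    P = suc (2 * suc h)
    eq : m * 2 ≡ q * (2 * P)
    eq = trans (cong (_* 2) m≡qp) (trans (ℕₚ.*-assoc q P 2) (cong (q *_) (ℕₚ.*-comm P 2)))

even-dihedral-s : ∀ n .{{_ : NonZero n}} → 3 ≤ n → 2 ℕᵈ.∣ n → FinGroup.IsS (Dihedral n) (2 * n)
even-dihedral-s n@(suc _) 3≤n 2∣n = subst (FinGroup.IsS (Dihedral n)) (cong (λ t → n + t) (sym (ℕₚ.+-identityʳ n)))
  (Transfer.isS n 0ℤ ∣-zero (Dihedral n) dihedral (s≤s z≤n) exp≡ λ S le → even-dihedral-good n 3≤n 2∣n _ (ℕₚ.≤-trans le (ℕₚ.≤-reflexive (sym (length-map _ S)))))
  where
  open DihedralRep n (ℕₚ.<-trans (s≤s (s≤s z≤n)) 3≤n)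
  exp≡ : FinGroup.exp (Dihedral n) ≡ n
  exp≡ = ℕᵈ.∣-antisym (exp-divides n ℕᵈ.∣-refl 2∣n) (Transfer.N∣exp n 0ℤ ∣-zero (Dihedral n) dihedral)

even-dicyclic-s : ∀ n .{{_ : NonZero n}} → 2 ℕᵈ.∣ n → FinGroup.IsS (Dicyclic n) (4 * n)
even-dicyclic-s n@(suc _) 2∣n@(ℕᵈ.divides q eq) = subst (FinGroup.IsS (Dicyclic n)) (four n)
  (Transfer.isS N (+ n) N∣2n (Dicyclic n) dicyclic (s≤s z≤n) exp≡ upper)
  where
  four : ∀ n → 2 * n + 2 * n ≡ 4 * n
  four = ℕR.solve-∀
  N∣2n : + (2 * n) ∣ + n +ᶻ + n
  N∣2n = divides 1ℤ (trans (cong (λ m → + (n + m)) (sym (ℕₚ.+-identityʳ n))) (sym (ℤₚ.*-identityˡ (+ (2 * n)))))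
  open DicyclicRep n N∣2n
  open Even N (+ n) N∣2n (∣ᵤ⇒∣ 2∣n)
  4∣N : 4 ℕᵈ.∣ N
  4∣N = ℕᵈ.*-monoʳ-∣ 2 2∣n
  exp≡ : FinGroup.exp (Dicyclic n) ≡ N
  exp≡ = ℕᵈ.∣-antisym (exp-divides N ℕᵈ.∣-refl 4∣N) (Transfer.N∣exp N (+ n) N∣2n (Dicyclic n) dicyclic)
  N≡ : N ≡ q * 4
  N≡ = trans (cong (2 *_) eq) (lem q)
    where
    lem : ∀ q → 2 * (q * 2) ≡ q * 4
    lem = ℕR.solve-∀
  q≢0 : NonZero q
  q≢0 = ℕ.≢-nonZero λ { refl → case eq of λ () }
  upper : ∀ S → N + N ≤ length S → Model.Good N (+ n) N∣2n N (map (Transfer.Representation.φ dicyclic) S)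
  upper S le = combine 4 q 8 {{q≢0}} N≡ (even-base 2 odd-case-2) _ (combine-bound 2 q N _ N≡ (ℕₚ.≤-trans le (ℕₚ.≤-reflexive (sym (length-map _ S)))))

theorem1p1 : ((n : ℕ) .{{_ : NonZero n}} → 3 ≤ n →
    (¬ (2 ℕᵈ.∣ n) → FinGroup.IsS (Dihedral n) (3 * n))
    × (2 ℕᵈ.∣ n → FinGroup.IsS (Dihedral n) (2 * n)))
    × ((n : ℕ) .{{_ : NonZero n}} → 2 ≤ n →
    (¬ (2 ℕᵈ.∣ n) → FinGroup.IsS (Dicyclic n) (6 * n))
    × (2 ℕᵈ.∣ n → FinGroup.IsS (Dicyclic n) (4 * n)))
theorem1p1 = (λ n 3≤n → dihedral-odd n 3≤n , even-dihedral-s n 3≤n) , (λ n 2≤n → dicyclic-odd n 2≤n , even-dicyclic-s n)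
  where
  positive : ∀ k → 2 ≤ suc (2 * k) → 1 ≤ k
  positive zero    (s≤s ())
  positive (suc k) _ = s≤s z≤n
  dihedral-odd : ∀ n .{{_ : NonZero n}} → 3 ≤ n → ¬ 2 ℕᵈ.∣ n → FinGroup.IsS (Dihedral n) (3 * n)
  dihedral-odd n 3≤n 2∤n with k , refl ← odd-form n 2∤n = odd-dihedral-s k (positive k (ℕₚ.<⇒≤ 3≤n))
  dicyclic-odd : ∀ n .{{_ : NonZero n}} → 2 ≤ n → ¬ 2 ℕᵈ.∣ n → FinGroup.IsS (Dicyclic n) (6 * n)
  dicyclic-odd n 2≤n 2∤n with k , refl ← odd-form n 2∤n = odd-dicyclic-s k (positive k 2≤n)
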